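{- Let $q$ be a prime power and let $\ell, m$ be integers with $0 < \ell < m$. Let $(\bm{A}, \bm{B}, \pi)$ be the output of $\mathsf{GenPKP}(q,\ell,m,1)$, i.e.\ $\pi$ is uniformly random in $\mathbb{S}_m$, $\bm{B}$ is uniformly random in $\mathbb{F}_q^{m \times 1, 1}$ (independent of $\pi$), and, given $(\pi,\bm{B})$, $\bm{A}$ is uniformly random among the matrices in $\mathbb{F}_q^{\ell \times m, \ell}$ satisfying $\bm{A}\bm{\pi}\bm{B} = \bm{0}$. Then \[ \mathbb{E}[N_{\mathsf{sol}}(\bm{A}, \bm{B})] = \frac{m!(q^{m-\ell} - q)}{q^m - q} + \frac{m!(q^m - q^{m - \ell})}{(q^m - 1)(q^m - q)}\left(\sum_{d \mid q - 1} \varphi(d) \binom{\lfloor (q+m-1) / d\rfloor}{\lfloor m / d\rfloor} - q + 1\right). \]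
   Context: $\mathbb{F}_q$ is the finite field with $q$ elements. $\mathbb{F}_q^{a \times b, r}$ denotes the set of $a\times b$ matrices over $\mathbb{F}_q$ of rank exactly $r$ (so $\mathbb{F}_q^{m\times 1,1}$ is the set of nonzero column vectors of length $m$). $\mathbb{S}_m$ is the symmetric group on $\{1,\dots,m\}$; for $\pi\in\mathbb{S}_m$, $\bm{\pi}$ is the $m\times m$ permutation matrix with $(i,j)$ entry $\delta_{\pi(i),j}$. $N_{\mathsf{sol}}(\bm{A},\bm{B})$ is the number of $\rho\in\mathbb{S}_m$ with $\bm{A}\bm{\rho}\bm{B}=\bm{0}$. $\varphi$ is Euler's totient function and the sum runs over positive divisors $d$ of $q-1$. -}

module Defs where

open import Level using (0ℓ)
open import Data.Nat as ℕ using (ℕ; zero; suc; _∸_; _!)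
open import Data.Nat.DivMod using (_/_)
open import Data.Nat.ListAction using (sum)
open import Data.Nat.Divisibility using (_∣?_)
open import Data.Nat.GCD using (gcd)
open import Data.Nat.Combinatorics using (_C_)
open import Data.Integer using (+_)
open import Data.Rational as ℚ using (ℚ; 0ℚ)
open import Data.Rational.Properties using () renaming (_≟_ to _≟ℚ_)
open import Data.Fin as Fin using (Fin)
open import Data.Fin.Properties using () renaming (_≟_ to _≟F_)
open import Data.List as List using (List; []; _∷_; [_]; length; filter; cartesianProductWith; upTo; allFin)
open import Data.List.Membership.Propositional using (_∈_; lose)
open import Data.List.Membership.Propositional.Properties using (∈-cartesianProductWith⁺; ∈-allFin)
open import Data.List.Relation.Unary.All as All using (all?)
open import Data.List.Relation.Unary.Any as Any using (any?)
open import Data.List.Relation.Unary.Unique.Propositional using (Unique)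
open import Data.Vec as Vec using (Vec; lookup; tabulate; replicate)
open import Data.Vec.Properties using (≡-dec)
open import Data.Product using (Σ; ∃; _×_; _,_; proj₁; proj₂)
open import Data.Bool using (if_then_else_)
open import Algebra.Core using (Op₁; Op₂)
open import Algebra.Structures using (IsCommutativeRing)
open import Relation.Nullary using (Dec; yes; no; ¬_; does)
open import Relation.Nullary.Decidable using (_×-dec_; _→-dec_; ¬?)
open import Relation.Unary using (Pred; Decidable)
open import Relation.Binary.PropositionalEquality using (_≡_; _≢_; refl)
open import Relation.Binary.Definitions using (DecidableEquality)

record FiniteField : Set₁ where
  field
    Carrier  : Set
    _+_ _*_  : Op₂ Carrier
    -_       : Op₁ Carrier
    0# 1#    : Carrier
    isCommutativeRing : IsCommutativeRing _≡_ _+_ _*_ -_ 0# 1#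
    0≢1      : 0# ≢ 1#
    inverse  : ∀ x → x ≢ 0# → ∃ λ y → x * y ≡ 1#
    _≟_      : DecidableEquality Carrier
    elements : List Carrier
    complete : ∀ x → x ∈ elements
    unique   : Unique elements

  size : ℕ
  size = length elements

record Enum (A : Set) : Set where
  field
    list     : List A
    complete : ∀ x → x ∈ list
open Enum

∀? : ∀ {A : Set} {P : Pred A 0ℓ} → Enum A → Decidable P → Dec (∀ x → P x)
∀? {P = P} E P? with all? P? (list E)
... | yes a = yes λ x → All.lookup a (complete E x)
... | no ¬a = no λ f → ¬a (All.tabulate λ {x} _ → f x)

∃? : ∀ {A : Set} {P : Pred A 0ℓ} → Enum A → Decidable P → Dec (∃ P)
∃? {P = P} E P? with any? P? (list E)
... | yes a = yes (Any.satisfied a)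
... | no ¬a = no λ { (x , px) → ¬a (lose (complete E x) px) }

enumFin : ∀ n → Enum (Fin n)
enumFin n = record { list = allFin n ; complete = ∈-allFin }

-- all vectors of length n over an enumerated type (duplicate-free when
-- the underlying list is)
allVecs : ∀ {A : Set} → List A → ∀ n → List (Vec A n)
allVecs xs zero    = [ Vec.[] ]
allVecs xs (suc n) = cartesianProductWith Vec._∷_ xs (allVecs xs n)

allVecs-complete : ∀ {A : Set} (xs : List A) → (∀ x → x ∈ xs) → ∀ n (v : Vec A n) → v ∈ allVecs xs n
allVecs-complete xs c zero Vec.[] = Any.here refl
allVecs-complete xs c (suc n) (x Vec.∷ v) = ∈-cartesianProductWith⁺ Vec._∷_ (c x) (allVecs-complete xs c n v)

enumVec : ∀ {A : Set} → Enum A → ∀ n → Enum (Vec A n)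
enumVec E n = record { list = allVecs (list E) n ; complete = allVecs-complete (list E) (complete E) n }

sumℚ : List ℚ → ℚ
sumℚ = List.foldr ℚ._+_ 0ℚ

ℕ→ℚ : ℕ → ℚ
ℕ→ℚ n = + n ℚ./ 1

-- average of f over the (duplicate-free) list xs; the empty average is 0
-- (never used: all lists averaged over below are nonempty)
avg : ∀ {A : Set} → List A → (A → ℚ) → ℚ
avg xs f with length xs
... | zero  = 0ℚ
... | suc n = sumℚ (List.map f xs) ℚ.* (+ 1 ℚ./ suc n)

-- total division; p ÷₀ 0 = 0 (never used: all denominators below are nonzero)
_÷₀_ : ℚ → ℚ → ℚ
p ÷₀ r with r ≟ℚ 0ℚ
... | yes _  = 0ℚ
... | no r≢0 = ℚ._÷_ p r {{ℚ.≢-nonZero r≢0}}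

φ : ℕ → ℕ
φ d = length (filter (λ k → gcd k d ℕ.≟ 1) (List.map suc (upTo d)))

divisorSum : ℕ → ℕ → ℕ
divisorSum q m =
  sum (List.map (λ k → φ (suc k) ℕ.* (((q ℕ.+ m ∸ 1) / suc k) C (m / suc k)))
                     (filter (λ k → suc k ∣? (q ∸ 1)) (upTo (q ∸ 1))))

rhs : ℕ → ℕ → ℕ → ℚ
rhs q ℓ m =
  ((ℕ→ℚ (m !) ℚ.* (ℕ→ℚ (q ℕ.^ (m ∸ ℓ)) ℚ.- ℕ→ℚ q)) ÷₀ (ℕ→ℚ (q ℕ.^ m) ℚ.- ℕ→ℚ q))
  ℚ.+
  (((ℕ→ℚ (m !) ℚ.* (ℕ→ℚ (q ℕ.^ m) ℚ.- ℕ→ℚ (q ℕ.^ (m ∸ ℓ))))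
      ÷₀ ((ℕ→ℚ (q ℕ.^ m) ℚ.- ℕ→ℚ 1) ℚ.* (ℕ→ℚ (q ℕ.^ m) ℚ.- ℕ→ℚ q)))
   ℚ.* ((ℕ→ℚ (divisorSum q m) ℚ.- ℕ→ℚ q) ℚ.+ ℕ→ℚ 1))

module LinAlg (F : FiniteField) where
  open FiniteField F

  enumF : Enum Carrier
  enumF = record { list = elements ; complete = FiniteField.complete F }

  Mat : ℕ → ℕ → Set
  Mat a b = Vec (Vec Carrier b) a

  _≟M_ : ∀ {a b} → DecidableEquality (Mat a b)
  _≟M_ = ≡-dec (≡-dec _≟_)

  enumMat : ∀ a b → Enum (Mat a b)
  enumMat a b = enumVec (enumVec enumF b) a

  ∑ : ∀ {n} → (Fin n → Carrier) → Carrier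
  ∑ {zero}  f = 0#
  ∑ {suc n} f = f Fin.zero + ∑ (λ i → f (Fin.suc i))

  _⊗_ : ∀ {a b c} → Mat a b → Mat b c → Mat a c
  A ⊗ B = tabulate λ i → tabulate λ k → ∑ λ j → lookup (lookup A i) j * lookup (lookup B j) k

  𝟎 : ∀ {a b} → Mat a b
  𝟎 = replicate _ (replicate _ 0#)

  LinIndep : ∀ {r b} → Vec (Vec Carrier b) r → Set
  LinIndep {r} {b} rows =
    ∀ (c : Vec Carrier r) →
      (∀ (j : Fin b) → ∑ (λ i → lookup c i * lookup (lookup rows i) j) ≡ 0#) →
      ∀ (i : Fin r) → lookup c i ≡ 0#

  linIndep? : ∀ {r b} (rows : Vec (Vec Carrier b) r) → Dec (LinIndep rows)
  linIndep? {r} {b} rows =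
    ∀? (enumVec enumF r) λ c →
      ∀? (enumFin b) (λ j → ∑ (λ i → lookup c i * lookup (lookup rows i) j) ≟ 0#)
      →-dec ∀? (enumFin r) (λ i → lookup c i ≟ 0#)

  HasRank : ∀ {a b} → Mat a b → ℕ → Set
  HasRank {a} A r =
    (∃ λ (s : Vec (Fin a) r) → LinIndep (Vec.map (lookup A) s)) ×
    (∀ (s : Vec (Fin a) (suc r)) → ¬ LinIndep (Vec.map (lookup A) s))

  hasRank? : ∀ {a b} (A : Mat a b) r → Dec (HasRank A r)
  hasRank? {a} A r =
    ∃? (enumVec (enumFin a) r) (λ s → linIndep? (Vec.map (lookup A) s))
    ×-dec ∀? (enumVec (enumFin a) (suc r)) (λ s → ¬? (linIndep? (Vec.map (lookup A) s)))

  matsOfRank : ∀ a b r → List (Mat a b)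
  matsOfRank a b r = filter (λ A → hasRank? A r) (list (enumMat a b))

  IsPerm : ∀ {m} → Vec (Fin m) m → Set
  IsPerm {m} π = ∀ (i j : Fin m) → lookup π i ≡ lookup π j → i ≡ j

  isPerm? : ∀ {m} (π : Vec (Fin m) m) → Dec (IsPerm π)
  isPerm? {m} π = ∀? (enumFin m) λ i → ∀? (enumFin m) λ j → (lookup π i ≟F lookup π j) →-dec (i ≟F j)

  Sym : ∀ m → List (Vec (Fin m) m)
  Sym m = filter isPerm? (list (enumVec (enumFin m) m))

  permMat : ∀ {m} → Vec (Fin m) m → Mat m m
  permMat π = tabulate λ i → tabulate λ j → if does (lookup π i ≟F j) then 1# else 0#

  Nsol : ∀ {ℓ m} → Mat ℓ m → Mat m 1 → ℕ
  Nsol {ℓ} {m} A B = length (filter (λ ρ → ((A ⊗ permMat ρ) ⊗ B) ≟M 𝟎) (Sym m))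

  admissibleA : ∀ ℓ {m} → Vec (Fin m) m → Mat m 1 → List (Mat ℓ m)
  admissibleA ℓ {m} π B = filter (λ A → ((A ⊗ permMat π) ⊗ B) ≟M 𝟎) (matsOfRank ℓ m ℓ)

  expectedNsol : ℕ → ℕ → ℚ
  expectedNsol ℓ m =
    avg (Sym m) λ π →
      avg (matsOfRank m 1 1) λ B →
        avg (admissibleA ℓ π B) λ A → ℕ→ℚ (Nsol A B)

{-# OPTIONS --safe #-}

-- Fix π and B and put v = πB.  A uniformly random A of rank ℓ with Av = 0 kills w = ρB
-- surely when w is a multiple of v, and otherwise with probability
-- p = (q^(m-ℓ) - q) / (q^m - q), as one sees by counting the linearly independent
-- ℓ-tuples in v⊥ and in v⊥ ∩ w⊥.  So the expectation is m! p + (1 - p) E[N₁], where N₁ is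
-- the number of ρ with ρB ∈ F* πB.  For a fixed unit c, the pairs (ρ, B) with ρB = cπB
-- number m! times the multisets of size m in F that are invariant under multiplication by c;
-- if c has order d, such a multiset consists of copies of 0 and of orbits of size d, and there
-- are C(⌊(q+m-1)/d⌋, ⌊m/d⌋) of them.  As F* is cyclic, φ(d) units have order d.
-- Removing B = 0, which counts once for each (ρ, c), gives the term - q + 1.
module Submission where

open import Defs
open import Level using (0ℓ)
open import Algebra.Bundles using (CommutativeRing)
open import Data.Bool using (if_then_else_)
open import Data.Fin as Fin using (Fin; zero; suc; toℕ; fromℕ<)
import Data.Fin.Properties as Fin
import Data.Integer as ℤ
import Data.Integer.Properties as ℤ
open import Data.List as List using (List; []; _∷_; _++_; length; filter; map; foldr; allFin; upTo; applyUpTo; cartesianProduct; cartesianProductWith)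
import Data.List.Properties as List
open import Data.List.Membership.Propositional using (_∈_; _∉_; find; lose)
open import Data.List.Membership.Propositional.Properties using (∈-length; ∈-++⁻; ∈-++⁺ˡ; ∈-++⁺ʳ; ∈-filter⁺; ∈-filter⁻; ∈-map⁻; ∈-map⁺; ∈-allFin; ∈-upTo⁺; ∈-upTo⁻; ∈-cartesianProduct⁺; ∈-cartesianProductWith⁻)
open import Data.List.Membership.Propositional.Properties.WithK using (unique∧set⇒bag)
import Data.List.Membership.DecPropositional as DecMembership
open import Data.List.Relation.Binary.BagAndSetEquality using (∼bag⇒↭)
open import Data.List.Relation.Binary.Permutation.Propositional using (_↭_; ↭⇒↭ₛ)
open import Data.List.Relation.Binary.Permutation.Propositional.Properties using (↭-length) renaming (map⁺ to ↭-map⁺)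
open import Data.List.Relation.Binary.Permutation.Setoid.Properties using (foldr-commMonoid)
open import Data.List.Relation.Unary.All as All using (All; []; _∷_)
open import Data.List.Relation.Unary.AllPairs using ([]; _∷_)
open import Data.List.Relation.Unary.Any using (here; there; any?)
open import Data.List.Relation.Unary.Unique.Propositional using (Unique)
import Data.List.Relation.Unary.Unique.Propositional.Properties as Unique
import Data.List.Relation.Unary.Unique.DecPropositional as DecUnique
open import Data.Nat as ℕ using (ℕ; zero; suc; _∸_; _≤_; _<_; z≤n; s≤s; NonZero; >-nonZero; ≢-nonZero; ≢-nonZero⁻¹; _!)
import Data.Nat.Properties as ℕ
open import Algebra.Properties.CommutativeSemigroup ℕ.+-commutativeSemigroup using (interchange)
open import Data.Nat.Combinatorics using (_C_; nCn≡1; nCk+nC[k+1]≡[n+1]C[k+1])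
open import Data.Nat.Combinatorics.Base using (_P′_)
open import Data.Nat.Combinatorics.Specification using (nP′n≡n!)
open import Data.Nat.DivMod
open import Data.Nat.Divisibility using (_∣_; _∣?_; divides; ∣⇒≤)
open import Data.Nat.GCD
open import Data.Nat.ListAction.Properties using (sum-↭)
open import Data.Nat.Solver using (module +-*-Solver)
open import Data.Product using (∃; _×_; _,_; proj₁; proj₂)
open import Data.Rational as ℚ using (ℚ; 0ℚ; 1ℚ)
import Data.Rational.Properties as ℚ
import Data.Rational.Solver as ℚSolver
open import Data.Rational.Unnormalised as ℚᵘ using (mkℚᵘ; *≡*)
import Data.Rational.Unnormalised.Properties as ℚᵘ
open import Data.Sum using (inj₁; inj₂; [_,_]′)
open import Data.Unit using (⊤; tt)
open import Data.Vec as Vec using (Vec; []; _∷_; lookup; replicate; tabulate; zipWith; updateAt; toList)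
import Data.Vec.Properties as Vec
open import Data.Vec.Properties using (lookup∘updateAt; lookup∘updateAt′; lookup-replicate; lookup-map; lookup-zipWith; lookup∘tabulate; lookup-allFin; tabulate-cong; tabulate∘lookup; toList-map; length-toList; map-lookup-allFin; ∷-injective; ∷-injectiveʳ; ≡-dec)
open import Data.Vec.Membership.Propositional.Properties using (∈-lookup; ∈-toList⁺)
open import Function using (_∘_; id; mk⇔)
open import Relation.Binary.Definitions using (DecidableEquality; tri<; tri≈; tri>)
open import Relation.Binary.PropositionalEquality
open import Relation.Nullary using (Dec; yes; no; ¬_; does; contradiction)
open import Relation.Nullary.Decidable using (¬?; _×-dec_)
open import Relation.Unary using (Pred; Decidable)

-- Sums over lists

-- Counting stays in ℕ: probabilities and averages occur as equations multiplied by their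
-- denominators, and ℚ enters only at the end. Subspaces are measured by their number of elements,
-- never by dimension.
--
-- That ρB lies in F* πB is an existential statement about the scalar c. For B ≠ 0 the scalar is
-- unique, so the statement may be replaced by the number of scalars, and E[N₁] becomes a sum over c
-- of separate counts. At B = 0 all q - 1 scalars qualify, which is why that vector has to be
-- removed.
--
-- The factor m! comes from a cancellation. If the multiset of B, with multiplicities μ_x, is
-- invariant under c, then exactly ∏ μ_x! permutations satisfy ρB = cπB, while m!/∏ μ_x! words B
-- share this multiset. Nothing here depends on π, so the outer average runs over a constant.
--
-- Cyclicity does more than count units of each order: with F listed as 0 and the powers of a
-- generator, multiplication by c is a translation of Z/(q-1), and by Bézout the functions invariant
-- under it are those whose period is a gcd.

module _ where

  open import Data.Nat using (_+_; _*_; _^_)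
  open import Data.Nat.Properties hiding (_≟_)
  open import Data.Nat.ListAction using (sum)

  private
    variable
      A B C : Set
      P Q : Set
      xs ys : List A

  Σₗ : List A → (A → ℕ) → ℕ
  Σₗ xs f = sum (map f xs)

  syntax Σₗ xs (λ x → e) = Σ[ x ∈ xs ] e

  𝟙 : Dec P → ℕ
  𝟙 p = if does p then 1 else 0

  𝟙-yes : (p : Dec P) → P → 𝟙 p ≡ 1
  𝟙-yes (yes _) _ = refl
  𝟙-yes (no ¬p) p = contradiction p ¬p

  𝟙-no : (p : Dec P) → ¬ P → 𝟙 p ≡ 0
  𝟙-no (yes p) ¬p = contradiction p ¬p
  𝟙-no (no _) _ = refl

  𝟙-cong : (p : Dec P) (q : Dec Q) → (P → Q) → (Q → P) → 𝟙 p ≡ 𝟙 q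
  𝟙-cong (yes p) q f g = sym (𝟙-yes q (f p))
  𝟙-cong (no ¬p) q f g = sym (𝟙-no q (¬p ∘ g))

  𝟙-mono : (p : Dec P) (q : Dec Q) → (P → Q) → 𝟙 p ≤ 𝟙 q
  𝟙-mono (yes p) q f = ≤-reflexive (sym (𝟙-yes q (f p)))
  𝟙-mono (no _) q f = z≤n

  𝟙-× : (p : Dec P) (q : Dec Q) → 𝟙 (p ×-dec q) ≡ 𝟙 p * 𝟙 q
  𝟙-× (yes _) (yes _) = refl
  𝟙-× (yes _) (no _) = refl
  𝟙-× (no _) _ = refl

  -- Inside a sum, the indicator supplies the proof of P on which the equality of two terms may
  -- depend.
  𝟙-*-cong : (p : Dec P) {m n : ℕ} → (P → m ≡ n) → 𝟙 p * m ≡ 𝟙 p * n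
  𝟙-*-cong (yes p) f = cong (1 *_) (f p)
  𝟙-*-cong (no _) _ = refl

  Σ-cong-∈ : (xs : List A) {f g : A → ℕ} → (∀ x → x ∈ xs → f x ≡ g x) → Σₗ xs f ≡ Σₗ xs g
  Σ-cong-∈ [] _ = refl
  Σ-cong-∈ (x ∷ xs) eq = cong₂ _+_ (eq x (here refl)) (Σ-cong-∈ xs (λ y → eq y ∘ there))

  Σ-cong : (xs : List A) {f g : A → ℕ} → (∀ x → f x ≡ g x) → Σₗ xs f ≡ Σₗ xs g
  Σ-cong xs eq = cong sum (List.map-cong eq xs)

  Σ-mono : (xs : List A) {f g : A → ℕ} → (∀ x → x ∈ xs → f x ≤ g x) → Σₗ xs f ≤ Σₗ xs g
  Σ-mono [] _ = z≤n
  Σ-mono (x ∷ xs) le = +-mono-≤ (le x (here refl)) (Σ-mono xs (λ y → le y ∘ there))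

  Σ-mono-< : (xs : List A) {f g : A → ℕ} → (∀ x → x ∈ xs → f x ≤ g x) →
             ∀ {x} → x ∈ xs → f x < g x → Σₗ xs f < Σₗ xs g
  Σ-mono-< (x ∷ xs) le (here refl) lt = +-mono-<-≤ lt (Σ-mono xs (λ y → le y ∘ there))
  Σ-mono-< (x ∷ xs) le (there p) lt = +-mono-≤-< (le x (here refl)) (Σ-mono-< xs (λ y → le y ∘ there) p lt)

  Σ-++ : (xs ys : List A) (f : A → ℕ) → Σₗ (xs ++ ys) f ≡ Σₗ xs f + Σₗ ys f
  Σ-++ [] ys f = refl
  Σ-++ (x ∷ xs) ys f = trans (cong (f x +_) (Σ-++ xs ys f)) (sym (+-assoc (f x) _ _))

  Σ-map : (h : A → B) (xs : List A) (f : B → ℕ) → Σₗ (map h xs) f ≡ Σₗ xs (f ∘ h)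
  Σ-map h xs f = cong sum (sym (List.map-∘ xs))

  Σ-+ : (xs : List A) (f g : A → ℕ) → Σ[ x ∈ xs ] (f x + g x) ≡ Σₗ xs f + Σₗ xs g
  Σ-+ [] f g = refl
  Σ-+ (x ∷ xs) f g = trans (cong (f x + g x +_) (Σ-+ xs f g)) (interchange (f x) (g x) _ _)

  Σ-*ˡ : (xs : List A) (c : ℕ) (f : A → ℕ) → Σ[ x ∈ xs ] (c * f x) ≡ c * Σₗ xs f
  Σ-*ˡ [] c f = sym (*-zeroʳ c)
  Σ-*ˡ (x ∷ xs) c f = trans (cong (c * f x +_) (Σ-*ˡ xs c f)) (sym (*-distribˡ-+ c (f x) _))

  Σ-*ʳ : (xs : List A) (c : ℕ) (f : A → ℕ) → Σ[ x ∈ xs ] (f x * c) ≡ Σₗ xs f * c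
  Σ-*ʳ [] c f = refl
  Σ-*ʳ (x ∷ xs) c f = trans (cong (f x * c +_) (Σ-*ʳ xs c f)) (sym (*-distribʳ-+ c (f x) _))

  Σ-const : (xs : List A) (c : ℕ) → Σ[ _ ∈ xs ] c ≡ length xs * c
  Σ-const [] c = refl
  Σ-const (x ∷ xs) c = cong (c +_) (Σ-const xs c)

  Σ-one : (xs : List A) → Σ[ _ ∈ xs ] 1 ≡ length xs
  Σ-one xs = trans (Σ-const xs 1) (*-identityʳ _)

  Σ-zero : (xs : List A) {f : A → ℕ} → (∀ x → x ∈ xs → f x ≡ 0) → Σₗ xs f ≡ 0
  Σ-zero xs eq = trans (Σ-cong-∈ xs eq) (trans (Σ-const xs 0) (*-zeroʳ (length xs)))

  Σ-swap : (xs : List A) (ys : List B) (f : A → B → ℕ) →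
           Σ[ x ∈ xs ] Σ[ y ∈ ys ] f x y ≡ Σ[ y ∈ ys ] Σ[ x ∈ xs ] f x y
  Σ-swap [] ys f = sym (Σ-zero ys (λ _ _ → refl))
  Σ-swap (x ∷ xs) ys f = trans (cong (Σₗ ys (f x) +_) (Σ-swap xs ys f)) (sym (Σ-+ ys (f x) _))

  Σ-↭ : (f : A → ℕ) → xs ↭ ys → Σₗ xs f ≡ Σₗ ys f
  Σ-↭ f p = sum-↭ (↭-map⁺ f p)

  Σ-filter : {P : Pred A 0ℓ} (P? : Decidable P) (xs : List A) (f : A → ℕ) →
             Σₗ (filter P? xs) f ≡ Σ[ x ∈ xs ] (𝟙 (P? x) * f x)
  Σ-filter P? [] f = refl
  Σ-filter P? (x ∷ xs) f with P? x
  ... | yes _ = cong₂ _+_ (sym (+-identityʳ (f x))) (Σ-filter P? xs f)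
  ... | no _ = Σ-filter P? xs f

  length-filter : {P : Pred A 0ℓ} (P? : Decidable P) (xs : List A) →
                  length (filter P? xs) ≡ Σ[ x ∈ xs ] 𝟙 (P? x)
  length-filter P? xs = trans (sym (Σ-one (filter P? xs)))
    (trans (Σ-filter P? xs _) (Σ-cong xs (λ x → *-identityʳ (𝟙 (P? x)))))

  Σ-cartesianProductWith : (h : A → B → C) (xs : List A) (ys : List B) (f : C → ℕ) →
    Σₗ (cartesianProductWith h xs ys) f ≡ Σ[ x ∈ xs ] Σ[ y ∈ ys ] f (h x y)
  Σ-cartesianProductWith h [] ys f = refl
  Σ-cartesianProductWith h (x ∷ xs) ys f = trans (Σ-++ (map (h x) ys) _ f)
    (cong₂ _+_ (Σ-map (h x) ys f) (Σ-cartesianProductWith h xs ys f))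

  length-cartesianProduct : (xs : List A) (ys : List B) → length (cartesianProduct xs ys) ≡ length xs * length ys
  length-cartesianProduct xs ys = begin
    length (cartesianProduct xs ys)   ≡⟨ Σ-one (cartesianProduct xs ys) ⟨
    Σ[ _ ∈ cartesianProduct xs ys ] 1 ≡⟨ Σ-cartesianProductWith _,_ xs ys _ ⟩
    Σ[ _ ∈ xs ] Σ[ _ ∈ ys ] 1         ≡⟨ Σ-cong xs (λ _ → Σ-one ys) ⟩
    Σ[ _ ∈ xs ] length ys             ≡⟨ Σ-const xs _ ⟩
    length xs * length ys             ∎
    where open ≡-Reasoning

  Σ-allVecs-suc : (xs : List A) (n : ℕ) (f : Vec A (suc n) → ℕ) →
    Σₗ (allVecs xs (suc n)) f ≡ Σ[ x ∈ xs ] Σ[ v ∈ allVecs xs n ] f (x Vec.∷ v)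
  Σ-allVecs-suc xs n f = Σ-cartesianProductWith Vec._∷_ xs (allVecs xs n) f

  Σ-allVecs-map : (h : A → B) (xs : List A) (n : ℕ) (f : Vec B n → ℕ) →
    Σₗ (allVecs (map h xs) n) f ≡ Σ[ v ∈ allVecs xs n ] f (Vec.map h v)
  Σ-allVecs-map h xs zero f = refl
  Σ-allVecs-map h xs (suc n) f = begin
    Σₗ (allVecs (map h xs) (suc n)) f
      ≡⟨ Σ-allVecs-suc (map h xs) n f ⟩
    Σ[ y ∈ map h xs ] Σ[ v ∈ allVecs (map h xs) n ] f (y Vec.∷ v)
      ≡⟨ Σ-map h xs _ ⟩
    Σ[ x ∈ xs ] Σ[ v ∈ allVecs (map h xs) n ] f (h x Vec.∷ v)
      ≡⟨ Σ-cong xs (λ x → Σ-allVecs-map h xs n _) ⟩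
    Σ[ x ∈ xs ] Σ[ v ∈ allVecs xs n ] f (h x Vec.∷ Vec.map h v)
      ≡⟨ Σ-allVecs-suc xs n _ ⟨
    Σ[ v ∈ allVecs xs (suc n) ] f (Vec.map h v) ∎
    where open ≡-Reasoning

  -- Used to replace the given listing of F by the one through powers of a generator.
  Σ-allVecs-↭ : xs ↭ ys → (n : ℕ) (f : Vec A n → ℕ) → Σₗ (allVecs xs n) f ≡ Σₗ (allVecs ys n) f
  Σ-allVecs-↭ p zero f = refl
  Σ-allVecs-↭ {xs = xs} {ys = ys} p (suc n) f =
    trans (Σ-allVecs-suc xs n f)
    (trans (Σ-cong xs (λ x → Σ-allVecs-↭ p n _))
    (trans (Σ-↭ _ p) (sym (Σ-allVecs-suc ys n f))))

  -- A v = 0 is a condition on each row of A separately; this turns such matrices into tuples over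
  -- the list of vectors orthogonal to v.
  Σ-allVecs-filter : {P : Pred A 0ℓ} (P? : Decidable P) (xs : List A) (k : ℕ) (f : Vec A k → ℕ) →
    Σ[ U ∈ allVecs (filter P? xs) k ] f U ≡ Σ[ U ∈ allVecs xs k ] (𝟙 (Fin.all? λ i → P? (lookup U i)) * f U)
  Σ-allVecs-filter P? xs zero f = cong (ℕ._+ 0) (sym (+-identityʳ (f [])))
  Σ-allVecs-filter {P = P} P? xs (suc k) f = begin
    Σ[ U ∈ allVecs (filter P? xs) (suc k) ] f U
      ≡⟨ Σ-allVecs-suc (filter P? xs) k f ⟩
    Σ[ u ∈ filter P? xs ] Σ[ U ∈ allVecs (filter P? xs) k ] f (u ∷ U)
      ≡⟨ Σ-cong (filter P? xs) (λ u → Σ-allVecs-filter P? xs k (f ∘ (u ∷_))) ⟩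
    Σ[ u ∈ filter P? xs ] Σ[ U ∈ allVecs xs k ] (all U * f (u ∷ U))
      ≡⟨ Σ-filter P? xs _ ⟩
    Σ[ u ∈ xs ] (𝟙 (P? u) * Σ[ U ∈ allVecs xs k ] (all U * f (u ∷ U)))
      ≡⟨ Σ-cong xs (λ u → sym (Σ-*ˡ (allVecs xs k) (𝟙 (P? u)) _)) ⟩
    Σ[ u ∈ xs ] Σ[ U ∈ allVecs xs k ] (𝟙 (P? u) * (all U * f (u ∷ U)))
      ≡⟨ Σ-cong xs (λ u → Σ-cong (allVecs xs k) λ U → trans (sym (*-assoc (𝟙 (P? u)) (all U) (f (u ∷ U)))) (cong (ℕ._* f (u ∷ U)) (sym (all-∷ u U)))) ⟩
    Σ[ u ∈ xs ] Σ[ U ∈ allVecs xs k ] (all (u ∷ U) * f (u ∷ U))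
      ≡⟨ Σ-allVecs-suc xs k _ ⟨
    Σ[ U ∈ allVecs xs (suc k) ] (all U * f U) ∎
    where
    open ≡-Reasoning
    all : ∀ {k} → Vec _ k → ℕ
    all U = 𝟙 (Fin.all? λ i → P? (lookup U i))
    all-∷ : ∀ {k} u (U : Vec _ k) → all (u ∷ U) ≡ 𝟙 (P? u) * all U
    all-∷ u U = trans (𝟙-cong (Fin.all? λ i → P? (lookup (u ∷ U) i)) (P? u ×-dec Fin.all? λ i → P? (lookup U i))
        (λ h → h zero , h ∘ suc) (λ { (p , h) zero → p ; (p , h) (suc i) → h i }))
      (𝟙-× (P? u) (Fin.all? λ i → P? (lookup U i)))

  length-allVecs : (xs : List A) (n : ℕ) → length (allVecs xs n) ≡ length xs ^ n
  length-allVecs xs zero = refl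
  length-allVecs xs (suc n) = begin
    length (allVecs xs (suc n))               ≡⟨ Σ-one (allVecs xs (suc n)) ⟨
    Σ[ _ ∈ allVecs xs (suc n) ] 1             ≡⟨ Σ-allVecs-suc xs n _ ⟩
    Σ[ _ ∈ xs ] Σ[ _ ∈ allVecs xs n ] 1       ≡⟨ Σ-cong xs (λ _ → Σ-one (allVecs xs n)) ⟩
    Σ[ _ ∈ xs ] length (allVecs xs n)         ≡⟨ Σ-const xs _ ⟩
    length xs * length (allVecs xs n)         ≡⟨ cong (length xs *_) (length-allVecs xs n) ⟩
    length xs * length xs ^ n        ∎
    where open ≡-Reasoning

  allVecs-unique : Unique xs → (n : ℕ) → Unique (allVecs xs n)
  allVecs-unique u zero = [] ∷ []
  allVecs-unique u (suc n) = Unique.cartesianProductWith⁺ Vec._∷_ Vec.∷-injective u (allVecs-unique u n)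

  sameMembers⇒↭ : Unique xs → Unique ys → (∀ {x} → x ∈ xs → x ∈ ys) → (∀ {x} → x ∈ ys → x ∈ xs) → xs ↭ ys
  sameMembers⇒↭ u v f g = ∼bag⇒↭ (unique∧set⇒bag u v (mk⇔ f g))

  module _ {A : Set} (_≟_ : DecidableEquality A) where
    open DecMembership _≟_ using (_∈?_)

    complement : List A → List A → List A
    complement ys xs = filter (λ x → ¬? (x ∈? ys)) xs

    complement-↭ : {xs ys : List A} → Unique xs → Unique ys → (∀ {x} → x ∈ ys → x ∈ xs) → ys ++ complement ys xs ↭ xs
    complement-↭ {xs} {ys} u v ys⊆xs = sameMembers⇒↭
      (Unique.++⁺ v (Unique.filter⁺ _ u) (λ (p , q) → proj₂ (∈-filter⁻ (λ x → ¬? (x ∈? ys)) {xs = xs} q) p))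
      u (λ p → [ ys⊆xs , proj₁ ∘ ∈-filter⁻ (λ x → ¬? (x ∈? ys)) ]′ (∈-++⁻ ys p)) back
      where
      back : ∀ {x} → x ∈ xs → x ∈ ys ++ complement ys xs
      back {x} x∈xs with x ∈? ys
      ... | yes x∈ys = ∈-++⁺ˡ x∈ys
      ... | no x∉ys = ∈-++⁺ʳ ys (∈-filter⁺ _ x∈xs x∉ys)

    Σ-complement : {xs ys : List A} → Unique xs → Unique ys → (∀ {x} → x ∈ ys → x ∈ xs) → (f : A → ℕ) →
                   Σₗ ys f + Σₗ (complement ys xs) f ≡ Σₗ xs f
    Σ-complement {ys = ys} u v ys⊆xs f = trans (sym (Σ-++ ys _ f)) (Σ-↭ f (complement-↭ u v ys⊆xs))

    ⊆⇒length≤ : {xs ys : List A} → Unique xs → Unique ys → (∀ {x} → x ∈ ys → x ∈ xs) → length ys ≤ length xs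
    ⊆⇒length≤ {ys = ys} u v ys⊆xs = subst (length ys ≤_)
      (trans (sym (List.length-++ ys)) (↭-length (complement-↭ u v ys⊆xs))) (m≤m+n _ _)

    -- An x missing from ys would make x ∷ ys a duplicate-free list within xs, yet longer than xs.
    ⊆∧length≤⇒⊇ : {xs ys : List A} → Unique xs → Unique ys → (∀ {x} → x ∈ ys → x ∈ xs) → length xs ≤ length ys →
                  ∀ {x} → x ∈ xs → x ∈ ys
    ⊆∧length≤⇒⊇ {xs} {ys} u v ys⊆xs le {x} x∈xs with x ∈? ys
    ... | yes x∈ys = x∈ys
    ... | no x∉ys = contradiction (≤-trans (⊆⇒length≤ u (All.tabulate (λ y∈ys x≡y → x∉ys (subst (_∈ ys) (sym x≡y) y∈ys)) ∷ v)
        (λ { (here refl) → x∈xs ; (there p) → ys⊆xs p })) le) 1+n≰n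

    Σ-point : {xs : List A} → Unique xs → ∀ {x} → x ∈ xs → (f : A → ℕ) → Σ[ y ∈ xs ] (𝟙 (x ≟ y) * f y) ≡ f x
    Σ-point {xs} u {x} x∈xs f = begin
      Σ[ y ∈ xs ] (𝟙 (x ≟ y) * f y)      ≡⟨ Σ-filter (x ≟_) xs f ⟨
      Σₗ (filter (x ≟_) xs) f            ≡⟨ Σ-↭ f (sameMembers⇒↭ (Unique.filter⁺ _ u) ([] ∷ [])
                                              (here ∘ sym ∘ proj₂ ∘ ∈-filter⁻ (x ≟_) {xs = xs})
                                              (λ { (here refl) → ∈-filter⁺ _ x∈xs refl })) ⟩
      f x + 0                            ≡⟨ +-identityʳ (f x) ⟩
      f x                                ∎
      where open ≡-Reasoning

    Σ-fibres : {ys : List A} (key : B → A) (xs : List B) → Unique ys → (∀ {x} → x ∈ xs → key x ∈ ys) → (h : A → ℕ) →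
      Σ[ x ∈ xs ] h (key x) ≡ Σ[ y ∈ ys ] (Σ[ x ∈ xs ] 𝟙 (key x ≟ y) * h y)
    Σ-fibres {ys = ys} key xs u key∈ h = begin
      Σ[ x ∈ xs ] h (key x)
        ≡⟨ Σ-cong-∈ xs (λ x x∈xs → Σ-point u (key∈ x∈xs) h) ⟨
      Σ[ x ∈ xs ] Σ[ y ∈ ys ] (𝟙 (key x ≟ y) * h y)
        ≡⟨ Σ-swap xs ys _ ⟩
      Σ[ y ∈ ys ] Σ[ x ∈ xs ] (𝟙 (key x ≟ y) * h y)
        ≡⟨ Σ-cong ys (λ y → Σ-*ʳ xs (h y) _) ⟩
      Σ[ y ∈ ys ] (Σ[ x ∈ xs ] 𝟙 (key x ≟ y) * h y) ∎
      where open ≡-Reasoning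

  length-bij : {xs : List A} {ys : List B} (f : A → B) → (∀ {x y} → f x ≡ f y → x ≡ y) → Unique xs → Unique ys →
    (∀ {x} → x ∈ xs → f x ∈ ys) → (∀ {y} → y ∈ ys → ∃ λ x → x ∈ xs × y ≡ f x) → length xs ≡ length ys
  length-bij {xs = xs} {ys = ys} f inj u v into onto = trans (sym (List.length-map f xs))
    (↭-length (sameMembers⇒↭ (Unique.map⁺ inj u) v
      (λ p → let (x , x∈xs , eq) = ∈-map⁻ f p in subst (_∈ ys) (sym eq) (into x∈xs))
      (λ p → let (x , x∈xs , eq) = onto p in subst (_∈ map f xs) (sym eq) (∈-map⁺ f x∈xs))))

-- Residues modulo n by additive order

module _ where

  open import Data.Nat using (_*_)
  open import Data.Nat.Properties
  open import Data.Nat.Divisibility using (quotient)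

  -- Residues are represented by 1, ..., n, as in `φ`, so that `φ d` is by definition the length of
  -- a filter of `range₁ d`.
  range₁ : ℕ → List ℕ
  range₁ n = map suc (upTo n)

  ∈-range₁⁺ : ∀ {a n} → 0 < a → a ≤ n → a ∈ range₁ n
  ∈-range₁⁺ {suc a} _ a<n = ∈-map⁺ suc (∈-upTo⁺ a<n)

  ∈-range₁⁻ : ∀ {a n} → a ∈ range₁ n → 0 < a × a ≤ n
  ∈-range₁⁻ p with k , k∈ , refl ← ∈-map⁻ suc p = s≤s z≤n , ∈-upTo⁻ k∈

  range₁-unique : ∀ n → Unique (range₁ n)
  range₁-unique n = Unique.map⁺ suc-injective (Unique.upTo⁺ n)

  divisors : ℕ → List ℕ
  divisors n = map suc (filter (λ k → suc k ∣? n) (upTo n))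

  ∈-divisors⁺ : ∀ {d n} → 0 < d → .{{NonZero n}} → d ∣ n → d ∈ divisors n
  ∈-divisors⁺ {suc k} {n} _ d∣n = ∈-map⁺ suc (∈-filter⁺ (λ k → suc k ∣? n) (∈-upTo⁺ (∣⇒≤ d∣n)) d∣n)

  ∈-divisors⁻ : ∀ {d n} → d ∈ divisors n → 0 < d × d ∣ n
  ∈-divisors⁻ {n = n} p with k , k∈ , refl ← ∈-map⁻ suc p =
    s≤s z≤n , proj₂ (∈-filter⁻ (λ k → suc k ∣? n) {xs = upTo n} k∈)

  divisors-unique : ∀ n → Unique (divisors n)
  divisors-unique n = Unique.map⁺ suc-injective (Unique.filter⁺ _ (Unique.upTo⁺ n))

  Σ-divisors : ∀ n (h : ℕ → ℕ) → Σₗ (divisors n) h ≡ Σ[ k ∈ filter (λ k → suc k ∣? n) (upTo n) ] h (suc k)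
  Σ-divisors n h = Σ-map suc (filter (λ k → suc k ∣? n) (upTo n)) h

  module _ (n : ℕ) {{n≢0 : NonZero n}} where

    gcd-nonZero : ∀ a → NonZero (gcd a n)
    gcd-nonZero a = ≢-nonZero (gcd[m,n]≢0 a n (inj₂ (≢-nonZero⁻¹ n)))

    -- The order of a in the additive group Z/n, hence the order of g^a when g generates a cyclic
    -- group of order n.
    cogcd : ℕ → ℕ
    cogcd a = (n / gcd a n) {{gcd-nonZero a}}

    cogcd*gcd : ∀ a → cogcd a * gcd a n ≡ n
    cogcd*gcd a = m/n*n≡m {{gcd-nonZero a}} (gcd[m,n]∣n a n)

    cogcd∣n : ∀ a → cogcd a ∣ n
    cogcd∣n a = divides (gcd a n) (trans (sym (cogcd*gcd a)) (*-comm (cogcd a) _))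

    cogcd>0 : ∀ a → 0 < cogcd a
    cogcd>0 a with cogcd a | cogcd*gcd a
    ... | zero | eq = contradiction (sym eq) (≢-nonZero⁻¹ n)
    ... | suc _ | _ = s≤s z≤n

    -- Multiplication by e = n / d maps the k ≤ d coprime to d onto the fibre.
    cogcd-fibre : ∀ {d} → 0 < d → d ∣ n → Σ[ a ∈ range₁ n ] 𝟙 (cogcd a ≟ d) ≡ φ d
    cogcd-fibre {d@(suc _)} _ (divides e n≡ed) = trans (sym (length-filter (λ a → cogcd a ≟ d) (range₁ n)))
      (sym (length-bij (e *_) (*-cancelˡ-≡ _ _ e)
        (Unique.filter⁺ (λ k → gcd k d ≟ 1) (range₁-unique d))
        (Unique.filter⁺ (λ a → cogcd a ≟ d) (range₁-unique n)) into onto))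
      where
      instance
        e≢0 : NonZero e
        e≢0 = ≢-nonZero λ { refl → ≢-nonZero⁻¹ n n≡ed }

      gcd-scaled : ∀ k → gcd (e * k) n ≡ e * gcd k d
      gcd-scaled k = trans (cong (gcd (e * k)) n≡ed) (sym (c*gcd[m,n]≡gcd[cm,cn] e k d))

      into : ∀ {k} → k ∈ filter (λ k → gcd k d ≟ 1) (range₁ d) → e * k ∈ filter (λ a → cogcd a ≟ d) (range₁ n)
      into {k} p with k∈ , coprime ← ∈-filter⁻ (λ k → gcd k d ≟ 1) {xs = range₁ d} p with 0<k , k≤d ← ∈-range₁⁻ k∈ =
        ∈-filter⁺ (λ a → cogcd a ≟ d)
          (∈-range₁⁺ (*-mono-< (n≢0⇒n>0 (≢-nonZero⁻¹ e)) 0<k) (≤-trans (*-monoʳ-≤ e k≤d) (≤-reflexive (sym n≡ed))))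
          (*-cancelʳ-≡ _ _ e (begin
            cogcd (e * k) * e                   ≡⟨ cong (cogcd (e * k) *_) (trans (gcd-scaled k) (trans (cong (e *_) coprime) (*-identityʳ e))) ⟨
            cogcd (e * k) * gcd (e * k) n       ≡⟨ cogcd*gcd (e * k) ⟩
            n                                   ≡⟨ trans n≡ed (*-comm e d) ⟩
            d * e ∎))
        where open ≡-Reasoning

      onto : ∀ {a} → a ∈ filter (λ a → cogcd a ≟ d) (range₁ n) → ∃ λ k → k ∈ filter (λ k → gcd k d ≟ 1) (range₁ d) × a ≡ e * k
      onto {a} p with a∈ , cogcd≡d ← ∈-filter⁻ (λ a → cogcd a ≟ d) {xs = range₁ n} p with 0<a , a≤n ← ∈-range₁⁻ a∈ = k ,
        ∈-filter⁺ (λ k → gcd k d ≟ 1)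
          (∈-range₁⁺ (n≢0⇒n>0 λ { k≡0 → <⇒≢ 0<a (sym (trans a≡ek (trans (cong (e *_) k≡0) (*-zeroʳ e)))) })
            (*-cancelˡ-≤ e (≤-trans (≤-reflexive (sym a≡ek)) (≤-trans a≤n (≤-reflexive n≡ed)))))
          (*-cancelˡ-≡ _ _ e (trans (sym (gcd-scaled k)) (trans (cong (λ x → gcd x n) (sym a≡ek)) (trans gcd≡e (sym (*-identityʳ e)))))) ,
        a≡ek
        where
        gcd≡e : gcd a n ≡ e
        gcd≡e = *-cancelˡ-≡ _ _ d (trans (cong (_* gcd a n) (sym cogcd≡d)) (trans (cogcd*gcd a) (trans n≡ed (*-comm e d))))
        e∣a : e ∣ a
        e∣a = subst (_∣ a) gcd≡e (gcd[m,n]∣m a n)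
        k = quotient e∣a
        a≡ek : a ≡ e * k
        a≡ek = trans (_∣_.equality e∣a) (*-comm k e)

    Σ-cogcd : (h : ℕ → ℕ) → Σ[ a ∈ range₁ n ] h (cogcd a) ≡ Σ[ d ∈ divisors n ] (φ d * h d)
    Σ-cogcd h = trans
      (Σ-fibres _≟_ cogcd (range₁ n) (divisors-unique n) (λ {a} _ → ∈-divisors⁺ (cogcd>0 a) (cogcd∣n a)) h)
      (Σ-cong-∈ (divisors n) λ d d∈ → let (0<d , d∣n) = ∈-divisors⁻ d∈ in cong (_* h d) (cogcd-fibre 0<d d∣n))

    -- Gauss's identity, obtained by grouping the residues by their additive order.
    Σ-φ : Σₗ (divisors n) φ ≡ n
    Σ-φ = begin
      Σₗ (divisors n) φ                   ≡⟨ Σ-cong (divisors n) (λ d → *-identityʳ (φ d)) ⟨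
      Σ[ d ∈ divisors n ] (φ d * 1)       ≡⟨ Σ-cogcd (λ _ → 1) ⟨
      Σ[ _ ∈ range₁ n ] 1                 ≡⟨ Σ-one (range₁ n) ⟩
      length (range₁ n)                   ≡⟨ trans (List.length-map suc (upTo n)) (List.length-upTo n) ⟩
      n                                   ∎
      where
      open ≡-Reasoning

-- The multiplicative group of a finite field is cyclic

-- The bound b is the default and is returned untested; a witness equal to b is therefore still
-- found.
findLeast : {P : Pred ℕ 0ℓ} → Decidable P → ℕ → ℕ
findLeast P? zero = zero
findLeast P? (suc b) with P? zero
... | yes _ = zero
... | no _ = suc (findLeast (P? ∘ suc) b)

findLeast-holds : {P : Pred ℕ 0ℓ} (P? : Decidable P) → ∀ {k b} → k ≤ b → P k → P (findLeast P? b)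
findLeast-holds P? {b = zero} z≤n p = p
findLeast-holds P? {zero} {suc b} _ p with P? zero
... | yes p₀ = p₀
... | no ¬p₀ = contradiction p ¬p₀
findLeast-holds P? {suc k} {suc b} (s≤s k≤b) p with P? zero
... | yes p₀ = p₀
... | no _ = findLeast-holds (P? ∘ suc) k≤b p

findLeast-minimal : {P : Pred ℕ 0ℓ} (P? : Decidable P) → ∀ b {j} → j < findLeast P? b → ¬ P j
findLeast-minimal P? (suc b) {j} j< with P? zero
findLeast-minimal P? (suc b) {zero} j< | no ¬p₀ = ¬p₀
findLeast-minimal P? (suc b) {suc j} (s≤s j<) | no _ = findLeast-minimal (P? ∘ suc) b j<

module Units (F : FiniteField) where
  open FiniteField F hiding (_+_; _*_; -_) renaming (_≟_ to infix 4 _≟_)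

  commutativeRing : CommutativeRing 0ℓ 0ℓ
  commutativeRing = record { isCommutativeRing = isCommutativeRing }

  open CommutativeRing commutativeRing public
    using (_+_; _*_; -_; *-comm; *-assoc; *-identityˡ; *-identityʳ; +-comm; +-assoc; +-identityˡ; +-identityʳ;
           -‿inverseˡ; -‿inverseʳ; zeroˡ; zeroʳ; distribˡ; distribʳ; ring; commutativeSemiring; semiring)
  open import Algebra.Properties.CommutativeSemiring.Exp commutativeSemiring public
    using (_^_; ^-homo-*; ^-assocʳ)
  open import Algebra.Properties.Ring ring public using (x∙y⁻¹≈ε⇒x≈y)
  open import Algebra.Solver.Ring.NaturalCoefficients.Default commutativeSemiring public
    using (solve; _:=_; _:+_; _:*_; con)
  open ≡-Reasoning

  x*y≡0⇒y≡0 : ∀ {x y} → x ≢ 0# → x * y ≡ 0# → y ≡ 0#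
  x*y≡0⇒y≡0 {x} {y} x≢0 xy≡0 with x⁻¹ , xx⁻¹≡1 ← inverse x x≢0 = begin
    y              ≡⟨ *-identityˡ y ⟨
    1# * y         ≡⟨ cong (_* y) (trans (*-comm x⁻¹ x) xx⁻¹≡1) ⟨
    x⁻¹ * x * y    ≡⟨ *-assoc x⁻¹ x y ⟩
    x⁻¹ * (x * y)  ≡⟨ cong (x⁻¹ *_) xy≡0 ⟩
    x⁻¹ * 0#       ≡⟨ zeroʳ x⁻¹ ⟩
    0#             ∎

  *-cancelˡ : ∀ {x y z} → x ≢ 0# → x * y ≡ x * z → y ≡ z
  *-cancelˡ {x} {y} {z} x≢0 eq with x⁻¹ , xx⁻¹≡1 ← inverse x x≢0 = trans (lemma y) (trans (cong (x⁻¹ *_) eq) (sym (lemma z)))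
    where
    lemma : ∀ y → y ≡ x⁻¹ * (x * y)
    lemma y = trans (sym (*-identityˡ y)) (trans (cong (_* y) (trans (sym xx⁻¹≡1) (*-comm x x⁻¹))) (*-assoc x⁻¹ x y))

  *-nonzero : ∀ {x y} → x ≢ 0# → y ≢ 0# → x * y ≢ 0#
  *-nonzero x≢0 y≢0 eq = y≢0 (x*y≡0⇒y≡0 x≢0 eq)

  ^-nonzero : ∀ {x} → x ≢ 0# → ∀ k → x ^ k ≢ 0#
  ^-nonzero x≢0 zero = 0≢1 ∘ sym
  ^-nonzero x≢0 (suc k) = *-nonzero x≢0 (^-nonzero x≢0 k)

  1^k≡1 : ∀ k → 1# ^ k ≡ 1#
  1^k≡1 zero = refl
  1^k≡1 (suc k) = trans (*-identityˡ _) (1^k≡1 k)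

  -- A vector of length d holds the lower coefficients, constant term first, of a monic
  -- polynomial of degree d.
  eval : ∀ {d} → Vec Carrier d → Carrier → Carrier
  eval [] x = 1#
  eval (c ∷ cs) x = c + x * eval cs x

  -- Synthetic division by X - a (Horner's scheme): the coefficients of the quotient are the values
  -- at a of the successive tails of the polynomial.
  quotient : ∀ {d} → Vec Carrier (suc d) → Carrier → Vec Carrier d
  quotient (c ∷ []) a = []
  quotient (c ∷ cs@(_ ∷ _)) a = eval cs a ∷ quotient cs a

  -- The point is written t + a, with t in place of x - a, so that the identity contains no
  -- subtraction and holds in every commutative semiring.
  eval-quotient : ∀ {d} (f : Vec Carrier (suc d)) t a →
    eval f (t + a) ≡ t * eval (quotient f a) (t + a) + eval f a
  eval-quotient (c ∷ []) t a =
    solve 3 (λ c t a → c :+ (t :+ a) :* con 1 := t :* con 1 :+ (c :+ a :* con 1)) refl c t a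
  eval-quotient (c ∷ cs@(_ ∷ _)) t a = trans
    (cong (λ e → c + (t + a) * e) (eval-quotient cs t a))
    (solve 5 (λ c t a q e → c :+ (t :+ a) :* (t :* q :+ e) := t :* (e :+ (t :+ a) :* q) :+ (c :+ a :* e))
      refl c t a (eval (quotient cs a) (t + a)) (eval cs a))

  -- At a root x other than a the factor x - a is invertible, so x is a root of the quotient by X -
  -- a, which is again monic. The descent ends at the constant polynomial 1, which has no root.
  roots-bound : ∀ {d} (f : Vec Carrier d) {xs} → Unique xs → (∀ {x} → x ∈ xs → eval f x ≡ 0#) → length xs ≤ d
  roots-bound f {[]} _ _ = z≤n
  roots-bound [] {x ∷ xs} _ root = contradiction (sym (root (here refl))) 0≢1
  roots-bound f@(_ ∷ _) {a ∷ xs} (a∉xs ∷ u) root = s≤s (roots-bound (quotient f a) u root′)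
    where
    root′ : ∀ {x} → x ∈ xs → eval (quotient f a) x ≡ 0#
    root′ {x} x∈xs = x*y≡0⇒y≡0 (λ x-a≡0 → All.lookup a∉xs x∈xs (sym (x∙y⁻¹≈ε⇒x≈y x a x-a≡0))) (begin
      (x + - a) * eval (quotient f a) x                           ≡⟨ cong (λ y → (x + - a) * eval (quotient f a) y) x≡ ⟩
      (x + - a) * eval (quotient f a) ((x + - a) + a)             ≡⟨ +-identityʳ _ ⟨
      (x + - a) * eval (quotient f a) ((x + - a) + a) + 0#        ≡⟨ cong ((x + - a) * eval (quotient f a) ((x + - a) + a) +_) (root (here refl)) ⟨
      (x + - a) * eval (quotient f a) ((x + - a) + a) + eval f a  ≡⟨ eval-quotient f (x + - a) a ⟨
      eval f ((x + - a) + a)                                      ≡⟨ cong (eval f) x≡ ⟨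
      eval f x                                                    ≡⟨ root (there x∈xs) ⟩
      0#                                                          ∎)
      where
      x≡ : x ≡ (x + - a) + a
      x≡ = sym (trans (+-assoc x (- a) a) (trans (cong (x +_) (-‿inverseˡ a)) (+-identityʳ x)))

  eval-xᵏ : ∀ k x → eval (Vec.replicate k 0#) x ≡ x ^ k
  eval-xᵏ zero x = refl
  eval-xᵏ (suc k) x = trans (+-identityˡ _) (cong (x *_) (eval-xᵏ k x))

  roots-of-unity-bound : ∀ {d xs} → 0 < d → Unique xs → (∀ {x} → x ∈ xs → x ^ d ≡ 1#) → length xs ≤ d
  roots-of-unity-bound {suc d} _ u root = roots-bound (- 1# ∷ Vec.replicate d 0#) u λ {x} x∈xs → begin
    - 1# + x * eval (Vec.replicate d 0#) x  ≡⟨ cong (λ y → - 1# + x * y) (eval-xᵏ d x) ⟩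
    - 1# + x ^ suc d                        ≡⟨ cong (- 1# +_) (root x∈xs) ⟩
    - 1# + 1#                               ≡⟨ -‿inverseˡ 1# ⟩
    0#                                      ∎

  -- Units, Fermat's theorem and orders of elements

  nonzero? : Decidable (_≢ 0#)
  nonzero? x = ¬? (x ≟ 0#)

  units : List Carrier
  units = filter nonzero? elements

  units-unique : Unique units
  units-unique = Unique.filter⁺ nonzero? unique

  ∈-units⁺ : ∀ {x} → x ≢ 0# → x ∈ units
  ∈-units⁺ {x} = ∈-filter⁺ nonzero? (complete x)

  ∈-units⁻ : ∀ {x} → x ∈ units → x ≢ 0#
  ∈-units⁻ = proj₂ ∘ ∈-filter⁻ nonzero? {xs = elements}

  elements-↭ : elements ↭ 0# ∷ units
  elements-↭ = sameMembers⇒↭ unique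
    (All.tabulate (λ p → ∈-units⁻ p ∘ sym) ∷ units-unique) fwd (λ {x} _ → complete x)
    where
    fwd : ∀ {x} → x ∈ elements → x ∈ 0# ∷ units
    fwd {x} _ with x ≟ 0#
    ... | yes refl = here refl
    ... | no x≢0 = there (∈-units⁺ x≢0)

  n : ℕ
  n = length units

  size≡1+n : size ≡ suc n
  size≡1+n = ↭-length elements-↭

  instance
    n≢0 : NonZero n
    n≢0 = >-nonZero (∈-length (∈-units⁺ (0≢1 ∘ sym)))

  product : List Carrier → Carrier
  product = foldr _*_ 1#

  product-nonzero : ∀ {xs} → (∀ {x} → x ∈ xs → x ≢ 0#) → product xs ≢ 0#
  product-nonzero {[]} _ = 0≢1 ∘ sym
  product-nonzero {x ∷ xs} nz = *-nonzero (nz (here refl)) (product-nonzero (nz ∘ there))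

  product-map-* : ∀ x xs → product (map (x *_) xs) ≡ x ^ length xs * product xs
  product-map-* x [] = sym (*-identityˡ 1#)
  product-map-* x (y ∷ ys) = trans (cong (x * y *_) (product-map-* x ys))
    (solve 4 (λ x y p q → x :* y :* (p :* q) := x :* p :* (y :* q)) refl x y (x ^ length ys) (product ys))

  -- Multiplication by x permutes the units, so the product of all units equals x ^ n times itself,
  -- and it can be cancelled.
  fermat : ∀ {x} → x ≢ 0# → x ^ n ≡ 1#
  fermat {x} x≢0 = *-cancelˡ (product-nonzero ∈-units⁻) (begin
    product units * x ^ n        ≡⟨ *-comm _ _ ⟩
    x ^ n * product units        ≡⟨ product-map-* x units ⟨
    product (map (x *_) units)   ≡⟨ foldr-commMonoid (setoid Carrier) (CommutativeRing.*-isCommutativeMonoid commutativeRing) (↭⇒↭ₛ shuffle) ⟩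
    product units                ≡⟨ *-identityʳ _ ⟨
    product units * 1#           ∎)
    where
    scaled-unique : Unique (map (x *_) units)
    scaled-unique = Unique.map⁺ (*-cancelˡ x≢0) units-unique
    sub : ∀ {y} → y ∈ map (x *_) units → y ∈ units
    sub p with y , y∈ , refl ← ∈-map⁻ (x *_) p = ∈-units⁺ (*-nonzero x≢0 (∈-units⁻ y∈))
    shuffle : map (x *_) units ↭ units
    shuffle = sameMembers⇒↭ scaled-unique units-unique sub
      (⊆∧length≤⇒⊇ _≟_ units-unique scaled-unique sub (ℕ.≤-reflexive (sym (List.length-map (x *_) units))))

  -- The exponent is `suc j`, which excludes 0. For a unit, `fermat` gives a hit at j = n - 1,
  -- within the bound; at `0#` the search fails and leaves the meaningless value `suc n`.
  ord : Carrier → ℕ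
  ord x = suc (findLeast (λ j → x ^ suc j ≟ 1#) n)

  x^ord≡1 : ∀ {x} → x ≢ 0# → x ^ ord x ≡ 1#
  x^ord≡1 {x} x≢0 = findLeast-holds (λ j → x ^ suc j ≟ 1#) {ℕ.pred n} {n} ℕ.pred[n]≤n
    (trans (cong (x ^_) (ℕ.suc-pred n)) (fermat x≢0))

  ord-minimal : ∀ {x j} → 0 < j → j < ord x → x ^ j ≢ 1#
  ord-minimal {x} {suc j} _ (s≤s j<) = findLeast-minimal (λ j → x ^ suc j ≟ 1#) n j<

  -- A nonzero remainder of k modulo `ord x` would be a smaller positive exponent sending x to 1.
  ord∣ : ∀ {x k} → x ≢ 0# → x ^ k ≡ 1# → ord x ∣ k
  ord∣ {x} {k} x≢0 x^k≡1 with k % ord x | m%n<n k (ord x) | m≡m%n+[m/n]*n k (ord x)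
  ... | zero | _ | k≡ = divides (k / ord x) k≡
  ... | suc r | r< | k≡ = contradiction (begin
      x ^ suc r                                          ≡⟨ *-identityʳ _ ⟨
      x ^ suc r * 1#                                     ≡⟨ cong (x ^ suc r *_) (1^k≡1 (k / ord x)) ⟨
      x ^ suc r * 1# ^ (k / ord x)                       ≡⟨ cong (λ y → x ^ suc r * y ^ (k / ord x)) (x^ord≡1 x≢0) ⟨
      x ^ suc r * (x ^ ord x) ^ (k / ord x)              ≡⟨ cong (x ^ suc r *_) (^-assocʳ x (ord x) (k / ord x)) ⟩
      x ^ suc r * x ^ (ord x ℕ.* (k / ord x))            ≡⟨ ^-homo-* x (suc r) (ord x ℕ.* (k / ord x)) ⟨
      x ^ (suc r ℕ.+ ord x ℕ.* (k / ord x))              ≡⟨ cong (λ e → x ^ (suc r ℕ.+ e)) (ℕ.*-comm (ord x) (k / ord x)) ⟩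
      x ^ (suc r ℕ.+ (k / ord x) ℕ.* ord x)              ≡⟨ cong (x ^_) k≡ ⟨
      x ^ k                                              ≡⟨ x^k≡1 ⟩
      1#                                                 ∎)
    (ord-minimal (s≤s z≤n) r<)

  pow-injective : ∀ {x i j} → x ≢ 0# → i < j → j < i ℕ.+ ord x → x ^ i ≢ x ^ j
  pow-injective {x} {i} {j} x≢0 i<j j< eq = ord-minimal (ℕ.m<n⇒0<n∸m i<j)
    (ℕ.+-cancelˡ-< i _ _ (subst (ℕ._< i ℕ.+ ord x) (sym (ℕ.m+[n∸m]≡n (ℕ.<⇒≤ i<j))) j<))
    (*-cancelˡ (^-nonzero x≢0 i) (begin
      x ^ i * x ^ (j ∸ i)   ≡⟨ ^-homo-* x i (j ∸ i) ⟨
      x ^ (i ℕ.+ (j ∸ i))   ≡⟨ cong (x ^_) (ℕ.m+[n∸m]≡n (ℕ.<⇒≤ i<j)) ⟩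
      x ^ j                 ≡⟨ eq ⟨
      x ^ i                 ≡⟨ *-identityʳ _ ⟨
      x ^ i * 1#            ∎))

  powers₁ : Carrier → List Carrier
  powers₁ x = map (x ^_) (range₁ (ord x))

  powers₁-applyUpTo : ∀ x → powers₁ x ≡ applyUpTo (λ i → x ^ suc i) (ord x)
  powers₁-applyUpTo x = trans (cong (map (x ^_)) (List.map-upTo suc (ord x))) (List.map-applyUpTo suc (x ^_) (ord x))

  powers₁-unique : ∀ {x} → x ≢ 0# → Unique (powers₁ x)
  powers₁-unique {x} x≢0 = subst Unique (sym (powers₁-applyUpTo x))
    (Unique.applyUpTo⁺₁ (λ i → x ^ suc i) (ord x) λ i<j j<d → pow-injective x≢0 (s≤s i<j) (s≤s (ℕ.m≤n⇒m≤o+n _ j<d)))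

  length-powers₁ : ∀ x → length (powers₁ x) ≡ ord x
  length-powers₁ x = trans (List.length-map (x ^_) (range₁ (ord x))) (trans (List.length-map suc (upTo (ord x))) (List.length-upTo (ord x)))

  pow-root : ∀ x d → x ^ d ≡ 1# → ∀ k → (x ^ k) ^ d ≡ 1#
  pow-root x d eq k = begin
    (x ^ k) ^ d      ≡⟨ ^-assocʳ x k d ⟩
    x ^ (k ℕ.* d)    ≡⟨ cong (x ^_) (ℕ.*-comm k d) ⟩
    x ^ (d ℕ.* k)    ≡⟨ ^-assocʳ x d k ⟨
    (x ^ d) ^ k      ≡⟨ cong (_^ k) eq ⟩
    1# ^ k           ≡⟨ 1^k≡1 k ⟩
    1#               ∎

  -- The d powers of an element of order d already exhaust the roots of X^d - 1.
  root⇒∈-powers₁ : ∀ {g x} → g ≢ 0# → x ^ ord g ≡ 1# → x ∈ powers₁ g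
  root⇒∈-powers₁ {g} {x} g≢0 root with DecMembership._∈?_ _≟_ x (powers₁ g)
  ... | yes p = p
  ... | no x∉ = contradiction (roots-of-unity-bound {d = ord g} (s≤s z≤n)
      (All.tabulate (λ p eq → x∉ (subst (_∈ powers₁ g) (sym eq) p)) ∷ powers₁-unique g≢0) allRoots)
      (ℕ.<⇒≱ (s≤s (ℕ.≤-reflexive (sym (length-powers₁ g)))))
    where
    allRoots : ∀ {y} → y ∈ x ∷ powers₁ g → y ^ ord g ≡ 1#
    allRoots (here refl) = root
    allRoots (there p) with k , _ , refl ← ∈-map⁻ (g ^_) {xs = range₁ (ord g)} p = pow-root g (ord g) (x^ord≡1 g≢0) k

  -- With e the gcd, the exponent `ord g` / e already sends g ^ k to 1. For e > 1 it would be
  -- smaller than `ord g`, the assumed order of g ^ k.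
  ord-pow⇒coprime : ∀ {g} k → g ≢ 0# → ord (g ^ k) ≡ ord g → gcd k (ord g) ≡ 1
  ord-pow⇒coprime {g} k g≢0 eq with gcd[m,n]∣m k (ord g) | gcd[m,n]∣n k (ord g)
  ... | divides k′ k≡ | divides zero ()
  ... | divides k′ k≡ | divides d′@(suc _) d≡ with gcd k (ord g)
  ...   | zero = contradiction (trans d≡ (ℕ.*-zeroʳ d′)) λ ()
  ...   | suc zero = refl
  ...   | e@(suc (suc _)) = contradiction
    (begin
      (g ^ k) ^ d′           ≡⟨ ^-assocʳ g k d′ ⟩
      g ^ (k ℕ.* d′)         ≡⟨ cong (g ^_) (trans (cong (ℕ._* d′) k≡) (trans (ℕ.*-assoc k′ e d′) (trans (cong (k′ ℕ.*_) (trans (ℕ.*-comm e d′) (sym d≡))) (ℕ.*-comm k′ (ord g))))) ⟩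
      g ^ (ord g ℕ.* k′)     ≡⟨ ^-assocʳ g (ord g) k′ ⟨
      (g ^ ord g) ^ k′       ≡⟨ cong (_^ k′) (x^ord≡1 g≢0) ⟩
      1# ^ k′                ≡⟨ 1^k≡1 k′ ⟩
      1#                     ∎)
    (ord-minimal {g ^ k} {d′} (s≤s z≤n) (ℕ.<-≤-trans (ℕ.m<m*n d′ e (s≤s (s≤s z≤n))) (ℕ.≤-reflexive (trans (sym d≡) (sym eq)))))

  ψ : ℕ → ℕ
  ψ d = Σ[ x ∈ units ] 𝟙 (ord x ℕ.≟ d)

  -- All units of order `ord g` are powers of g by `root⇒∈-powers₁`, and only powers with exponent
  -- coprime to `ord g` can have that order.
  ψ≤φ-ord : ∀ {g} → g ≢ 0# → ψ (ord g) ≤ φ (ord g)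
  ψ≤φ-ord {g} g≢0 = bound
    where
    ofOrder : List Carrier → List Carrier
    ofOrder = filter (λ x → ord x ℕ.≟ ord g)

    sub : ∀ {x} → x ∈ ofOrder units → x ∈ ofOrder (powers₁ g)
    sub {x} p with x∈ , eq ← ∈-filter⁻ (λ x → ord x ℕ.≟ ord g) {xs = units} p =
      ∈-filter⁺ (λ x → ord x ℕ.≟ ord g) (root⇒∈-powers₁ g≢0 (trans (cong (x ^_) (sym eq)) (x^ord≡1 (∈-units⁻ x∈)))) eq

    𝟙≤ : ∀ k → 𝟙 (ord (g ^ k) ℕ.≟ ord g) ≤ 𝟙 (gcd k (ord g) ℕ.≟ 1)
    𝟙≤ k = 𝟙-mono (ord (g ^ k) ℕ.≟ ord g) (gcd k (ord g) ℕ.≟ 1) (ord-pow⇒coprime k g≢0)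

    bound : ψ (ord g) ≤ φ (ord g)
    bound = ℕ.≤-trans (ℕ.≤-reflexive (sym (length-filter (λ x → ord x ℕ.≟ ord g) units)))
      (ℕ.≤-trans (⊆⇒length≤ _≟_ (Unique.filter⁺ (λ x → ord x ℕ.≟ ord g) (powers₁-unique g≢0)) (Unique.filter⁺ (λ x → ord x ℕ.≟ ord g) units-unique) sub)
      (ℕ.≤-trans (ℕ.≤-reflexive (trans (length-filter (λ x → ord x ℕ.≟ ord g) (powers₁ g)) (Σ-map (g ^_) (range₁ (ord g)) _)))
      (ℕ.≤-trans (Σ-mono (range₁ (ord g)) (λ k _ → 𝟙≤ k))
      (ℕ.≤-reflexive (sym (length-filter (λ k → gcd k (ord g) ℕ.≟ 1) (range₁ (ord g))))))))

  ψ≤φ : ∀ d → ψ d ≤ φ d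
  ψ≤φ d with any? (λ x → ord x ℕ.≟ d) units
  ... | yes found with g , g∈ , refl ← find found = ψ≤φ-ord (∈-units⁻ g∈)
  ... | no none = ℕ.≤-trans (ℕ.≤-reflexive (Σ-zero units λ x x∈ →
      𝟙-no (ord x ℕ.≟ d) (λ eq → none (lose x∈ eq)))) z≤n

  Σ-ψ : Σₗ (divisors n) ψ ≡ n
  Σ-ψ = begin
    Σₗ (divisors n) ψ               ≡⟨ Σ-cong (divisors n) (λ d → ℕ.*-identityʳ (ψ d)) ⟨
    Σ[ d ∈ divisors n ] (ψ d ℕ.* 1) ≡⟨ Σ-fibres ℕ._≟_ ord units (divisors-unique n)
                                        (λ x∈ → ∈-divisors⁺ (s≤s z≤n) (ord∣ (∈-units⁻ x∈) (fermat (∈-units⁻ x∈)))) (λ _ → 1) ⟨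
    Σ[ _ ∈ units ] 1                ≡⟨ Σ-one units ⟩
    n                               ∎

  0<φ : ∀ {d} → 0 < d → 0 < φ d
  0<φ {d} 0<d = ∈-length (∈-filter⁺ (λ k → gcd k d ℕ.≟ 1) (∈-range₁⁺ (s≤s z≤n) 0<d) (gcd-zeroˡ d))

  -- Without a unit of order n = q - 1, n = Σ ψ d would be less than Σ φ d = n.
  generator : ∃ λ g → g ≢ 0# × ord g ≡ n
  generator with any? (λ x → ord x ℕ.≟ n) units
  ... | yes found with g , g∈ , eq ← find found = g , ∈-units⁻ g∈ , eq
  ... | no none = contradiction (trans Σ-ψ (sym (Σ-φ n)))
    (ℕ.<⇒≢ (Σ-mono-< (divisors n) (λ d _ → ψ≤φ d)
      (∈-divisors⁺ (ℕ.>-nonZero⁻¹ n) (divides 1 (sym (ℕ.*-identityˡ n))))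
      (subst (ℕ._< φ n) (sym (Σ-zero units λ x x∈ →
        𝟙-no (ord x ℕ.≟ n) (λ eq → none (lose x∈ eq)))) (0<φ (ℕ.>-nonZero⁻¹ n)))))

  gen : Carrier
  gen = proj₁ generator

  gen≢0 : gen ≢ 0#
  gen≢0 = proj₁ (proj₂ generator)

  units-↭ : units ↭ map (gen ^_) (range₁ n)
  units-↭ = subst (λ d → units ↭ map (gen ^_) (range₁ d)) (proj₂ (proj₂ generator))
    (sameMembers⇒↭ units-unique (powers₁-unique gen≢0)
      (λ {x} x∈ → root⇒∈-powers₁ gen≢0 (trans (cong (x ^_) (proj₂ (proj₂ generator))) (fermat (∈-units⁻ x∈))))
      (λ p → let (k , _ , eq) = ∈-map⁻ (gen ^_) {xs = range₁ (ord gen)} p in ∈-units⁺ (subst (_≢ 0#) (sym eq) (^-nonzero gen≢0 k))))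

  gen^% : ∀ k → gen ^ (k % n) ≡ gen ^ k
  gen^% k = begin
    gen ^ (k % n)                            ≡⟨ *-identityʳ _ ⟨
    gen ^ (k % n) * 1#                       ≡⟨ cong (gen ^ (k % n) *_) (pow-root gen n (fermat gen≢0) (k / n)) ⟨
    gen ^ (k % n) * (gen ^ (k / n)) ^ n      ≡⟨ cong (gen ^ (k % n) *_) (^-assocʳ gen (k / n) n) ⟩
    gen ^ (k % n) * gen ^ ((k / n) ℕ.* n)    ≡⟨ ^-homo-* gen (k % n) _ ⟨
    gen ^ (k % n ℕ.+ (k / n) ℕ.* n)          ≡⟨ cong (gen ^_) (m≡m%n+[m/n]*n k n) ⟨
    gen ^ k                                  ∎

  gen^-injective : ∀ {i j} → i < n → j < n → gen ^ i ≡ gen ^ j → i ≡ j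
  gen^-injective {i} {j} i<n j<n eq with ℕ.<-cmp i j
  ... | tri≈ _ i≡j _ = i≡j
  ... | tri< i<j _ _ = contradiction eq (pow-injective gen≢0 i<j (ℕ.m≤n⇒m≤o+n i (subst (j <_) (sym (proj₂ (proj₂ generator))) j<n)))
  ... | tri> _ _ j<i = contradiction (sym eq) (pow-injective gen≢0 j<i (ℕ.m≤n⇒m≤o+n j (subst (i <_) (sym (proj₂ (proj₂ generator))) i<n)))

-- Words, multisets and rearrangements

module _ where

  open import Data.Nat using (_+_; _*_)
  open import Data.Nat.Properties hiding (_≟_; suc-injective)
  open import Data.Fin.Properties using (_≟_; all?)

  private
    variable
      A : Set
      k m n : ℕ

  lookup-ext : {v w : Vec A n} → (∀ i → lookup v i ≡ lookup w i) → v ≡ w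
  lookup-ext {v = v} {w} eq = trans (sym (tabulate∘lookup v)) (trans (tabulate-cong eq) (tabulate∘lookup w))

  lookup∈toList : (v : Vec A n) (i : Fin n) → lookup v i ∈ toList v
  lookup∈toList v i = ∈-toList⁺ (∈-lookup i v)

  ∈toList⇒lookup : (v : Vec A n) {x : A} → x ∈ toList v → ∃ λ i → lookup v i ≡ x
  ∈toList⇒lookup (x ∷ v) (here refl) = zero , refl
  ∈toList⇒lookup (x ∷ v) (there p) with i , eq ← ∈toList⇒lookup v p = suc i , eq

  unique⇒injective : (v : Vec A n) → Unique (toList v) → ∀ i j → lookup v i ≡ lookup v j → i ≡ j
  unique⇒injective (x ∷ v) (x∉v ∷ u) zero zero _ = refl
  unique⇒injective (x ∷ v) (x∉v ∷ u) zero (suc j) eq = contradiction eq (All.lookup x∉v (lookup∈toList v j))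
  unique⇒injective (x ∷ v) (x∉v ∷ u) (suc i) zero eq = contradiction (sym eq) (All.lookup x∉v (lookup∈toList v i))
  unique⇒injective (x ∷ v) (x∉v ∷ u) (suc i) (suc j) eq = cong suc (unique⇒injective v u i j eq)

  injective⇒unique : (v : Vec A n) → (∀ i j → lookup v i ≡ lookup v j → i ≡ j) → Unique (toList v)
  injective⇒unique [] inj = []
  injective⇒unique (x ∷ v) inj =
    All.tabulate (λ y∈ x≡y → let (i , eq) = ∈toList⇒lookup v y∈ in contradiction (inj zero (suc i) (trans x≡y (sym eq))) λ ())
    ∷ injective⇒unique v (λ i j eq → Fin.suc-injective (inj (suc i) (suc j) eq))

  permutation-↭ : (π : Vec (Fin n) n) → Unique (toList π) → toList π ↭ allFin n
  permutation-↭ {n} π u = sameMembers⇒↭ u (Unique.allFin⁺ n) (λ _ → ∈-allFin _)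
    (⊆∧length≤⇒⊇ _≟_ (Unique.allFin⁺ n) u (λ _ → ∈-allFin _)
      (≤-reflexive (trans (List.length-tabulate (λ i → i)) (sym (length-toList π)))))

  injective⇒surjective : (τ : Fin k → Fin k) → (∀ {i j} → τ i ≡ τ j → i ≡ j) → ∀ j → ∃ λ i → j ≡ τ i
  injective⇒surjective {k} τ inj j =
    let (i , _ , eq) = ∈-map⁻ τ (⊆∧length≤⇒⊇ _≟_ (Unique.allFin⁺ k) (Unique.map⁺ inj (Unique.allFin⁺ k)) (λ _ → ∈-allFin _)
                         (≤-reflexive (sym (List.length-map τ (allFin k)))) (∈-allFin j))
    in i , eq

  Σ-allFin-suc : ∀ n (f : Fin (suc n) → ℕ) → Σₗ (allFin (suc n)) f ≡ f zero + Σ[ i ∈ allFin n ] f (suc i)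
  Σ-allFin-suc n f = cong (f zero +_) (trans (cong (λ l → Σₗ l f) (sym (List.map-tabulate (λ i → i) suc))) (Σ-map suc (allFin n) f))

  Σ-lookup : (μ : Vec ℕ k) → Σₗ (allFin k) (lookup μ) ≡ Vec.sum μ
  Σ-lookup [] = refl
  Σ-lookup (a ∷ μ) = trans (Σ-allFin-suc _ (lookup (a ∷ μ))) (cong (a +_) (Σ-lookup μ))

  Σ-toList-allFin : (v : Vec A n) (f : A → ℕ) → Σₗ (toList v) f ≡ Σ[ i ∈ allFin n ] f (lookup v i)
  Σ-toList-allFin [] f = refl
  Σ-toList-allFin {n = suc n} (x ∷ v) f = trans (cong (f x +_) (Σ-toList-allFin v f)) (sym (Σ-allFin-suc n (f ∘ lookup (x ∷ v))))

  raise : Vec ℕ k → Fin k → Vec ℕ k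
  raise μ x = updateAt μ x suc

  lookup-raise : (μ : Vec ℕ k) (x y : Fin k) → lookup (raise μ x) y ≡ 𝟙 (x ≟ y) + lookup μ y
  lookup-raise μ x y with x ≟ y
  ... | yes refl = lookup∘updateAt x μ
  ... | no x≢y = lookup∘updateAt′ y x (x≢y ∘ sym) μ

  sum-raise : (μ : Vec ℕ k) (x : Fin k) → Vec.sum (raise μ x) ≡ suc (Vec.sum μ)
  sum-raise (a ∷ μ) zero = refl
  sum-raise (a ∷ μ) (suc x) = trans (cong (a +_) (sum-raise μ x)) (+-suc a _)

  -- The multiset of letters of a word, encoded by the multiplicity of each letter.
  mult : Vec (Fin k) n → Vec ℕ k
  mult [] = replicate _ 0
  mult (x ∷ w) = raise (mult w) x

  lookup-mult : (w : Vec (Fin k) n) (y : Fin k) → lookup (mult w) y ≡ Σ[ x ∈ toList w ] 𝟙 (x ≟ y)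
  lookup-mult [] y = lookup-replicate y 0
  lookup-mult (x ∷ w) y = trans (lookup-raise (mult w) x y) (cong (𝟙 (x ≟ y) +_) (lookup-mult w y))

  sum-replicate-0 : ∀ k → Vec.sum (replicate k 0) ≡ 0
  sum-replicate-0 zero = refl
  sum-replicate-0 (suc k) = sum-replicate-0 k

  sum-mult : (w : Vec (Fin k) n) → Vec.sum (mult w) ≡ n
  sum-mult {k} [] = sum-replicate-0 k
  sum-mult (x ∷ w) = trans (sum-raise (mult w) x) (cong suc (sum-mult w))

  mult-permute : (w : Vec (Fin k) n) (π : Vec (Fin n) n) → Unique (toList π) → mult (Vec.map (lookup w) π) ≡ mult w
  mult-permute {n = n} w π u = lookup-ext λ y → begin
    lookup (mult (Vec.map (lookup w) π)) y               ≡⟨ lookup-mult (Vec.map (lookup w) π) y ⟩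
    Σ[ x ∈ toList (Vec.map (lookup w) π) ] 𝟙 (x ≟ y)     ≡⟨ cong (λ l → Σ[ x ∈ l ] 𝟙 (x ≟ y)) (toList-map (lookup w) π) ⟩
    Σ[ x ∈ List.map (lookup w) (toList π) ] 𝟙 (x ≟ y) ≡⟨ Σ-map (lookup w) (toList π) _ ⟩
    Σ[ i ∈ toList π ] 𝟙 (lookup w i ≟ y)             ≡⟨ Σ-↭ _ (permutation-↭ π u) ⟩
    Σ[ i ∈ allFin n ] 𝟙 (lookup w i ≟ y)             ≡⟨ Σ-toList-allFin w _ ⟨
    Σ[ x ∈ toList w ] 𝟙 (x ≟ y)                      ≡⟨ lookup-mult w y ⟨
    lookup (mult w) y ∎
    where open ≡-Reasoning

  -- The number of ways to spell a word with multiplicities b from a stock with a copies of each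
  -- letter, the copies being distinguishable.
  falling : Vec ℕ k → Vec ℕ k → ℕ
  falling [] [] = 1
  falling (a ∷ as) (b ∷ bs) = (a P′ b) * falling as bs

  factorials : Vec ℕ k → ℕ
  factorials [] = 1
  factorials (a ∷ as) = a ! * factorials as

  falling-raise : (α μ : Vec ℕ k) (x : Fin k) → falling α (raise μ x) ≡ falling α μ * (lookup α x ∸ lookup μ x)
  falling-raise (a ∷ α) (b ∷ μ) zero =
    solve 3 (λ d p f → d :* p :* f := p :* f :* d) refl (a ∸ b) (a P′ b) (falling α μ)
    where open +-*-Solver
  falling-raise (a ∷ α) (b ∷ μ) (suc x) = trans (cong ((a P′ b) *_) (falling-raise α μ x)) (sym (*-assoc (a P′ b) _ _))

  factorials-raise : (μ : Vec ℕ k) (x : Fin k) → factorials (raise μ x) ≡ factorials μ * suc (lookup μ x)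
  factorials-raise (a ∷ μ) zero =
    solve 3 (λ s p f → s :* p :* f := p :* f :* s) refl (suc a) (a !) (factorials μ)
    where open +-*-Solver
  factorials-raise (a ∷ μ) (suc x) = trans (cong (a ! *_) (factorials-raise μ x)) (sym (*-assoc (a !) _ _))

  falling-refl : (μ : Vec ℕ k) → falling μ μ ≡ factorials μ
  falling-refl [] = refl
  falling-refl (a ∷ μ) = cong₂ _*_ (nP′n≡n! a) (falling-refl μ)

  n<k⇒nP′k≡0 : n < k → n P′ k ≡ 0
  n<k⇒nP′k≡0 {n} {suc k} (s≤s n≤k) = cong (_* (n P′ k)) (m≤n⇒m∸n≡0 n≤k)

  -- Since α is different from μ and has no larger total, some letter is scarcer in α than in μ, and
  -- its factor vanishes.
  falling-≢ : (α μ : Vec ℕ k) → Vec.sum α ≤ Vec.sum μ → α ≢ μ → falling α μ ≡ 0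
  falling-≢ [] [] _ α≢μ = contradiction refl α≢μ
  falling-≢ (a ∷ α) (b ∷ μ) le α≢μ with <-cmp a b
  ... | tri< a<b _ _ = cong (_* falling α μ) (n<k⇒nP′k≡0 a<b)
  ... | tri≈ _ refl _ = trans (cong ((a P′ a) *_) (falling-≢ α μ (+-cancelˡ-≤ a _ _ le) (α≢μ ∘ cong (a ∷_)))) (*-zeroʳ (a P′ a))
  ... | tri> _ _ b<a = trans (cong ((a P′ b) *_) (falling-≢ α μ (<⇒≤ lt) (λ { refl → <-irrefl refl lt }))) (*-zeroʳ (a P′ b))
    where
    lt : Vec.sum α < Vec.sum μ
    lt = +-cancelˡ-< b _ _ (<-≤-trans (+-monoˡ-< (Vec.sum α) b<a) le)

  unique? : (ρ : Vec (Fin n) m) → Dec (Unique (toList ρ))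
  unique? {n} ρ = DecUnique.unique? (_≟_ {n = n}) (toList ρ)

  _≟ᵥ_ : (v w : Vec (Fin n) m) → Dec (v ≡ w)
  _≟ᵥ_ = ≡-dec _≟_

  -- Injective choices of positions of B at which w is read. The lengths n and m are kept apart so
  -- that w can be shortened letter by letter while B stays fixed; for n = m the choices are the
  -- permutations.
  embeddings : Vec (Fin k) n → Vec (Fin k) m → ℕ
  embeddings {n = n} {m} B w = Σ[ ρ ∈ allVecs (allFin n) m ] (𝟙 (unique? ρ) * 𝟙 (Vec.map (lookup B) ρ ≟ᵥ w))

  fresh? : (j : Fin n) (ρ : Vec (Fin n) m) → Dec (j ∉ toList ρ)
  fresh? j ρ = ¬? (DecMembership._∈?_ _≟_ j (toList ρ))

  𝟙-unique-∷ : (j : Fin n) (ρ : Vec (Fin n) m) → 𝟙 (unique? (j ∷ ρ)) ≡ 𝟙 (fresh? j ρ) * 𝟙 (unique? ρ)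
  𝟙-unique-∷ j ρ = trans
    (𝟙-cong (unique? (j ∷ ρ)) (fresh? j ρ ×-dec unique? ρ)
      (λ { u@(_ ∷ u′) → Unique.Unique[x∷xs]⇒x∉xs u , u′ })
      (λ (j∉ , u) → All.tabulate (λ i∈ j≡i → j∉ (subst (_∈ toList ρ) (sym j≡i) i∈)) ∷ u))
    (𝟙-× (fresh? j ρ) (unique? ρ))

  𝟙-≟-∷ : (x y : Fin n) (v w : Vec (Fin n) m) → 𝟙 ((x ∷ v) ≟ᵥ (y ∷ w)) ≡ 𝟙 (x ≟ y) * 𝟙 (v ≟ᵥ w)
  𝟙-≟-∷ x y v w = trans
    (𝟙-cong ((x ∷ v) ≟ᵥ (y ∷ w)) (x ≟ y ×-dec v ≟ᵥ w) ∷-injective (λ { (refl , refl) → refl }))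
    (𝟙-× (x ≟ y) (v ≟ᵥ w))

  -- As ρ has no repetition, its positions form a sublist of all positions, and the truncated
  -- subtraction is exact: it counts the occurrences of x in B that ρ leaves free.
  fresh-positions : (B : Vec (Fin k) n) (ρ : Vec (Fin n) m) (x : Fin k) → Unique (toList ρ) →
    Σ[ j ∈ allFin n ] (𝟙 (fresh? j ρ) * 𝟙 (lookup B j ≟ x)) ≡ lookup (mult B) x ∸ lookup (mult (Vec.map (lookup B) ρ)) x
  fresh-positions {n = n} B ρ x u = begin
    Σ[ j ∈ allFin n ] (𝟙 (fresh? j ρ) * f j)                    ≡⟨ Σ-filter (λ j → fresh? j ρ) (allFin n) f ⟨
    Σₗ (complement _≟_ (toList ρ) (allFin n)) f                 ≡⟨ m+n∸m≡n (Σₗ (toList ρ) f) _ ⟨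
    Σₗ (toList ρ) f + Σₗ (complement _≟_ (toList ρ) (allFin n)) f ∸ Σₗ (toList ρ) f
      ≡⟨ cong (_∸ Σₗ (toList ρ) f) (Σ-complement _≟_ (Unique.allFin⁺ n) u (λ _ → ∈-allFin _) f) ⟩
    Σₗ (allFin n) f ∸ Σₗ (toList ρ) f                           ≡⟨ cong₂ _∸_ total used ⟩
    lookup (mult B) x ∸ lookup (mult (Vec.map (lookup B) ρ)) x      ∎
    where
    open ≡-Reasoning
    f : Fin n → ℕ
    f j = 𝟙 (lookup B j ≟ x)
    total : Σₗ (allFin n) f ≡ lookup (mult B) x
    total = trans (sym (Σ-toList-allFin B (λ y → 𝟙 (y ≟ x)))) (sym (lookup-mult B x))
    used : Σₗ (toList ρ) f ≡ lookup (mult (Vec.map (lookup B) ρ)) x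
    used = sym (trans (lookup-mult (Vec.map (lookup B) ρ) x)
      (trans (cong (λ l → Σ[ y ∈ l ] 𝟙 (y ≟ x)) (toList-map (lookup B) ρ)) (Σ-map (lookup B) (toList ρ) _)))

  -- The head x of w is placed after its tail: whatever the positions of the tail, the number of
  -- free occurrences of x is the same, and it is the factor by which `falling` changes in
  -- `falling-raise`.
  embeddings≡falling : (B : Vec (Fin k) n) (w : Vec (Fin k) m) → embeddings B w ≡ falling (mult B) (mult w)
  embeddings≡falling {k} B [] = sym (falling-0 (mult B))
    where
    falling-0 : ∀ {k} (α : Vec ℕ k) → falling α (replicate k 0) ≡ 1
    falling-0 [] = refl
    falling-0 (a ∷ α) = trans (*-identityˡ _) (falling-0 α)
  embeddings≡falling {n = n} {suc m} B (x ∷ w) = begin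
    embeddings B (x ∷ w)
      ≡⟨ Σ-allVecs-suc (allFin n) m _ ⟩
    Σ[ j ∈ allFin n ] Σ[ ρ ∈ allVecs (allFin n) m ] (𝟙 (unique? (j ∷ ρ)) * 𝟙 (Vec.map (lookup B) (j ∷ ρ) ≟ᵥ (x ∷ w)))
      ≡⟨ Σ-cong (allFin n) (λ j → Σ-cong (allVecs (allFin n) m) (split j)) ⟩
    Σ[ j ∈ allFin n ] Σ[ ρ ∈ allVecs (allFin n) m ] (u ρ * (e ρ * (𝟙 (fresh? j ρ) * 𝟙 (lookup B j ≟ x))))
      ≡⟨ Σ-swap (allFin n) (allVecs (allFin n) m) _ ⟩
    Σ[ ρ ∈ allVecs (allFin n) m ] Σ[ j ∈ allFin n ] (u ρ * (e ρ * (𝟙 (fresh? j ρ) * 𝟙 (lookup B j ≟ x))))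
      ≡⟨ Σ-cong (allVecs (allFin n) m) (λ ρ → trans (Σ-*ˡ (allFin n) (u ρ) _) (cong (u ρ *_) (Σ-*ˡ (allFin n) (e ρ) _))) ⟩
    Σ[ ρ ∈ allVecs (allFin n) m ] (u ρ * (e ρ * Σ[ j ∈ allFin n ] (𝟙 (fresh? j ρ) * 𝟙 (lookup B j ≟ x))))
      -- Only repetition-free ρ that read w from B contribute, and for those the inner count no
      -- longer depends on ρ.
      ≡⟨ Σ-cong (allVecs (allFin n) m) (λ ρ → 𝟙-*-cong (unique? ρ) (λ uq → 𝟙-*-cong (Vec.map (lookup B) ρ ≟ᵥ w)
           (λ { refl → fresh-positions B ρ x uq }))) ⟩
    Σ[ ρ ∈ allVecs (allFin n) m ] (u ρ * (e ρ * c))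
      ≡⟨ Σ-cong (allVecs (allFin n) m) (λ ρ → sym (*-assoc (u ρ) (e ρ) c)) ⟩
    Σ[ ρ ∈ allVecs (allFin n) m ] (u ρ * e ρ * c)
      ≡⟨ Σ-*ʳ (allVecs (allFin n) m) c _ ⟩
    embeddings B w * c
      ≡⟨ cong (_* c) (embeddings≡falling B w) ⟩
    falling (mult B) (mult w) * c
      ≡⟨ falling-raise (mult B) (mult w) x ⟨
    falling (mult B) (mult (x ∷ w)) ∎
    where
    open ≡-Reasoning
    c = lookup (mult B) x ∸ lookup (mult w) x
    u e : Vec (Fin n) m → ℕ
    u ρ = 𝟙 (unique? ρ)
    e ρ = 𝟙 (Vec.map (lookup B) ρ ≟ᵥ w)
    split : ∀ j ρ → 𝟙 (unique? (j ∷ ρ)) * 𝟙 (Vec.map (lookup B) (j ∷ ρ) ≟ᵥ (x ∷ w)) ≡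
                    u ρ * (e ρ * (𝟙 (fresh? j ρ) * 𝟙 (lookup B j ≟ x)))
    split j ρ = trans (cong₂ _*_ (𝟙-unique-∷ j ρ) (𝟙-≟-∷ (lookup B j) x (Vec.map (lookup B) ρ) w))
      (solve 4 (λ f u b e → f :* u :* (b :* e) := u :* (e :* (f :* b))) refl (𝟙 (fresh? j ρ)) (u ρ) (𝟙 (lookup B j ≟ x)) (e ρ))
      where open +-*-Solver

  -- For words of equal length the two multisets have the same total, so either they agree or
  -- `falling-≢` applies.
  embeddings-square : (v w : Vec (Fin k) n) → embeddings v w ≡ 𝟙 (≡-dec ℕ._≟_ (mult v) (mult w)) * factorials (mult v)
  embeddings-square v w with ≡-dec ℕ._≟_ (mult v) (mult w) | embeddings≡falling v w
  ... | yes eq | e = trans e (trans (cong (falling (mult v)) (sym eq)) (trans (falling-refl (mult v)) (sym (*-identityˡ _))))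
  ... | no neq | e = trans e (falling-≢ (mult v) (mult w) (≤-reflexive (trans (sum-mult v) (sym (sum-mult w)))) neq)

  -- Over an alphabet with a single letter every choice of positions reads the constant word, so the
  -- count of embeddings becomes a count of permutations.
  permutations-count : ∀ n → Σ[ ρ ∈ allVecs (allFin n) n ] 𝟙 (unique? ρ) ≡ n !
  permutations-count n = begin
    Σ[ ρ ∈ allVecs (allFin n) n ] 𝟙 (unique? ρ)
      ≡⟨ Σ-cong (allVecs (allFin n) n) (λ ρ → trans (sym (*-identityʳ _))
           (cong (𝟙 (unique? ρ) *_) (sym (𝟙-yes (Vec.map (lookup c) ρ ≟ᵥ c) (lookup-ext λ i → all-zero _ _))))) ⟩
    embeddings c c            ≡⟨ embeddings≡falling c c ⟩
    falling (mult c) (mult c) ≡⟨ falling-refl (mult c) ⟩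
    factorials (mult c)       ≡⟨ cong factorials (mult-zeros n) ⟩
    n ! * 1                   ≡⟨ *-identityʳ (n !) ⟩
    n !                       ∎
    where
    open ≡-Reasoning
    c : Vec (Fin 1) n
    c = replicate n zero
    all-zero : (i j : Fin 1) → i ≡ j
    all-zero zero zero = refl
    mult-zeros : ∀ n → mult {1} (replicate n zero) ≡ n ∷ []
    mult-zeros zero = refl
    mult-zeros (suc n) = cong (λ μ → raise μ zero) (mult-zeros n)

  -- Multisets of size m over k letters, split by whether the letter zero occurs; if it does, one
  -- copy is removed. The lengths therefore obey Pascal's rule.
  compositions : (k m : ℕ) → List (Vec ℕ k)
  compositions k zero = replicate k 0 ∷ []
  compositions zero (suc m) = []
  compositions (suc k) (suc m) = List.map (0 ∷_) (compositions k (suc m)) ++ List.map (λ μ → raise μ zero) (compositions (suc k) m)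

  Σ-compositions-suc : ∀ k m (f : Vec ℕ (suc k) → ℕ) →
    Σₗ (compositions (suc k) (suc m)) f ≡
    Σ[ μ ∈ compositions k (suc m) ] f (0 ∷ μ) + Σ[ μ ∈ compositions (suc k) m ] f (raise μ zero)
  Σ-compositions-suc k m f = trans (Σ-++ (List.map (0 ∷_) (compositions k (suc m))) _ f)
    (cong₂ _+_ (Σ-map (0 ∷_) (compositions k (suc m)) f) (Σ-map _ (compositions (suc k) m) f))

  ∈-compositions⁻ : ∀ k m {μ} → μ ∈ compositions k m → Vec.sum μ ≡ m
  ∈-compositions⁻ k zero (here refl) = sum-replicate-0 k
  ∈-compositions⁻ (suc k) (suc m) p with ∈-++⁻ (List.map (0 ∷_) (compositions k (suc m))) p
  ... | inj₁ q with μ , μ∈ , refl ← ∈-map⁻ (0 ∷_) q = ∈-compositions⁻ k (suc m) μ∈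
  ... | inj₂ q with μ , μ∈ , refl ← ∈-map⁻ (λ μ → raise μ zero) q = trans (sum-raise μ zero) (cong suc (∈-compositions⁻ (suc k) m μ∈))

  ∈-compositions⁺ : ∀ {m} (μ : Vec ℕ k) → Vec.sum μ ≡ m → μ ∈ compositions k m
  ∈-compositions⁺ {m = zero} [] eq = here refl
  ∈-compositions⁺ {m = zero} (zero ∷ μ) eq with here refl ← ∈-compositions⁺ {m = zero} μ eq = here refl
  ∈-compositions⁺ {m = suc m} (zero ∷ μ) eq = ∈-++⁺ˡ (∈-map⁺ (0 ∷_) (∈-compositions⁺ μ eq))
  ∈-compositions⁺ {m = suc m} (suc a ∷ μ) eq =
    ∈-++⁺ʳ (List.map (0 ∷_) (compositions _ (suc m))) (∈-map⁺ (λ μ → raise μ zero) (∈-compositions⁺ {m = m} (a ∷ μ) (ℕ.suc-injective eq)))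

  compositions-unique : ∀ k m → Unique (compositions k m)
  compositions-unique k zero = [] ∷ []
  compositions-unique zero (suc m) = []
  compositions-unique (suc k) (suc m) = Unique.++⁺
    (Unique.map⁺ ∷-injectiveʳ (compositions-unique k (suc m)))
    (Unique.map⁺ raise-injective (compositions-unique (suc k) m))
    λ (p , q) → disjoint (∈-map⁻ (0 ∷_) p) (∈-map⁻ (λ μ → raise μ zero) q)
    where
    raise-injective : ∀ {k} {μ ν : Vec ℕ (suc k)} → raise μ zero ≡ raise ν zero → μ ≡ ν
    raise-injective {μ = a ∷ μ} {b ∷ ν} refl = refl
    disjoint : ∀ {k} {v : Vec ℕ (suc k)} {xs : List (Vec ℕ k)} {ys : List (Vec ℕ (suc k))} →
      (∃ λ μ → μ ∈ xs × v ≡ 0 ∷ μ) → ¬ (∃ λ μ → μ ∈ ys × v ≡ raise μ zero)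
    disjoint (_ , _ , refl) (a ∷ μ , _ , ())

  length-compositions : ∀ k m → length (compositions (suc k) m) ≡ (k + m) C m
  length-compositions k zero = refl
  length-compositions zero (suc m) = trans (List.length-map (λ μ → raise μ zero) (compositions 1 m))
    (trans (length-compositions zero m) (trans (nCn≡1 m) (sym (nCn≡1 (suc m)))))
  length-compositions (suc k) (suc m) = begin
    length (compositions (suc (suc k)) (suc m))
      ≡⟨ List.length-++ (List.map (0 ∷_) (compositions (suc k) (suc m))) ⟩
    length (List.map (0 ∷_) (compositions (suc k) (suc m))) + length (List.map (λ μ → raise μ zero) (compositions (suc (suc k)) m))
      ≡⟨ cong₂ _+_ (List.length-map (0 ∷_) (compositions (suc k) (suc m))) (List.length-map (λ μ → raise μ zero) (compositions (suc (suc k)) m)) ⟩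
    length (compositions (suc k) (suc m)) + length (compositions (suc (suc k)) m)
      ≡⟨ cong₂ _+_ (length-compositions k (suc m)) (length-compositions (suc k) m) ⟩
    (k + suc m) C suc m + (suc k + m) C m
      ≡⟨ cong (λ x → x C suc m + (suc k + m) C m) (+-suc k m) ⟩
    (suc k + m) C suc m + (suc k + m) C m
      ≡⟨ +-comm ((suc k + m) C suc m) _ ⟩
    (suc k + m) C m + (suc k + m) C suc m
      ≡⟨ nCk+nC[k+1]≡[n+1]C[k+1] (suc k + m) m ⟩
    suc (suc k + m) C suc m
      ≡⟨ cong (_C suc m) (+-suc (suc k) m) ⟨
    (suc k + suc m) C suc m ∎
    where open ≡-Reasoning

  -- Raising the entry at x is a bijection from the multisets of size m onto those of size `suc m`
  -- that contain x; the others are annulled by the factor `lookup μ x`.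
  Σ-raise : ∀ m (x : Fin k) (f : Vec ℕ k → ℕ) →
    Σ[ μ ∈ compositions k m ] (f (raise μ x) * suc (lookup μ x)) ≡ Σ[ μ ∈ compositions k (suc m) ] (f μ * lookup μ x)
  Σ-raise {suc k} m zero f = sym (begin
    Σ[ μ ∈ compositions (suc k) (suc m) ] (f μ * lookup μ zero)
      ≡⟨ Σ-compositions-suc k m _ ⟩
    Σ[ μ ∈ compositions k (suc m) ] (f (0 ∷ μ) * 0) + Σ[ μ ∈ compositions (suc k) m ] (f (raise μ zero) * lookup (raise μ zero) zero)
      ≡⟨ cong₂ _+_ (Σ-zero (compositions k (suc m)) (λ μ _ → *-zeroʳ (f (0 ∷ μ))))
           (Σ-cong (compositions (suc k) m) λ { (a ∷ μ) → refl }) ⟩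
    Σ[ μ ∈ compositions (suc k) m ] (f (raise μ zero) * suc (lookup μ zero)) ∎)
    where open ≡-Reasoning
  Σ-raise {suc k} zero (suc y) f = begin
    f (0 ∷ raise (replicate k 0) y) * suc (lookup (replicate k 0) y) + 0
      ≡⟨ Σ-raise zero y (f ∘ (0 ∷_)) ⟩
    Σ[ μ ∈ compositions k 1 ] (f (0 ∷ μ) * lookup μ y)
      ≡⟨ +-identityʳ _ ⟨
    Σ[ μ ∈ compositions k 1 ] (f (0 ∷ μ) * lookup μ y) + 0
      ≡⟨ cong (Σ[ μ ∈ compositions k 1 ] (f (0 ∷ μ) * lookup μ y) +_)
           (Σ-zero (compositions (suc k) 0) {λ μ → f (raise μ zero) * lookup (raise μ zero) (suc y)} λ { μ (here refl) → trans (cong (f (raise μ zero) *_) (lookup-replicate y 0)) (*-zeroʳ (f (raise μ zero))) }) ⟨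
    Σ[ μ ∈ compositions k 1 ] (f (0 ∷ μ) * lookup μ y) + Σ[ μ ∈ compositions (suc k) 0 ] (f (raise μ zero) * lookup (raise μ zero) (suc y))
      ≡⟨ Σ-compositions-suc k zero _ ⟨
    Σ[ μ ∈ compositions (suc k) 1 ] (f μ * lookup μ (suc y)) ∎
    where open ≡-Reasoning
  Σ-raise {suc k} (suc m) (suc y) f = begin
    Σ[ μ ∈ compositions (suc k) (suc m) ] (f (raise μ (suc y)) * suc (lookup μ (suc y)))
      ≡⟨ Σ-compositions-suc k m _ ⟩
    Σ[ μ ∈ compositions k (suc m) ] (f (0 ∷ raise μ y) * suc (lookup μ y)) +
    Σ[ μ ∈ compositions (suc k) m ] (f (raise (raise μ zero) (suc y)) * suc (lookup (raise μ zero) (suc y)))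
      ≡⟨ cong₂ _+_ (Σ-raise (suc m) y (f ∘ (0 ∷_)))
           (trans (Σ-cong (compositions (suc k) m) λ { (a ∷ μ) → refl }) (Σ-raise m (suc y) (λ μ → f (raise μ zero)))) ⟩
    Σ[ μ ∈ compositions k (suc (suc m)) ] (f (0 ∷ μ) * lookup μ y) +
    Σ[ μ ∈ compositions (suc k) (suc m) ] (f (raise μ zero) * lookup μ (suc y))
      ≡⟨ cong (Σ[ μ ∈ compositions k (suc (suc m)) ] (f (0 ∷ μ) * lookup μ y) +_)
           (Σ-cong (compositions (suc k) (suc m)) λ { (a ∷ μ) → refl }) ⟩
    Σ[ μ ∈ compositions k (suc (suc m)) ] (f (0 ∷ μ) * lookup μ y) +
    Σ[ μ ∈ compositions (suc k) (suc m) ] (f (raise μ zero) * lookup (raise μ zero) (suc y))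
      ≡⟨ Σ-compositions-suc k (suc m) _ ⟨
    Σ[ μ ∈ compositions (suc k) (suc (suc m)) ] (f μ * lookup μ (suc y)) ∎
    where open ≡-Reasoning

  -- Every multiset of size m is the multiplicity vector of m! / ∏ μᵢ! words.
  Σ-words : ∀ m (f : Vec ℕ k → ℕ) →
    Σ[ w ∈ allVecs (allFin k) m ] (f (mult w) * factorials (mult w)) ≡ m ! * Σₗ (compositions k m) f
  Σ-words {k} zero f = cong (λ x → x + 0) (trans (cong (f (replicate k 0) *_) (factorials-0 k)) (trans (*-identityʳ _) (sym (+-identityʳ _))))
    where
    factorials-0 : ∀ k → factorials (replicate k 0) ≡ 1
    factorials-0 zero = refl
    factorials-0 (suc k) = trans (*-identityˡ _) (factorials-0 k)
  Σ-words {k} (suc m) f = begin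
    Σ[ w ∈ allVecs (allFin k) (suc m) ] (f (mult w) * factorials (mult w))
      ≡⟨ Σ-allVecs-suc (allFin k) m _ ⟩
    Σ[ x ∈ allFin k ] Σ[ w ∈ allVecs (allFin k) m ] (f (raise (mult w) x) * factorials (raise (mult w) x))
      ≡⟨ Σ-cong (allFin k) (λ x → Σ-cong (allVecs (allFin k) m) (λ w → regroup x (mult w))) ⟩
    Σ[ x ∈ allFin k ] Σ[ w ∈ allVecs (allFin k) m ] (f (raise (mult w) x) * suc (lookup (mult w) x) * factorials (mult w))
      -- The factor by which the product of factorials grows with the letter x is moved into the
      -- function to which the induction hypothesis is applied.
      ≡⟨ Σ-cong (allFin k) (λ x → trans (Σ-words m (λ μ → f (raise μ x) * suc (lookup μ x))) (cong (m ! *_) (Σ-raise m x f))) ⟩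
    Σ[ x ∈ allFin k ] (m ! * Σ[ μ ∈ compositions k (suc m) ] (f μ * lookup μ x))
      ≡⟨ Σ-*ˡ (allFin k) (m !) _ ⟩
    m ! * Σ[ x ∈ allFin k ] Σ[ μ ∈ compositions k (suc m) ] (f μ * lookup μ x)
      ≡⟨ cong (m ! *_) (Σ-swap (allFin k) (compositions k (suc m)) _) ⟩
    m ! * Σ[ μ ∈ compositions k (suc m) ] Σ[ x ∈ allFin k ] (f μ * lookup μ x)
      -- The multiplicities of μ add up to `suc m`, which is what turns m ! into (suc m) !.
      ≡⟨ cong (m ! *_) (Σ-cong-∈ (compositions k (suc m)) λ μ μ∈ → trans (Σ-*ˡ (allFin k) (f μ) _)
           (cong (f μ *_) (trans (Σ-lookup μ) (∈-compositions⁻ k (suc m) μ∈)))) ⟩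
    m ! * Σ[ μ ∈ compositions k (suc m) ] (f μ * suc m)
      ≡⟨ cong (m ! *_) (Σ-*ʳ (compositions k (suc m)) (suc m) f) ⟩
    m ! * (Σₗ (compositions k (suc m)) f * suc m)
      ≡⟨ solve 3 (λ a s b → a :* (s :* b) := b :* a :* s) refl (m !) (Σₗ (compositions k (suc m)) f) (suc m) ⟩
    suc m ! * Σₗ (compositions k (suc m)) f ∎
    where
    open ≡-Reasoning
    open +-*-Solver
    regroup : ∀ x μ → f (raise μ x) * factorials (raise μ x) ≡ f (raise μ x) * suc (lookup μ x) * factorials μ
    regroup x μ = trans (cong (f (raise μ x) *_) (factorials-raise μ x))
      (solve 3 (λ a b c → a :* (b :* c) := a :* c :* b) refl (f (raise μ x)) (factorials μ) (suc (lookup μ x)))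

  -- Rearrangements of a word into its image under a relabelling of the letters

  invariant? : (τ : Fin k → Fin k) (μ : Vec ℕ k) → Dec (∀ x → lookup μ (τ x) ≡ lookup μ x)
  invariant? τ μ = all? λ x → lookup μ (τ x) ℕ.≟ lookup μ x

  module _ (τ : Fin k → Fin k) (τ-injective : ∀ {x y} → τ x ≡ τ y → x ≡ y) where

    lookup-mult-map : (w : Vec (Fin k) n) (x : Fin k) → lookup (mult (Vec.map τ w)) (τ x) ≡ lookup (mult w) x
    lookup-mult-map w x = begin
      lookup (mult (Vec.map τ w)) (τ x)                 ≡⟨ lookup-mult (Vec.map τ w) (τ x) ⟩
      Σ[ y ∈ toList (Vec.map τ w) ] 𝟙 (y ≟ τ x)         ≡⟨ cong (λ l → Σ[ y ∈ l ] 𝟙 (y ≟ τ x)) (toList-map τ w) ⟩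
      Σ[ y ∈ List.map τ (toList w) ] 𝟙 (y ≟ τ x)    ≡⟨ Σ-map τ (toList w) _ ⟩
      Σ[ y ∈ toList w ] 𝟙 (τ y ≟ τ x)               ≡⟨ Σ-cong (toList w) (λ y → 𝟙-cong (τ y ≟ τ x) (y ≟ x) τ-injective (cong τ)) ⟩
      Σ[ y ∈ toList w ] 𝟙 (y ≟ x)                   ≡⟨ lookup-mult w x ⟨
      lookup (mult w) x                             ∎
      where open ≡-Reasoning

    mult≡mult-map⇒invariant : (w : Vec (Fin k) n) → mult w ≡ mult (Vec.map τ w) → ∀ x → lookup (mult w) (τ x) ≡ lookup (mult w) x
    mult≡mult-map⇒invariant w eq x = trans (cong (λ μ → lookup μ (τ x)) eq) (lookup-mult-map w x)

    invariant⇒mult≡mult-map : (w : Vec (Fin k) n) → (∀ x → lookup (mult w) (τ x) ≡ lookup (mult w) x) → mult w ≡ mult (Vec.map τ w)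
    invariant⇒mult≡mult-map w inv = lookup-ext λ y → let (x , y≡τx) = injective⇒surjective τ τ-injective y in
      subst (λ y → lookup (mult w) y ≡ lookup (mult (Vec.map τ w)) y) (sym y≡τx) (trans (inv x) (sym (lookup-mult-map w x)))

    -- Permuting positions by π does not change the multiset of w, so π drops out, and w has the
    -- multiset of its relabelling exactly when `mult w` is τ-invariant. The product of factorials
    -- from `embeddings-square` is the weight required by `Σ-words`.
    Σ-embeddings : (π : Vec (Fin m) m) → Unique (toList π) →
      Σ[ w ∈ allVecs (allFin k) m ] embeddings w (Vec.map τ (Vec.map (lookup w) π)) ≡
      m ! * Σ[ μ ∈ compositions k m ] 𝟙 (invariant? τ μ)
    Σ-embeddings {m} π u = trans (Σ-cong (allVecs (allFin k) m) λ w → begin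
        embeddings w (Vec.map τ (Vec.map (lookup w) π))
          ≡⟨ embeddings-square w (Vec.map τ (Vec.map (lookup w) π)) ⟩
        𝟙 (≡-dec ℕ._≟_ (mult w) (mult (Vec.map τ (Vec.map (lookup w) π)))) * factorials (mult w)
          ≡⟨ cong (_* factorials (mult w)) (𝟙-cong (≡-dec ℕ._≟_ (mult w) (mult (Vec.map τ (Vec.map (lookup w) π)))) (invariant? τ (mult w))
               (λ eq → mult≡mult-map⇒invariant w (trans eq (shift w)))
               (λ inv → trans (invariant⇒mult≡mult-map w inv) (sym (shift w)))) ⟩
        𝟙 (invariant? τ (mult w)) * factorials (mult w) ∎)
      (Σ-words m (λ μ → 𝟙 (invariant? τ μ)))
      where
      open ≡-Reasoning
      shift : (w : Vec (Fin k) m) → mult (Vec.map τ (Vec.map (lookup w) π)) ≡ mult (Vec.map τ w)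
      shift w = lookup-ext λ y → let (x , y≡τx) = injective⇒surjective τ τ-injective y in
        subst (λ y → lookup (mult (Vec.map τ (Vec.map (lookup w) π))) y ≡ lookup (mult (Vec.map τ w)) y) (sym y≡τx)
          (trans (lookup-mult-map (Vec.map (lookup w) π) x)
          (trans (cong (λ μ → lookup μ x) (mult-permute w π u)) (sym (lookup-mult-map w x))))

-- Multisets invariant under a translation of Z/n

module _ where

  open import Data.Nat using (_+_; _*_)
  open import Data.Nat.Properties hiding (_≟_)
  open import Data.Fin.Properties using (toℕ-injective; toℕ-fromℕ<; toℕ<n)

  Periodic : (ℕ → ℕ) → ℕ → Set
  Periodic f p = ∀ j → f (p + j) ≡ f j

  periodic-* : ∀ {f p} → Periodic f p → ∀ k → Periodic f (k * p)
  periodic-* per zero j = refl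
  periodic-* {f} {p} per (suc k) j = trans (cong f (+-assoc p (k * p) j)) (trans (per (k * p + j)) (periodic-* per k j))

  -- Over ℕ a Bézout identity reads g + yn = xa or g + xa = yn, hence the two cases: add a multiple
  -- of one period to the argument, and remove a multiple of the other.
  periodic-gcd : ∀ {f} a n → Periodic f a → Periodic f n → Periodic f (gcd a n)
  periodic-gcd {f} a n perₐ perₙ j with Bézout.identity (gcd-GCD a n)
  ... | Bézout.+- x y eq = begin
    f (gcd a n + j)             ≡⟨ periodic-* perₙ y (gcd a n + j) ⟨
    f (y * n + (gcd a n + j))   ≡⟨ cong f (trans (sym (+-assoc (y * n) (gcd a n) j)) (cong (_+ j) (trans (+-comm (y * n) (gcd a n)) eq))) ⟩
    f (x * a + j)               ≡⟨ periodic-* perₐ x j ⟩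
    f j                         ∎
    where open ≡-Reasoning
  ... | Bézout.-+ x y eq = begin
    f (gcd a n + j)             ≡⟨ periodic-* perₐ x (gcd a n + j) ⟨
    f (x * a + (gcd a n + j))   ≡⟨ cong f (trans (sym (+-assoc (x * a) (gcd a n) j)) (cong (_+ j) (trans (+-comm (x * a) (gcd a n)) eq))) ⟩
    f (y * n + j)               ≡⟨ periodic-* perₙ y j ⟩
    f j                         ∎
    where open ≡-Reasoning

  periodic-% : ∀ {f p} .{{_ : NonZero p}} → Periodic f p → ∀ j → f j ≡ f (j % p)
  periodic-% {f} {p} per j = trans (cong f (trans (m≡m%n+[m/n]*n j p) (+-comm (j % p) _))) (periodic-* per (j / p) (j % p))

  sumTo : (ℕ → ℕ) → ℕ → ℕ
  sumTo f n = Vec.sum (tabulate {n = n} (f ∘ toℕ))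

  sumTo-cong : ∀ {f g : ℕ → ℕ} → (∀ j → f j ≡ g j) → ∀ n → sumTo f n ≡ sumTo g n
  sumTo-cong eq n = cong (Vec.sum {n}) (tabulate-cong (eq ∘ toℕ))

  sumTo-+ : ∀ f p q → sumTo f (p + q) ≡ sumTo f p + sumTo (f ∘ (p +_)) q
  sumTo-+ f zero q = refl
  sumTo-+ f (suc p) q = trans (cong (f 0 +_) (sumTo-+ (f ∘ suc) p q)) (sym (+-assoc (f 0) _ _))

  sumTo-periodic : ∀ {f p} → Periodic f p → ∀ k → sumTo f (k * p) ≡ k * sumTo f p
  sumTo-periodic per zero = refl
  sumTo-periodic {f} {p} per (suc k) = trans (sumTo-+ f p (k * p))
    (cong (sumTo f p +_) (trans (sumTo-cong per (k * p)) (sumTo-periodic per k)))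

  modFin : ℕ → ∀ n .{{_ : NonZero n}} → Fin n
  modFin j n = fromℕ< (m%n<n j n)

  toℕ-modFin : ∀ j n .{{_ : NonZero n}} → toℕ (modFin j n) ≡ j % n
  toℕ-modFin j n = toℕ-fromℕ< (m%n<n j n)

  -- A function on Z/n is carried to ℕ as an n-periodic function, on which translation is plain
  -- addition and periods can be combined.
  periodicExtension : ∀ {n} .{{_ : NonZero n}} → Vec ℕ n → ℕ → ℕ
  periodicExtension {n} ν j = lookup ν (modFin j n)

  periodicExtension-cong : ∀ {n} .{{_ : NonZero n}} (ν : Vec ℕ n) {i j} → i % n ≡ j % n → periodicExtension ν i ≡ periodicExtension ν j
  periodicExtension-cong {n} ν {i} {j} eq = cong (lookup ν) (toℕ-injective (trans (toℕ-modFin i n) (trans eq (sym (toℕ-modFin j n)))))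

  periodicExtension-toℕ : ∀ {n} .{{_ : NonZero n}} (ν : Vec ℕ n) i → periodicExtension ν (toℕ i) ≡ lookup ν i
  periodicExtension-toℕ {n} ν i = cong (lookup ν) (toℕ-injective (trans (toℕ-modFin (toℕ i) n) (m<n⇒m%n≡m (toℕ<n i))))

  periodicExtension-periodic : ∀ {n p} .{{_ : NonZero n}} → n ∣ p → (ν : Vec ℕ n) → Periodic (periodicExtension ν) p
  periodicExtension-periodic n∣p ν j = periodicExtension-cong ν (%-remove-+ˡ j n∣p)

  sum-periodicExtension : ∀ {n} .{{_ : NonZero n}} (ν : Vec ℕ n) → Vec.sum ν ≡ sumTo (periodicExtension ν) n
  sum-periodicExtension ν = cong Vec.sum (trans (sym (tabulate∘lookup ν)) (tabulate-cong (λ i → sym (periodicExtension-toℕ ν i))))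

  -- The letter zero stands for the field element 0, which scaling fixes; `suc i` stands for the
  -- i-th power of a generator.
  shift : ∀ (n a : ℕ) .{{_ : NonZero n}} → Fin (suc n) → Fin (suc n)
  shift n a zero = zero
  shift n a (suc i) = suc (modFin (a + toℕ i) n)

  -- A vector on Z/n is invariant under translation by a iff it is e-periodic for
  -- e = gcd a n; it is then d = n/e copies of its first e entries, so its total is
  -- d times theirs.  The entry at 0 absorbs the remainder m % d.
  module _ (n a d : ℕ) {{_ : NonZero n}} {{_ : NonZero d}} (n≡d*gcd : n ≡ d * gcd a n) (m : ℕ) where

    private
      e : ℕ
      e = gcd a n

      instance
        e≢0 : NonZero e
        e≢0 = ℕ.≢-nonZero λ e≡0 → ℕ.≢-nonZero⁻¹ n (trans n≡d*gcd (trans (cong (d *_) e≡0) (*-zeroʳ d)))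

      spread : Vec ℕ e → Vec ℕ n
      spread κ = tabulate (periodicExtension κ ∘ toℕ)

      restrict : Vec ℕ n → Vec ℕ e
      restrict ν = tabulate (periodicExtension ν ∘ toℕ)

      extension-spread : ∀ κ j → periodicExtension (spread κ) j ≡ periodicExtension κ j
      extension-spread κ j = trans (lookup∘tabulate (periodicExtension κ ∘ toℕ) (modFin j n))
        (periodicExtension-cong κ (trans (cong (_% e) (toℕ-modFin j n)) (m∣n⇒o%n%m≡o%m e n j (gcd[m,n]∣n a n))))

      spread-injective : ∀ {κ κ′} → spread κ ≡ spread κ′ → κ ≡ κ′
      spread-injective {κ} {κ′} eq = lookup-ext λ i → begin
        lookup κ i                              ≡⟨ periodicExtension-toℕ κ i ⟨
        periodicExtension κ (toℕ i)             ≡⟨ extension-spread κ (toℕ i) ⟨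
        periodicExtension (spread κ) (toℕ i)    ≡⟨ cong (λ ν → periodicExtension ν (toℕ i)) eq ⟩
        periodicExtension (spread κ′) (toℕ i)   ≡⟨ extension-spread κ′ (toℕ i) ⟩
        periodicExtension κ′ (toℕ i)            ≡⟨ periodicExtension-toℕ κ′ i ⟩
        lookup κ′ i                             ∎
        where open ≡-Reasoning

      sum-spread : ∀ κ → Vec.sum (spread κ) ≡ d * Vec.sum κ
      sum-spread κ = begin
        sumTo (periodicExtension κ) n         ≡⟨ cong (sumTo (periodicExtension κ)) n≡d*gcd ⟩
        sumTo (periodicExtension κ) (d * e)   ≡⟨ sumTo-periodic {periodicExtension κ} {e} (periodicExtension-periodic (divides 1 (sym (*-identityˡ e))) κ) d ⟩
        d * sumTo (periodicExtension κ) e     ≡⟨ cong (d *_) (sum-periodicExtension κ) ⟨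
        d * Vec.sum κ                         ∎
        where open ≡-Reasoning

      -- The orbits of the translation are the e residue classes modulo e, each with d elements. The
      -- entries of κ count orbits, and s counts blocks of d copies of the letter zero beyond the
      -- remainder.
      fill : Vec ℕ (suc e) → Vec ℕ (suc n)
      fill (s ∷ κ) = m % d + d * s ∷ spread κ

      fill-injective : ∀ {v w} → fill v ≡ fill w → v ≡ w
      fill-injective {s ∷ κ} {t ∷ κ′} eq = cong₂ _∷_
        (*-cancelˡ-≡ s t d (+-cancelˡ-≡ (m % d) _ _ (cong Vec.head eq)))
        (spread-injective (cong Vec.tail eq))

      sum-fill : ∀ v → Vec.sum (fill v) ≡ m % d + d * Vec.sum v
      sum-fill (s ∷ κ) = trans (cong (m % d + d * s +_) (sum-spread κ))
        (solve 4 (λ r d s t → r :+ d :* s :+ d :* t := r :+ d :* (s :+ t)) refl (m % d) d s (Vec.sum κ))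
        where open +-*-Solver

      Invariant : Vec ℕ (suc n) → Set
      Invariant μ = ∀ x → lookup μ (shift n a x) ≡ lookup μ x

      fill-invariant : ∀ v → Invariant (fill v)
      fill-invariant (s ∷ κ) zero = refl
      fill-invariant (s ∷ κ) (suc i) = begin
        periodicExtension (spread κ) (a + toℕ i)   ≡⟨ extension-spread κ (a + toℕ i) ⟩
        periodicExtension κ (a + toℕ i)            ≡⟨ periodicExtension-periodic (gcd[m,n]∣m a n) κ (toℕ i) ⟩
        periodicExtension κ (toℕ i)                ≡⟨ extension-spread κ (toℕ i) ⟨
        periodicExtension (spread κ) (toℕ i)       ≡⟨ periodicExtension-toℕ (spread κ) i ⟩
        lookup (spread κ) i                        ∎
        where open ≡-Reasoning

      invariant⇒spread-restrict : ∀ c ν → Invariant (c ∷ ν) → ν ≡ spread (restrict ν)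
      invariant⇒spread-restrict c ν inv = lookup-ext λ i → begin
        lookup ν i                                        ≡⟨ periodicExtension-toℕ ν i ⟨
        periodicExtension ν (toℕ i)                       ≡⟨ periodic-% {periodicExtension ν} {e} perₑ (toℕ i) ⟩
        periodicExtension ν (toℕ i % e)                   ≡⟨ cong (periodicExtension ν) (toℕ-modFin (toℕ i) e) ⟨
        periodicExtension ν (toℕ (modFin (toℕ i) e))      ≡⟨ lookup∘tabulate (periodicExtension ν ∘ toℕ) (modFin (toℕ i) e) ⟨
        periodicExtension (restrict ν) (toℕ i)            ≡⟨ lookup∘tabulate (periodicExtension (restrict ν) ∘ toℕ) i ⟨
        lookup (spread (restrict ν)) i                    ∎
        where
        open ≡-Reasoning
        perₐ : Periodic (periodicExtension ν) a
        perₐ j = begin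
          periodicExtension ν (a + j)                     ≡⟨ periodicExtension-cong ν (trans (%-distribˡ-+ a j n) (trans (cong (λ x → (a % n + x) % n) (sym (m%n%n≡m%n j n))) (sym (%-distribˡ-+ a (j % n) n)))) ⟩
          periodicExtension ν (a + j % n)                 ≡⟨ cong (λ x → periodicExtension ν (a + x)) (toℕ-modFin j n) ⟨
          periodicExtension ν (a + toℕ (modFin j n))      ≡⟨ inv (suc (modFin j n)) ⟩
          periodicExtension ν j                           ∎
        perₑ : Periodic (periodicExtension ν) e
        perₑ = periodic-gcd a n perₐ (periodicExtension-periodic (divides 1 (sym (*-identityˡ n))) ν)

      into : ∀ {v} → v ∈ compositions (suc e) (m / d) → fill v ∈ filter (invariant? (shift n a)) (compositions (suc n) m)
      into {v} v∈ = ∈-filter⁺ (invariant? (shift n a))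
        (∈-compositions⁺ (fill v) (begin
          Vec.sum (fill v)           ≡⟨ sum-fill v ⟩
          m % d + d * Vec.sum v      ≡⟨ cong (λ x → m % d + d * x) (∈-compositions⁻ (suc e) (m / d) v∈) ⟩
          m % d + d * (m / d)        ≡⟨ cong (m % d +_) (*-comm d (m / d)) ⟩
          m % d + (m / d) * d        ≡⟨ m≡m%n+[m/n]*n m d ⟨
          m                          ∎))
        (fill-invariant v)
        where open ≡-Reasoning

      onto : ∀ {μ} → μ ∈ filter (invariant? (shift n a)) (compositions (suc n) m) → ∃ λ v → v ∈ compositions (suc e) (m / d) × μ ≡ fill v
      onto {c ∷ ν} p with c∷ν∈ , inv ← ∈-filter⁻ (invariant? (shift n a)) {xs = compositions (suc n) m} p =
        -- The entries other than c sum to a multiple of d, so c and m leave the same remainder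
        -- modulo d, and c splits into m % d and c / d blocks.
        c / d ∷ restrict ν , ∈-compositions⁺ (c / d ∷ restrict ν) (sym quot) , cong₂ _∷_ head (invariant⇒spread-restrict c ν inv)
        where
        open ≡-Reasoning
        total : m ≡ c + Vec.sum (restrict ν) * d
        total = begin
          m                                        ≡⟨ ∈-compositions⁻ (suc n) m c∷ν∈ ⟨
          c + Vec.sum ν                            ≡⟨ cong (λ ν → c + Vec.sum ν) (invariant⇒spread-restrict c ν inv) ⟩
          c + Vec.sum (spread (restrict ν))        ≡⟨ cong (c +_) (trans (sum-spread (restrict ν)) (*-comm d _)) ⟩
          c + Vec.sum (restrict ν) * d             ∎
        quot : m / d ≡ c / d + Vec.sum (restrict ν)
        quot = begin
          m / d                                    ≡⟨ /-congˡ {o = d} total ⟩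
          (c + Vec.sum (restrict ν) * d) / d       ≡⟨ +-distrib-/-∣ʳ c {d = d} (divides (Vec.sum (restrict ν)) refl) ⟩
          c / d + Vec.sum (restrict ν) * d / d     ≡⟨ cong (c / d +_) (m*n/n≡m (Vec.sum (restrict ν)) d) ⟩
          c / d + Vec.sum (restrict ν)             ∎
        head : c ≡ m % d + d * (c / d)
        head = begin
          c                                        ≡⟨ m≡m%n+[m/n]*n c d ⟩
          c % d + (c / d) * d                      ≡⟨ cong₂ _+_ (sym (trans (%-congˡ {o = d} total) ([m+kn]%n≡m%n c (Vec.sum (restrict ν)) d))) (*-comm (c / d) d) ⟩
          m % d + d * (c / d)                      ∎

    -- Stars and bars for m / d blocks distributed over e orbits and the letter zero. As n = e d,
    -- the number e can be drawn into the floor of m / d, which gives the upper index of the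
    -- binomial.
    shift-invariant-count : Σ[ μ ∈ compositions (suc n) m ] 𝟙 (invariant? (shift n a) μ) ≡ ((n + m) / d) C (m / d)
    shift-invariant-count = begin
      Σ[ μ ∈ compositions (suc n) m ] 𝟙 (invariant? (shift n a) μ)
        ≡⟨ length-filter (invariant? (shift n a)) (compositions (suc n) m) ⟨
      length (filter (invariant? (shift n a)) (compositions (suc n) m))
        ≡⟨ length-bij fill fill-injective (compositions-unique (suc e) (m / d))
             (Unique.filter⁺ (invariant? (shift n a)) (compositions-unique (suc n) m)) into onto ⟨
      length (compositions (suc e) (m / d))
        ≡⟨ length-compositions e (m / d) ⟩
      (e + m / d) C (m / d)
        ≡⟨ cong (λ x → (x + m / d) C (m / d)) (m*n/n≡m e d) ⟨
      (e * d / d + m / d) C (m / d)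
        ≡⟨ cong (_C (m / d)) (+-distrib-/-∣ˡ m {d} (divides e refl)) ⟨
      ((e * d + m) / d) C (m / d)
        ≡⟨ cong (λ x → ((x + m) / d) C (m / d)) (trans (*-comm e d) (sym n≡d*gcd)) ⟩
      ((n + m) / d) C (m / d) ∎
      where open ≡-Reasoning

-- Linear algebra over the field

module Linear (F : FiniteField) where
  open Units F
  open FiniteField F using (Carrier; 0#; 1#; 0≢1; inverse; elements; complete; unique; size)
    renaming (_≟_ to infix 4 _≟_)
  open LinAlg F
  open import Algebra.Properties.Ring ring using (-0#≈0#; -1*x≈-x; -‿injective; -‿involutive)
  open import Algebra.Properties.Semiring.Sum semiring using (sum; ∑-distrib-+; *-distribˡ-sum; ∑-comm; sum-cong-≗)
  open ≡-Reasoning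

  ∑≡sum : ∀ {n} (f : Fin n → Carrier) → ∑ f ≡ sum f
  ∑≡sum {zero} f = refl
  ∑≡sum {suc n} f = cong (f zero +_) (∑≡sum (f ∘ suc))

  ∑-cong : ∀ {n} {f g : Fin n → Carrier} → (∀ i → f i ≡ g i) → ∑ f ≡ ∑ g
  ∑-cong {f = f} {g} eq = trans (∑≡sum f) (trans (sum-cong-≗ eq) (sym (∑≡sum g)))

  ∑-+ : ∀ {n} (f g : Fin n → Carrier) → ∑ (λ i → f i + g i) ≡ ∑ f + ∑ g
  ∑-+ f g = trans (∑≡sum (λ i → f i + g i)) (trans (∑-distrib-+ f g) (sym (cong₂ _+_ (∑≡sum f) (∑≡sum g))))

  ∑-*ˡ : ∀ {n} x (f : Fin n → Carrier) → ∑ (λ i → x * f i) ≡ x * ∑ f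
  ∑-*ˡ x f = trans (∑≡sum (λ i → x * f i)) (trans (sym (*-distribˡ-sum x f)) (cong (x *_) (sym (∑≡sum f))))

  ∑-swap : ∀ {m n} (f : Fin m → Fin n → Carrier) → ∑ (λ i → ∑ (f i)) ≡ ∑ (λ j → ∑ (λ i → f i j))
  ∑-swap f = trans (∑-cong (λ i → ∑≡sum (f i))) (trans (∑≡sum (λ i → sum (f i))) (trans (∑-comm f)
    (sym (trans (∑-cong (λ j → ∑≡sum (λ i → f i j))) (∑≡sum (λ j → sum (λ i → f i j)))))))

  ∑-zero : ∀ {n} {f : Fin n → Carrier} → (∀ i → f i ≡ 0#) → ∑ f ≡ 0#
  ∑-zero {zero} eq = refl
  ∑-zero {suc n} eq = trans (cong₂ _+_ (eq zero) (∑-zero (eq ∘ suc))) (+-identityˡ 0#)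

  δ : ∀ {n} → Fin n → Fin n → Carrier
  δ i j = if does (i Fin.≟ j) then 1# else 0#

  ∑-δ : ∀ {n} (i : Fin n) (f : Fin n → Carrier) → ∑ (λ j → δ i j * f j) ≡ f i
  ∑-δ zero f = trans (cong₂ _+_ (*-identityˡ (f zero)) (∑-zero (λ j → zeroˡ (f (suc j))))) (+-identityʳ (f zero))
  ∑-δ (suc i) f = trans (cong₂ _+_ (zeroˡ (f zero)) (∑-δ i (f ∘ suc))) (+-identityˡ _)

  ∑-permute : ∀ {n} (s : Vec (Fin n) n) → Unique (toList s) → (f : Fin n → Carrier) → ∑ (f ∘ lookup s) ≡ ∑ f
  ∑-permute s u f = trans (toListSum s) (trans
    (foldr-commMonoid (setoid Carrier) (CommutativeRing.+-isCommutativeMonoid commutativeRing) (↭⇒↭ₛ (↭-map⁺ f (permutation-↭ s u))))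
    (sym (allFinSum f)))
    where
    toListSum : ∀ {k} (s : Vec (Fin _) k) → ∑ (f ∘ lookup s) ≡ foldr _+_ 0# (map f (toList s))
    toListSum [] = refl
    toListSum (i ∷ s) = cong (f i +_) (toListSum s)
    allFinSum : ∀ {n} (f : Fin n → Carrier) → ∑ f ≡ foldr _+_ 0# (map f (allFin n))
    allFinSum {zero} f = refl
    allFinSum {suc n} f = cong (f zero +_) (trans (allFinSum (f ∘ suc))
      (cong (foldr _+_ 0#) (trans (List.map-∘ (allFin n)) (cong (map f) (List.map-tabulate (λ i → i) suc)))))

  0⃗ : ∀ {m} → Vec Carrier m
  0⃗ = replicate _ 0#

  _⊞_ : ∀ {m} → Vec Carrier m → Vec Carrier m → Vec Carrier m
  _⊞_ = zipWith _+_

  _∙_ : ∀ {m} → Carrier → Vec Carrier m → Vec Carrier m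
  c ∙ v = Vec.map (c *_) v

  infixl 6 _⊞_
  infixl 7 _∙_

  basis : ∀ {m} → Fin m → Vec Carrier m
  basis i = tabulate (δ i)

  lookup-⊞ : ∀ {m} (u v : Vec Carrier m) i → lookup (u ⊞ v) i ≡ lookup u i + lookup v i
  lookup-⊞ u v i = lookup-zipWith _+_ i u v

  lookup-∙ : ∀ {m} c (v : Vec Carrier m) i → lookup (c ∙ v) i ≡ c * lookup v i
  lookup-∙ c v i = lookup-map i (c *_) v

  _≟⃗_ : ∀ {m} (u v : Vec Carrier m) → Dec (u ≡ v)
  _≟⃗_ = ≡-dec _≟_

  infix 4 _≟⃗_

  vectors : ∀ m → List (Vec Carrier m)
  vectors m = allVecs elements m

  vectors-unique : ∀ m → Unique (vectors m)
  vectors-unique m = allVecs-unique unique m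

  ∈-vectors : ∀ {m} (v : Vec Carrier m) → v ∈ vectors m
  ∈-vectors {m} = allVecs-complete elements complete m

  dot : ∀ {m} → Vec Carrier m → Vec Carrier m → Carrier
  dot u v = ∑ λ j → lookup u j * lookup v j

  dot-⊞ : ∀ {m} (u u′ v : Vec Carrier m) → dot (u ⊞ u′) v ≡ dot u v + dot u′ v
  dot-⊞ u u′ v = trans (∑-cong (λ j → trans (cong (_* lookup v j) (lookup-⊞ u u′ j)) (distribʳ (lookup v j) _ _)))
    (∑-+ (λ j → lookup u j * lookup v j) (λ j → lookup u′ j * lookup v j))

  dot-∙ : ∀ {m} c (u v : Vec Carrier m) → dot (c ∙ u) v ≡ c * dot u v
  dot-∙ c u v = trans (∑-cong (λ j → trans (cong (_* lookup v j) (lookup-∙ c u j)) (*-assoc c _ _)))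
    (∑-*ˡ c (λ j → lookup u j * lookup v j))

  dot-∙ʳ : ∀ {m} c (u v : Vec Carrier m) → dot u (c ∙ v) ≡ c * dot u v
  dot-∙ʳ c u v = trans (∑-cong λ j → trans (cong (lookup u j *_) (lookup-∙ c v j))
      (solve 3 (λ u c v → u :* (c :* v) := c :* (u :* v)) refl (lookup u j) c (lookup v j)))
    (∑-*ˡ c (λ j → lookup u j * lookup v j))

  dot-basis : ∀ {m} (i : Fin m) v → dot (basis i) v ≡ lookup v i
  dot-basis i v = trans (∑-cong (λ j → cong (_* lookup v j) (lookup∘tabulate (δ i) j))) (∑-δ i (lookup v))

  dot-0⃗ : ∀ {m} (v : Vec Carrier m) → dot 0⃗ v ≡ 0#
  dot-0⃗ v = ∑-zero (λ j → trans (cong (_* lookup v j) (lookup-replicate j 0#)) (zeroˡ _))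

  comb : ∀ {k m} → Vec Carrier k → Vec (Vec Carrier m) k → Vec Carrier m
  comb [] [] = 0⃗
  comb (c ∷ cs) (u ∷ U) = c ∙ u ⊞ comb cs U

  lookup-comb : ∀ {k m} (c : Vec Carrier k) (U : Vec (Vec Carrier m) k) j →
    lookup (comb c U) j ≡ ∑ λ i → lookup c i * lookup (lookup U i) j
  lookup-comb [] [] j = lookup-replicate j 0#
  lookup-comb (c ∷ cs) (u ∷ U) j = trans (lookup-⊞ (c ∙ u) (comb cs U) j) (cong₂ _+_ (lookup-∙ c u j) (lookup-comb cs U j))

  linIndep⇒ : ∀ {k m} {U : Vec (Vec Carrier m) k} → LinIndep U → ∀ {c} → comb c U ≡ 0⃗ → c ≡ 0⃗
  linIndep⇒ {U = U} li {c} eq = lookup-ext λ i → trans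
    (li c (λ j → trans (sym (lookup-comb c U j)) (trans (cong (λ v → lookup v j) eq) (lookup-replicate j 0#))) i)
    (sym (lookup-replicate i 0#))

  ⇒linIndep : ∀ {k m} {U : Vec (Vec Carrier m) k} → (∀ {c} → comb c U ≡ 0⃗ → c ≡ 0⃗) → LinIndep U
  ⇒linIndep {U = U} h c eq i = trans
    (cong (λ v → lookup v i) (h {c} (lookup-ext λ j → trans (lookup-comb c U j) (trans (eq j) (sym (lookup-replicate j 0#))))))
    (lookup-replicate i 0#)

  ⊞-identityˡ : ∀ {m} (v : Vec Carrier m) → 0⃗ ⊞ v ≡ v
  ⊞-identityˡ [] = refl
  ⊞-identityˡ (x ∷ v) = cong₂ _∷_ (+-identityˡ x) (⊞-identityˡ v)

  0∙ : ∀ {m} (v : Vec Carrier m) → 0# ∙ v ≡ 0⃗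
  0∙ [] = refl
  0∙ (x ∷ v) = cong₂ _∷_ (zeroˡ x) (0∙ v)

  ∙0⃗ : ∀ {m} c → c ∙ 0⃗ {m} ≡ 0⃗
  ∙0⃗ {zero} c = refl
  ∙0⃗ {suc m} c = cong₂ _∷_ (zeroʳ c) (∙0⃗ c)

  1∙ : ∀ {m} (v : Vec Carrier m) → 1# ∙ v ≡ v
  1∙ [] = refl
  1∙ (x ∷ v) = cong₂ _∷_ (*-identityˡ x) (1∙ v)

  ∙-assoc : ∀ {m} a b (v : Vec Carrier m) → a ∙ (b ∙ v) ≡ (a * b) ∙ v
  ∙-assoc a b [] = refl
  ∙-assoc a b (x ∷ v) = cong₂ _∷_ (sym (*-assoc a b x)) (∙-assoc a b v)

  ∙-distrib-⊞ : ∀ {m} a (u v : Vec Carrier m) → a ∙ (u ⊞ v) ≡ a ∙ u ⊞ a ∙ v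
  ∙-distrib-⊞ a [] [] = refl
  ∙-distrib-⊞ a (x ∷ u) (y ∷ v) = cong₂ _∷_ (distribˡ a x y) (∙-distrib-⊞ a u v)

  -1∙-inverse : ∀ {m} (v : Vec Carrier m) → (- 1#) ∙ v ⊞ v ≡ 0⃗
  -1∙-inverse [] = refl
  -1∙-inverse (x ∷ v) = cong₂ _∷_ (trans (cong (_+ x) (-1*x≈-x x)) (-‿inverseˡ x)) (-1∙-inverse v)

  ⊞-inverse⇒≡ : ∀ {m} (u v : Vec Carrier m) → (- 1#) ∙ u ⊞ v ≡ 0⃗ → v ≡ u
  ⊞-inverse⇒≡ [] [] _ = refl
  ⊞-inverse⇒≡ (x ∷ u) (y ∷ v) eq = cong₂ _∷_
    (x∙y⁻¹≈ε⇒x≈y y x (trans (+-comm y (- x)) (trans (cong (_+ y) (sym (-1*x≈-x x))) (cong Vec.head eq))))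
    (⊞-inverse⇒≡ u v (cong Vec.tail eq))

  comb-⊞ : ∀ {k m} (c d : Vec Carrier k) (U : Vec (Vec Carrier m) k) → comb (c ⊞ d) U ≡ comb c U ⊞ comb d U
  comb-⊞ c d U = lookup-ext λ j → begin
    lookup (comb (c ⊞ d) U) j
      ≡⟨ lookup-comb (c ⊞ d) U j ⟩
    ∑ (λ i → lookup (c ⊞ d) i * lookup (lookup U i) j)
      ≡⟨ ∑-cong (λ i → trans (cong (_* lookup (lookup U i) j) (lookup-⊞ c d i)) (distribʳ _ _ _)) ⟩
    ∑ (λ i → lookup c i * lookup (lookup U i) j + lookup d i * lookup (lookup U i) j)
      ≡⟨ ∑-+ (λ i → lookup c i * lookup (lookup U i) j) (λ i → lookup d i * lookup (lookup U i) j) ⟩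
    ∑ (λ i → lookup c i * lookup (lookup U i) j) + ∑ (λ i → lookup d i * lookup (lookup U i) j)
      ≡⟨ cong₂ _+_ (lookup-comb c U j) (lookup-comb d U j) ⟨
    lookup (comb c U) j + lookup (comb d U) j
      ≡⟨ lookup-⊞ (comb c U) (comb d U) j ⟨
    lookup (comb c U ⊞ comb d U) j ∎

  comb-∙ : ∀ {k m} a (c : Vec Carrier k) (U : Vec (Vec Carrier m) k) → comb (a ∙ c) U ≡ a ∙ comb c U
  comb-∙ a [] [] = sym (∙0⃗ a)
  comb-∙ a (c ∷ cs) (u ∷ U) = trans (cong₂ _⊞_ (sym (∙-assoc a c u)) (comb-∙ a cs U)) (sym (∙-distrib-⊞ a (c ∙ u) (comb cs U)))

  comb-basis : ∀ {k m} (i : Fin k) (U : Vec (Vec Carrier m) k) → comb (basis i) U ≡ lookup U i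
  comb-basis i U = lookup-ext λ j → trans (lookup-comb (basis i) U j)
    (trans (∑-cong (λ i′ → cong (_* lookup (lookup U i′) j) (lookup∘tabulate (δ i) i′))) (∑-δ i (λ i′ → lookup (lookup U i′) j)))

  comb-injective : ∀ {k m} {U : Vec (Vec Carrier m) k} → LinIndep U → ∀ {c d} → comb c U ≡ comb d U → c ≡ d
  comb-injective {U = U} li {c} {d} eq = ⊞-inverse⇒≡ d c (linIndep⇒ {U = U} li (begin
    comb ((- 1#) ∙ d ⊞ c) U                ≡⟨ comb-⊞ ((- 1#) ∙ d) c U ⟩
    comb ((- 1#) ∙ d) U ⊞ comb c U         ≡⟨ cong₂ _⊞_ (comb-∙ (- 1#) d U) eq ⟩
    (- 1#) ∙ comb d U ⊞ comb d U           ≡⟨ -1∙-inverse (comb d U) ⟩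
    0⃗                                      ∎))

  δ-injective : ∀ {k} (i j : Fin k) → basis i ≡ basis j → i ≡ j
  δ-injective i j eq with i Fin.≟ j
  ... | yes i≡j = i≡j
  ... | no i≢j = contradiction (begin
    0#                   ≡⟨ off i≢j ⟨
    δ i j                ≡⟨ lookup∘tabulate (δ i) j ⟨
    lookup (basis i) j   ≡⟨ cong (λ v → lookup v j) eq ⟩
    lookup (basis j) j   ≡⟨ lookup∘tabulate (δ j) j ⟩
    δ j j                ≡⟨ diag j ⟩
    1#                   ∎) 0≢1
    where
    off : ∀ {k} {i j : Fin k} → i ≢ j → δ i j ≡ 0#
    off {i = i} {j} i≢j with i Fin.≟ j
    ... | yes i≡j = contradiction i≡j i≢j
    ... | no _ = refl
    diag : ∀ {k} (j : Fin k) → δ j j ≡ 1#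
    diag j with j Fin.≟ j
    ... | yes _ = refl
    ... | no j≢j = contradiction refl j≢j

  linIndep⇒rows-distinct : ∀ {k m} {U : Vec (Vec Carrier m) k} → LinIndep U → ∀ {i j} → lookup U i ≡ lookup U j → i ≡ j
  linIndep⇒rows-distinct {U = U} li {i} {j} eq = δ-injective i j
    (comb-injective {U = U} li (trans (comb-basis i U) (trans eq (sym (comb-basis j U)))))

  span : ∀ {k m} → Vec (Vec Carrier m) k → List (Vec Carrier m)
  span {k} U = map (λ c → comb c U) (vectors k)

  ∈-span : ∀ {k m} (U : Vec (Vec Carrier m) k) c → comb c U ∈ span U
  ∈-span U c = ∈-map⁺ (λ c → comb c U) (∈-vectors c)

  ∉span? : ∀ {k m} (u : Vec Carrier m) (U : Vec (Vec Carrier m) k) → Dec (u ∉ span U)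
  ∉span? u U = ¬? (DecMembership._∈?_ _≟⃗_ u (span U))

  -- If u is the combination of U with coefficients c, then `- 1#` and c are the coefficients of a
  -- relation. A relation within U extends by the coefficient 0.
  linIndep-∷⁻ : ∀ {k m} (u : Vec Carrier m) (U : Vec (Vec Carrier m) k) → LinIndep (u ∷ U) → u ∉ span U × LinIndep U
  linIndep-∷⁻ u U li =
    (λ u∈ → let (c , _ , u≡) = ∈-map⁻ (λ c → comb c U) u∈ in
      contradiction
        (trans (sym -0#≈0#) (sym (-‿injective (trans (cong Vec.head (linIndep⇒ {U = u ∷ U} li {(- 1#) ∷ c}
          (trans (cong ((- 1#) ∙ u ⊞_) (sym u≡)) (-1∙-inverse u)))) (trans (sym -0#≈0#) (cong -_ (sym -0#≈0#))))))) 0≢1) ,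
    ⇒linIndep {U = U} λ {c} eq → cong Vec.tail (linIndep⇒ {U = u ∷ U} li {0# ∷ c}
      (trans (cong₂ _⊞_ (0∙ u) eq) (⊞-identityˡ 0⃗)))

  linIndep-∷⁺ : ∀ {k m} (u : Vec Carrier m) (U : Vec (Vec Carrier m) k) → u ∉ span U → LinIndep U → LinIndep (u ∷ U)
  linIndep-∷⁺ u U u∉ li = ⇒linIndep {U = u ∷ U} λ { {a ∷ c} eq → go a c eq }
    where
    go : ∀ a c → a ∙ u ⊞ comb c U ≡ 0⃗ → a ∷ c ≡ 0⃗
    go a c eq with a ≟ 0#
    ... | yes refl = cong (0# ∷_) (linIndep⇒ {U = U} li (trans (sym (⊞-identityˡ (comb c U))) (trans (cong (_⊞ comb c U) (sym (0∙ u))) eq)))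
    -- Dividing the relation by a solves it for u, as -b times `comb c U`.
    ... | no a≢0 with b , ab≡1 ← inverse a a≢0 = contradiction (subst (_∈ span U) u≡ (∈-span U ((- 1#) ∙ (b ∙ c)))) u∉
      where
      u≡ : comb ((- 1#) ∙ (b ∙ c)) U ≡ u
      u≡ = begin
        comb ((- 1#) ∙ (b ∙ c)) U   ≡⟨ trans (comb-∙ (- 1#) (b ∙ c) U) (cong ((- 1#) ∙_) (comb-∙ b c U)) ⟩
        (- 1#) ∙ (b ∙ comb c U)     ≡⟨ ⊞-inverse⇒≡ _ u (begin
            (- 1#) ∙ ((- 1#) ∙ (b ∙ comb c U)) ⊞ u
              ≡⟨ cong₂ _⊞_ (trans (∙-assoc (- 1#) (- 1#) _) (trans (cong (_∙ (b ∙ comb c U)) (trans (-1*x≈-x (- 1#)) (-‿involutive 1#))) (1∙ _))) (trans (sym (1∙ u)) (cong (_∙ u) (trans (sym ab≡1) (*-comm a b)))) ⟩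
            b ∙ comb c U ⊞ (b * a) ∙ u
              ≡⟨ cong (b ∙ comb c U ⊞_) (sym (∙-assoc b a u)) ⟩
            b ∙ comb c U ⊞ b ∙ (a ∙ u)
              ≡⟨ sym (∙-distrib-⊞ b (comb c U) (a ∙ u)) ⟩
            b ∙ (comb c U ⊞ a ∙ u)
              ≡⟨ cong (b ∙_) (trans (⊞-comm (comb c U) (a ∙ u)) eq) ⟩
            b ∙ 0⃗
              ≡⟨ ∙0⃗ b ⟩
            0⃗ ∎) ⟨
        u ∎
        where
        ⊞-comm : ∀ {m} (u v : Vec Carrier m) → u ⊞ v ≡ v ⊞ u
        ⊞-comm [] [] = refl
        ⊞-comm (x ∷ u) (y ∷ v) = cong₂ _∷_ (+-comm x y) (⊞-comm u v)

  𝟙-linIndep-∷ : ∀ {k m} (u : Vec Carrier m) (U : Vec (Vec Carrier m) k) →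
    𝟙 (linIndep? (u ∷ U)) ≡ 𝟙 (linIndep? U) ℕ.* 𝟙 (∉span? u U)
  𝟙-linIndep-∷ u U = trans
    (𝟙-cong (linIndep? (u ∷ U)) (linIndep? U ×-dec ∉span? u U)
      (λ li → let (p , q) = linIndep-∷⁻ u U li in q , p) (λ (q , p) → linIndep-∷⁺ u U p q))
    (𝟙-× (linIndep? U) (∉span? u U))

  -- Linearly independent tuples in a subspace

  record IsSubspace {m} (V : Vec Carrier m → Set) : Set where
    field
      zero-closed : V 0⃗
      ⊞-closed : ∀ {u v} → V u → V v → V (u ⊞ v)
      ∙-closed : ∀ c {u} → V u → V (c ∙ u)

  -- The product of s - q^i for i < k, the number of independent k-tuples in a subspace with s
  -- elements. The argument is the cardinality, so neither a basis nor a dimension of the subspace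
  -- is called for.
  frames : ℕ → ℕ → ℕ
  frames s zero = 1
  frames s (suc k) = frames s k ℕ.* (s ∸ size ℕ.^ k)

  module _ {m} {V : Vec Carrier m → Set} (V? : Decidable V) (sub : IsSubspace V) where
    open IsSubspace sub

    subspaceVectors : List (Vec Carrier m)
    subspaceVectors = filter V? (vectors m)

    subspaceVectors-unique : Unique subspaceVectors
    subspaceVectors-unique = Unique.filter⁺ V? (vectors-unique m)

    ∈-subspaceVectors⁺ : ∀ {u} → V u → u ∈ subspaceVectors
    ∈-subspaceVectors⁺ = ∈-filter⁺ V? (∈-vectors _)

    ∈-subspaceVectors⁻ : ∀ {u} → u ∈ subspaceVectors → V u
    ∈-subspaceVectors⁻ = proj₂ ∘ ∈-filter⁻ V? {xs = vectors m}

    comb-closed : ∀ {k} c (U : Vec (Vec Carrier m) k) → U ∈ allVecs subspaceVectors k → V (comb c U)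
    comb-closed [] [] _ = zero-closed
    comb-closed {suc k} (c ∷ cs) (u ∷ U) p
      with _ , _ , u∈ , U∈ , refl ← ∈-cartesianProductWith⁻ Vec._∷_ subspaceVectors (allVecs subspaceVectors k) p =
      ⊞-closed (∙-closed c (∈-subspaceVectors⁻ u∈)) (comb-closed cs U U∈)

    -- Independence makes `comb` injective in the coefficients, so the span has exactly q^k
    -- elements; all of them lie in V, since the rows of U do.
    outside-span-count : ∀ {k} (U : Vec (Vec Carrier m) k) → U ∈ allVecs subspaceVectors k → LinIndep U →
      Σ[ u ∈ subspaceVectors ] 𝟙 (∉span? u U) ≡ length subspaceVectors ∸ size ℕ.^ k
    outside-span-count {k} U U∈ li = begin
      Σ[ u ∈ subspaceVectors ] 𝟙 (∉span? u U)
        ≡⟨ length-filter (λ u → ∉span? u U) subspaceVectors ⟨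
      length outside
        ≡⟨ Σ-one outside ⟨
      Σ[ _ ∈ outside ] 1
        ≡⟨ ℕ.m+n∸m≡n (Σ[ _ ∈ span U ] 1) _ ⟨
      Σ[ _ ∈ span U ] 1 ℕ.+ Σ[ _ ∈ outside ] 1 ∸ Σ[ _ ∈ span U ] 1
        ≡⟨ cong₂ _∸_ (trans (Σ-complement _≟⃗_ subspaceVectors-unique (Unique.map⁺ (comb-injective {U = U} li) (vectors-unique k)) inside (λ _ → 1)) (Σ-one subspaceVectors)) (Σ-one (span U)) ⟩
      length subspaceVectors ∸ length (span U)
        ≡⟨ cong (length subspaceVectors ∸_) (trans (List.length-map (λ c → comb c U) (vectors k)) (length-allVecs elements k)) ⟩
      length subspaceVectors ∸ size ℕ.^ k ∎
      where
      outside = complement _≟⃗_ (span U) subspaceVectors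
      inside : ∀ {u} → u ∈ span U → u ∈ subspaceVectors
      inside u∈ = let (c , _ , u≡) = ∈-map⁻ (λ c → comb c U) u∈ in
        ∈-subspaceVectors⁺ (subst V (sym u≡) (comb-closed c U U∈))

    frames-count : ∀ k → Σ[ U ∈ allVecs subspaceVectors k ] 𝟙 (linIndep? U) ≡ frames (length subspaceVectors) k
    frames-count zero = trans (ℕ.+-identityʳ _) (𝟙-yes (linIndep? {r = 0} {b = m} []) (λ _ _ ()))
    frames-count (suc k) = begin
      Σ[ U ∈ allVecs subspaceVectors (suc k) ] 𝟙 (linIndep? U)
        ≡⟨ Σ-allVecs-suc subspaceVectors k _ ⟩
      Σ[ u ∈ subspaceVectors ] Σ[ U ∈ allVecs subspaceVectors k ] 𝟙 (linIndep? (u ∷ U))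
        ≡⟨ Σ-cong subspaceVectors (λ u → Σ-cong (allVecs subspaceVectors k) (𝟙-linIndep-∷ u)) ⟩
      Σ[ u ∈ subspaceVectors ] Σ[ U ∈ allVecs subspaceVectors k ] (𝟙 (linIndep? U) ℕ.* 𝟙 (∉span? u U))
        ≡⟨ Σ-swap subspaceVectors (allVecs subspaceVectors k) _ ⟩
      Σ[ U ∈ allVecs subspaceVectors k ] Σ[ u ∈ subspaceVectors ] (𝟙 (linIndep? U) ℕ.* 𝟙 (∉span? u U))
        ≡⟨ Σ-cong-∈ (allVecs subspaceVectors k) (λ U U∈ → trans (Σ-*ˡ subspaceVectors (𝟙 (linIndep? U)) _)
             (𝟙-*-cong (linIndep? U) (outside-span-count U U∈))) ⟩
      Σ[ U ∈ allVecs subspaceVectors k ] (𝟙 (linIndep? U) ℕ.* (length subspaceVectors ∸ size ℕ.^ k))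
        ≡⟨ Σ-*ʳ (allVecs subspaceVectors k) _ _ ⟩
      Σ[ U ∈ allVecs subspaceVectors k ] 𝟙 (linIndep? U) ℕ.* (length subspaceVectors ∸ size ℕ.^ k)
        ≡⟨ cong (ℕ._* (length subspaceVectors ∸ size ℕ.^ k)) (frames-count k) ⟩
      frames (length subspaceVectors) (suc k) ∎

    -- Splitting x as (x - (w·x) z) + (w·x) z identifies V with (V ∩ w⊥) × F.
    hyperplane-count : ∀ (w z : Vec Carrier m) → V z → dot z w ≡ 1# →
      length subspaceVectors ≡ length (filter (λ u → V? u ×-dec dot u w ≟ 0#) (vectors m)) ℕ.* size
    hyperplane-count w z z∈V zw≡1 = trans
      (length-bij split split-injective subspaceVectors-unique
        (Unique.cartesianProduct⁺ (Unique.filter⁺ W? (vectors-unique m)) unique) into onto)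
      (length-cartesianProduct (filter W? (vectors m)) elements)
      where
      W? : Decidable (λ u → V u × dot u w ≡ 0#)
      W? u = V? u ×-dec dot u w ≟ 0#

      split : Vec Carrier m → Vec Carrier m × Carrier
      split x = x ⊞ (- dot x w) ∙ z , dot x w

      merge : Vec Carrier m × Carrier → Vec Carrier m
      merge (u , t) = u ⊞ t ∙ z

      cancel : ∀ {m} (x z : Vec Carrier m) s t → s + t ≡ 0# → x ⊞ s ∙ z ⊞ t ∙ z ≡ x
      cancel [] [] s t _ = refl
      cancel (x ∷ xs) (z ∷ zs) s t s+t≡0 = cong₂ _∷_
        (trans (+-assoc x (s * z) (t * z)) (trans (cong (x +_) (trans (sym (distribʳ z s t)) (trans (cong (_* z) s+t≡0) (zeroˡ z)))) (+-identityʳ x)))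
        (cancel xs zs s t s+t≡0)

      merge-split : ∀ x → merge (split x) ≡ x
      merge-split x = cancel x z (- dot x w) (dot x w) (-‿inverseˡ (dot x w))

      split-injective : ∀ {x y} → split x ≡ split y → x ≡ y
      split-injective {x} {y} eq = trans (sym (merge-split x)) (trans (cong merge eq) (merge-split y))

      dot-merge : ∀ u t → dot (u ⊞ t ∙ z) w ≡ dot u w + t
      dot-merge u t = trans (dot-⊞ u (t ∙ z) w) (cong (dot u w +_) (trans (dot-∙ t z w) (trans (cong (t *_) zw≡1) (*-identityʳ t))))

      into : ∀ {x} → x ∈ subspaceVectors → split x ∈ cartesianProduct (filter W? (vectors m)) elements
      into {x} x∈ = ∈-cartesianProduct⁺
        (∈-filter⁺ W? (∈-vectors _)
          (⊞-closed (∈-subspaceVectors⁻ x∈) (∙-closed _ z∈V) , trans (dot-merge x _) (-‿inverseʳ (dot x w))))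
        (complete _)

      onto : ∀ {p} → p ∈ cartesianProduct (filter W? (vectors m)) elements → ∃ λ x → x ∈ subspaceVectors × p ≡ split x
      onto {u , t} p∈ with _ , _ , u∈ , _ , refl ← ∈-cartesianProductWith⁻ _,_ (filter W? (vectors m)) elements p∈
        with u∈V , uw≡0 ← proj₂ (∈-filter⁻ W? {xs = vectors m} u∈) =
        merge (u , t) , ∈-subspaceVectors⁺ (⊞-closed u∈V (∙-closed t z∈V)) ,
        cong₂ _,_ (sym (trans (cong (λ s → u ⊞ t ∙ z ⊞ (- s) ∙ z) xw≡t) (cancel u z t (- t) (-‿inverseʳ t)))) (sym xw≡t)
        where
        xw≡t : dot (u ⊞ t ∙ z) w ≡ t
        xw≡t = trans (dot-merge u t) (trans (cong (_+ t) uw≡0) (+-identityˡ t))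

-- Orthogonal complements and the ratio of frame counts

permute : ∀ {A : Set} {m n} → Vec A m → Vec (Fin m) n → Vec A n
permute b ρ = Vec.map (lookup b) ρ

lookup-permute : ∀ {A : Set} {m n} (b : Vec A m) (ρ : Vec (Fin m) n) i → lookup (permute b ρ) i ≡ lookup b (lookup ρ i)
lookup-permute b ρ i = lookup-map i (lookup b) ρ

module Counting (F : FiniteField) where
  open Units F
  open Linear F
  open FiniteField F using (Carrier; 0#; 1#; 0≢1; inverse; elements; size)
    renaming (_≟_ to infix 4 _≟_)
  open LinAlg F
  open import Algebra.Properties.Ring ring using (-‿distribˡ-*; -0#≈0#; -‿involutive)
  open ≡-Reasoning

  ≢⇒lookup≢ : ∀ {m} {v w : Vec Carrier m} → v ≢ w → ∃ λ i → lookup v i ≢ lookup w i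
  ≢⇒lookup≢ {m} {v} {w} v≢w = Fin.¬∀⟶∃¬ m (λ i → lookup v i ≡ lookup w i) (λ i → lookup v i ≟ lookup w i) (v≢w ∘ lookup-ext)

  ≢0⃗⇒lookup≢0 : ∀ {m} {v : Vec Carrier m} → v ≢ 0⃗ → ∃ λ i → lookup v i ≢ 0#
  ≢0⃗⇒lookup≢0 v≢0 with i , neq ← ≢⇒lookup≢ v≢0 = i , λ eq → neq (trans eq (sym (lookup-replicate i 0#)))

  orthogonal : ∀ {m} → Vec Carrier m → List (Vec Carrier m)
  orthogonal {m} v = filter (λ u → dot u v ≟ 0#) (vectors m)

  orthogonal₂ : ∀ {m} → Vec Carrier m → Vec Carrier m → List (Vec Carrier m)
  orthogonal₂ {m} v w = filter (λ u → dot u v ≟ 0# ×-dec dot u w ≟ 0#) (vectors m)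

  whole-subspace : ∀ {m} → IsSubspace {m} (λ _ → ⊤)
  whole-subspace = record { zero-closed = tt ; ⊞-closed = λ _ _ → tt ; ∙-closed = λ _ _ → tt }

  orthogonal-subspace : ∀ {m} (v : Vec Carrier m) → IsSubspace (λ u → dot u v ≡ 0#)
  orthogonal-subspace v = record
    { zero-closed = dot-0⃗ v
    ; ⊞-closed = λ {x} {y} p q → trans (dot-⊞ x y v) (trans (cong₂ _+_ p q) (+-identityˡ 0#))
    ; ∙-closed = λ c {x} p → trans (dot-∙ c x v) (trans (cong (c *_) p) (zeroʳ c))
    }

  orthogonal₂-subspace : ∀ {m} (v w : Vec Carrier m) → IsSubspace (λ u → dot u v ≡ 0# × dot u w ≡ 0#)
  orthogonal₂-subspace v w = record
    { zero-closed = dot-0⃗ v , dot-0⃗ w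
    ; ⊞-closed = λ {x} {y} (p , p′) (q , q′) → V.⊞-closed {x} {y} p q , W.⊞-closed {x} {y} p′ q′
    ; ∙-closed = λ c {x} (p , p′) → V.∙-closed c {x} p , W.∙-closed c {x} p′
    }
    where
    module V = IsSubspace (orthogonal-subspace v)
    module W = IsSubspace (orthogonal-subspace w)

  -- `hyperplane-count` in the whole space, with z a basis vector divided by a nonzero entry of v.
  -- Stating the size through its product with q avoids the exponent m - 1.
  length-orthogonal : ∀ {m} {v : Vec Carrier m} → v ≢ 0⃗ → length (orthogonal v) ℕ.* size ≡ size ℕ.^ m
  length-orthogonal {m} {v} v≢0 with i , vᵢ≢0 ← ≢0⃗⇒lookup≢0 v≢0 with b , vᵢb≡1 ← inverse (lookup v i) vᵢ≢0 = begin
    length (orthogonal v) ℕ.* size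
      -- The always true condition is inserted to bring the list into the form used by
      -- `hyperplane-count`.
      ≡⟨ cong (ℕ._* size) (trans (length-filter (λ u → dot u v ≟ 0#) (vectors m))
           (trans (Σ-cong (vectors m) (λ u → 𝟙-cong (dot u v ≟ 0#) (yes tt ×-dec dot u v ≟ 0#) (tt ,_) proj₂))
                  (sym (length-filter (λ u → yes tt ×-dec dot u v ≟ 0#) (vectors m))))) ⟩
    length (filter (λ u → yes tt ×-dec dot u v ≟ 0#) (vectors m)) ℕ.* size
      ≡⟨ hyperplane-count (λ _ → yes tt) whole-subspace v (b ∙ basis i) tt
           (trans (dot-∙ b (basis i) v) (trans (cong (b *_) (dot-basis i v)) (trans (*-comm b _) vᵢb≡1))) ⟨
    length (filter {P = λ _ → ⊤} (λ _ → yes tt) (vectors m))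
      ≡⟨ cong length (List.filter-all {P = λ _ → ⊤} (λ _ → yes tt) {vectors m} (All.tabulate (λ _ → tt))) ⟩
    length (vectors m)
      ≡⟨ length-allVecs elements m ⟩
    size ℕ.^ m ∎

  -- Inside v⊥ a vector z with z·w = 1 is required. Choose i with v_i ≠ 0, and j at which w differs
  -- from (w_i / v_i) v. Then e_j - (v_j / v_i) e_i is orthogonal to v, while its product with w is
  -- w_j - (w_i / v_i) v_j ≠ 0; it remains to rescale.
  length-orthogonal₂ : ∀ {m} {v w : Vec Carrier m} → v ≢ 0⃗ → (∀ c → w ≢ c ∙ v) →
    length (orthogonal₂ v w) ℕ.* size ≡ length (orthogonal v)
  length-orthogonal₂ {m} {v} {w} v≢0 indep
    with i , vᵢ≢0 ← ≢0⃗⇒lookup≢0 v≢0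
    with b , vᵢb≡1 ← inverse (lookup v i) vᵢ≢0
    with j , wⱼ≢ ← ≢⇒lookup≢ (indep (lookup w i * b))
    = sym (hyperplane-count (λ u → dot u v ≟ 0#) (orthogonal-subspace v) w (t⁻¹ ∙ z) z∈V (trans (dot-∙ t⁻¹ z w) (trans (*-comm t⁻¹ _) (proj₂ t-inverse))))
    where
    s = - (b * lookup v j)
    z = basis j ⊞ s ∙ basis i

    dot-z : ∀ u → dot z u ≡ lookup u j + s * lookup u i
    dot-z u = trans (dot-⊞ (basis j) (s ∙ basis i) u)
      (cong₂ _+_ (dot-basis j u) (trans (dot-∙ s (basis i) u) (cong (s *_) (dot-basis i u))))

    z⊥v : dot z v ≡ 0#
    z⊥v = begin
      dot z v                                           ≡⟨ dot-z v ⟩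
      lookup v j + s * lookup v i                       ≡⟨ cong (lookup v j +_) (sym (-‿distribˡ-* (b * lookup v j) (lookup v i))) ⟩
      lookup v j + - (b * lookup v j * lookup v i)      ≡⟨ cong (λ x → lookup v j + - x) (trans (solve 3 (λ b x y → b :* x :* y := y :* b :* x) refl b (lookup v j) (lookup v i))
                                                             (trans (cong (_* lookup v j) vᵢb≡1) (*-identityˡ _))) ⟩
      lookup v j + - lookup v j                         ≡⟨ -‿inverseʳ _ ⟩
      0#                                                ∎

    t≢0 : dot z w ≢ 0#
    t≢0 eq = wⱼ≢ (trans (x∙y⁻¹≈ε⇒x≈y _ _ (begin
      lookup w j + - (lookup w i * b * lookup v j)      ≡⟨ cong (λ x → lookup w j + - x) (solve 3 (λ b x y → y :* b :* x := b :* x :* y) refl b (lookup v j) (lookup w i)) ⟩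
      lookup w j + - (b * lookup v j * lookup w i)      ≡⟨ cong (lookup w j +_) (-‿distribˡ-* (b * lookup v j) (lookup w i)) ⟩
      lookup w j + s * lookup w i                       ≡⟨ dot-z w ⟨
      dot z w                                           ≡⟨ eq ⟩
      0#                                                ∎))
      (sym (lookup-∙ (lookup w i * b) v j)))

    t-inverse = inverse (dot z w) t≢0
    t⁻¹ = proj₁ t-inverse

    z∈V : dot (t⁻¹ ∙ z) v ≡ 0#
    z∈V = trans (dot-∙ t⁻¹ z v) (trans (cong (t⁻¹ *_) z⊥v) (zeroʳ t⁻¹))

  -- For s = q s′ the factor s - q^(i+1) is q times s′ - q^i. Of the factors of `frames s`, only s -
  -- 1 has no partner.
  frames-scale : ∀ {s s′} → s′ ℕ.* size ≡ s → ∀ k → frames s (suc k) ≡ frames s′ k ℕ.* size ℕ.^ k ℕ.* (s ∸ 1)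
  frames-scale eq zero = refl
  frames-scale {s} {s′} refl (suc k) = begin
    frames s (suc k) ℕ.* (s′ ℕ.* size ∸ size ℕ.* size ℕ.^ k)
      ≡⟨ cong₂ ℕ._*_ (frames-scale {s} {s′} refl k) (cong (_∸ size ℕ.* size ℕ.^ k) (ℕ.*-comm s′ size)) ⟩
    frames s′ k ℕ.* size ℕ.^ k ℕ.* (s ∸ 1) ℕ.* (size ℕ.* s′ ∸ size ℕ.* size ℕ.^ k)
      ≡⟨ cong (frames s′ k ℕ.* size ℕ.^ k ℕ.* (s ∸ 1) ℕ.*_) (ℕ.*-distribˡ-∸ size s′ (size ℕ.^ k)) ⟨
    frames s′ k ℕ.* size ℕ.^ k ℕ.* (s ∸ 1) ℕ.* (size ℕ.* (s′ ∸ size ℕ.^ k))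
      ≡⟨ Solver.solve 5 (λ f p t q r → f Solver.:* p Solver.:* t Solver.:* (q Solver.:* r) Solver.:= f Solver.:* r Solver.:* (q Solver.:* p) Solver.:* t) refl
           (frames s′ k) (size ℕ.^ k) (s ∸ 1) size (s′ ∸ size ℕ.^ k) ⟩
    frames s′ k ℕ.* (s′ ∸ size ℕ.^ k) ℕ.* (size ℕ.* size ℕ.^ k) ℕ.* (s ∸ 1) ∎
    where module Solver = +-*-Solver

  instance
    size≢0 : NonZero size
    size≢0 = subst NonZero (sym size≡1+n) _

  -- The quotient of the two frame counts is the probability p. By `frames-scale` it telescopes to
  -- (s - q^ℓ) over q^ℓ (s - 1); multiplying both by q and using s q = q^m leaves q^ℓ as a common
  -- factor.
  frames-ratio : ∀ {ℓ m s s′} → ℓ < m → s ℕ.* size ≡ size ℕ.^ m → s′ ℕ.* size ≡ s →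
    frames s′ ℓ ℕ.* (size ℕ.^ m ∸ size) ≡ frames s ℓ ℕ.* (size ℕ.^ (m ∸ ℓ) ∸ size)
  frames-ratio {ℓ} {m} {s} {s′} ℓ<m s*q≡ s′*q≡ = ℕ.*-cancelʳ-≡ _ _ (size ℕ.^ ℓ) {{ℕ.m^n≢0 size ℓ}} (begin
    frames s′ ℓ ℕ.* (size ℕ.^ m ∸ size) ℕ.* size ℕ.^ ℓ
      ≡⟨ cong (λ x → frames s′ ℓ ℕ.* x ℕ.* size ℕ.^ ℓ) (trans (cong₂ _∸_ (sym s*q≡) (sym (ℕ.*-identityˡ size))) (sym (ℕ.*-distribʳ-∸ size s 1))) ⟩
    frames s′ ℓ ℕ.* ((s ∸ 1) ℕ.* size) ℕ.* size ℕ.^ ℓ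
      ≡⟨ Solver.solve 4 (λ f t q p → f Solver.:* (t Solver.:* q) Solver.:* p Solver.:= f Solver.:* p Solver.:* t Solver.:* q) refl (frames s′ ℓ) (s ∸ 1) size (size ℕ.^ ℓ) ⟩
    frames s′ ℓ ℕ.* size ℕ.^ ℓ ℕ.* (s ∸ 1) ℕ.* size
      ≡⟨ cong (ℕ._* size) (frames-scale {s} {s′} s′*q≡ ℓ) ⟨
    frames s ℓ ℕ.* (s ∸ size ℕ.^ ℓ) ℕ.* size
      ≡⟨ ℕ.*-assoc (frames s ℓ) _ size ⟩
    frames s ℓ ℕ.* ((s ∸ size ℕ.^ ℓ) ℕ.* size)
      ≡⟨ cong (frames s ℓ ℕ.*_) (begin
           (s ∸ size ℕ.^ ℓ) ℕ.* size                         ≡⟨ ℕ.*-distribʳ-∸ size s (size ℕ.^ ℓ) ⟩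
           s ℕ.* size ∸ size ℕ.^ ℓ ℕ.* size                  ≡⟨ cong (_∸ size ℕ.^ ℓ ℕ.* size) (trans s*q≡ (trans (cong (size ℕ.^_) (sym (ℕ.m∸n+n≡m (ℕ.<⇒≤ ℓ<m)))) (ℕ.^-distribˡ-+-* size (m ∸ ℓ) ℓ))) ⟩
           size ℕ.^ (m ∸ ℓ) ℕ.* size ℕ.^ ℓ ∸ size ℕ.^ ℓ ℕ.* size ≡⟨ cong (size ℕ.^ (m ∸ ℓ) ℕ.* size ℕ.^ ℓ ∸_) (ℕ.*-comm (size ℕ.^ ℓ) size) ⟩
           size ℕ.^ (m ∸ ℓ) ℕ.* size ℕ.^ ℓ ∸ size ℕ.* size ℕ.^ ℓ ≡⟨ ℕ.*-distribʳ-∸ (size ℕ.^ ℓ) (size ℕ.^ (m ∸ ℓ)) size ⟨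
           (size ℕ.^ (m ∸ ℓ) ∸ size) ℕ.* size ℕ.^ ℓ          ∎) ⟩
    frames s ℓ ℕ.* ((size ℕ.^ (m ∸ ℓ) ∸ size) ℕ.* size ℕ.^ ℓ)
      ≡⟨ ℕ.*-assoc (frames s ℓ) _ _ ⟨
    frames s ℓ ℕ.* (size ℕ.^ (m ∸ ℓ) ∸ size) ℕ.* size ℕ.^ ℓ ∎)
    where module Solver = +-*-Solver

  1<size : 1 < size
  1<size = subst (1 <_) (sym size≡1+n) (s≤s (ℕ.>-nonZero⁻¹ n))

  -- As s q = q^m, every factor s - q^i with i < ℓ is positive. This makes the list of admissible A
  -- nonempty, so its average is a true one.
  frames>0 : ∀ {m s} ℓ → ℓ < m → s ℕ.* size ≡ size ℕ.^ m → 0 < frames s ℓ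
  frames>0 zero _ _ = s≤s z≤n
  frames>0 {m} {s} (suc ℓ) ℓ<m s*q≡ = ℕ.*-mono-< (frames>0 ℓ (ℕ.<-trans (ℕ.n<1+n ℓ) ℓ<m) s*q≡)
    (ℕ.m<n⇒0<n∸m {size ℕ.^ ℓ} {s} (ℕ.*-cancelʳ-< size _ _ (subst₂ _<_ (ℕ.*-comm size (size ℕ.^ ℓ)) (sym s*q≡) (ℕ.^-monoʳ-< size 1<size ℓ<m))))

  -- Matrices of full rank and columns of rank one

  linIndep-rows⇒injective : ∀ {k l m} (A : Mat l m) (s : Vec (Fin l) k) → LinIndep (Vec.map (lookup A) s) →
    ∀ {i j} → lookup s i ≡ lookup s j → i ≡ j
  linIndep-rows⇒injective A s li {i} {j} eq = linIndep⇒rows-distinct {U = Vec.map (lookup A) s} li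
    (trans (lookup-map i (lookup A) s) (trans (cong (lookup A) eq) (sym (lookup-map j (lookup A) s))))

  -- Independent rows are distinct, so a choice of k rows among k is a permutation, along which the
  -- coefficients of a relation can be transported.
  linIndep-rows⇒ : ∀ {k m} (A : Mat k m) (s : Vec (Fin k) k) → LinIndep (Vec.map (lookup A) s) → LinIndep A
  linIndep-rows⇒ {k} {m} A s li c eq i with j , i≡sj ← injective⇒surjective (lookup s) (linIndep-rows⇒injective A s li) i = begin
    lookup c i               ≡⟨ cong (lookup c) i≡sj ⟩
    lookup c (lookup s j)    ≡⟨ lookup∘tabulate (lookup c ∘ lookup s) j ⟨
    lookup c′ j              ≡⟨ li c′ eq′ j ⟩
    0#                       ∎
    where
    c′ : Vec Carrier k
    c′ = tabulate (lookup c ∘ lookup s)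
    eq′ : ∀ j → ∑ (λ i → lookup c′ i * lookup (lookup (Vec.map (lookup A) s) i) j) ≡ 0#
    eq′ j = trans (∑-cong (λ i → cong₂ (λ x r → x * lookup r j) (lookup∘tabulate (lookup c ∘ lookup s) i) (lookup-map i (lookup A) s)))
      (trans (∑-permute s (injective⇒unique s (λ i j → linIndep-rows⇒injective A s li)) (λ i → lookup c i * lookup (lookup A i) j)) (eq j))

  hasFullRank⇒linIndep : ∀ {k m} (A : Mat k m) → HasRank A k → LinIndep A
  hasFullRank⇒linIndep A ((s , li) , _) = linIndep-rows⇒ A s li

  -- Any k + 1 rows chosen among k repeat one, by the pigeonhole principle, whereas independent rows
  -- are distinct.
  linIndep⇒hasFullRank : ∀ {k m} (A : Mat k m) → LinIndep A → HasRank A k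
  linIndep⇒hasFullRank {k} A li = (Vec.allFin k , subst LinIndep (sym (map-lookup-allFin A)) li) ,
    λ s li′ → let (i , j , i<j , eq) = Fin.pigeonhole (ℕ.n<1+n k) (lookup s) in
      Fin.<⇒≢ i<j (linIndep-rows⇒injective A s li′ eq)

  column : ∀ {m} → Vec Carrier m → Mat m 1
  column b = Vec.map (_∷ []) b

  lookup-column : ∀ {m} (b : Vec Carrier m) i → lookup (column b) i ≡ lookup b i ∷ []
  lookup-column b i = lookup-map i (_∷ []) b

  hasRank1⇒≢0⃗ : ∀ {m} (b : Vec Carrier m) → HasRank (column b) 1 → b ≢ 0⃗
  hasRank1⇒≢0⃗ b ((i ∷ [] , li) , _) refl = 0≢1 (sym (cong Vec.head (linIndep⇒ {U = lookup (column 0⃗) i ∷ []} li {1# ∷ []}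
    (begin
      1# ∙ lookup (column 0⃗) i ⊞ 0⃗    ≡⟨ cong (λ r → 1# ∙ r ⊞ 0⃗) (trans (lookup-column 0⃗ i) (cong (_∷ []) (lookup-replicate i 0#))) ⟩
      1# ∙ 0⃗ ⊞ 0⃗                       ≡⟨ cong (_⊞ 0⃗) (1∙ 0⃗) ⟩
      0⃗ ⊞ 0⃗                            ≡⟨ ⊞-identityˡ 0⃗ ⟩
      0⃗                                ∎))))

  ≢0⃗⇒hasRank1 : ∀ {m} (b : Vec Carrier m) → b ≢ 0⃗ → HasRank (column b) 1
  ≢0⃗⇒hasRank1 b b≢0 with i , bᵢ≢0 ← ≢0⃗⇒lookup≢0 b≢0 = (i ∷ [] , independent) , dependent
    where
    independent : LinIndep (lookup (column b) i ∷ [])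
    independent = subst (λ r → LinIndep (r ∷ [])) (sym (lookup-column b i))
      (⇒linIndep {U = (lookup b i ∷ []) ∷ []} λ { {c ∷ []} eq → cong (_∷ []) (x*y≡0⇒y≡0 bᵢ≢0
        (trans (*-comm _ c) (trans (sym (+-identityʳ _)) (cong Vec.head eq)))) })
    pair-dependent : ∀ x y → ¬ LinIndep ((x ∷ []) ∷ (y ∷ []) ∷ [])
    pair-dependent x y li = 0≢1 (sym (cong Vec.head (relation⇒0 {1#} {1#} (trans (cong₂ (λ x y → 1# * x + (1# * y + 0#)) x≡0 y≡0)
        (trans (cong₂ (λ u v → u + (v + 0#)) (zeroʳ 1#) (zeroʳ 1#)) (trans (+-identityˡ _) (+-identityˡ 0#)))))))
      where
      relation⇒0 : ∀ {c d} → c * x + (d * y + 0#) ≡ 0# → c ∷ d ∷ [] ≡ 0⃗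
      relation⇒0 eq = linIndep⇒ {U = (x ∷ []) ∷ (y ∷ []) ∷ []} li (cong (_∷ []) eq)
      -- The relation y x - x y = 0 has coefficients y and -x, so independence forces x = y = 0; but
      -- then the coefficients 1 and 1 give a relation as well.
      cross : y ∷ - x ∷ [] ≡ 0⃗
      cross = relation⇒0 (trans (cong (y * x +_) (trans (+-identityʳ _) (trans (sym (-‿distribˡ-* x y)) (cong -_ (*-comm x y))))) (-‿inverseʳ (y * x)))
      y≡0 : y ≡ 0#
      y≡0 = cong Vec.head cross
      x≡0 : x ≡ 0#
      x≡0 = trans (sym (-‿involutive x)) (trans (cong -_ (cong (Vec.head ∘ Vec.tail) cross)) -0#≈0#)
    dependent : ∀ s → ¬ LinIndep (Vec.map (lookup (column b)) s)
    dependent (i ∷ j ∷ []) li = pair-dependent (lookup b i) (lookup b j)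
      (subst₂ (λ r r′ → LinIndep (r ∷ r′ ∷ [])) (lookup-column b i) (lookup-column b j) li)

  Solves : ∀ {ℓ m} → Mat ℓ m → Vec Carrier m → Set
  Solves A v = ∀ i → dot (lookup A i) v ≡ 0#

  solves? : ∀ {ℓ m} (A : Mat ℓ m) (v : Vec Carrier m) → Dec (Solves A v)
  solves? A v = Fin.all? λ i → dot (lookup A i) v ≟ 0#

  ⊗-column : ∀ {ℓ m} (A : Mat ℓ m) (ρ : Vec (Fin m) m) (b : Vec Carrier m) i →
    lookup (lookup ((A ⊗ permMat ρ) ⊗ column b) i) zero ≡ dot (lookup A i) (permute b ρ)
  ⊗-column A ρ b i = begin
    lookup (lookup ((A ⊗ permMat ρ) ⊗ column b) i) zero
      ≡⟨ lookup-⊗ (A ⊗ permMat ρ) (column b) i zero ⟩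
    ∑ (λ k → lookup (lookup (A ⊗ permMat ρ) i) k * lookup (lookup (column b) k) zero)
      ≡⟨ ∑-cong (λ k → cong₂ _*_
           (trans (lookup-⊗ A (permMat ρ) i k) (∑-cong (λ j → cong (lookup (lookup A i) j *_) (lookup-permMat j k))))
           (cong (λ r → lookup r zero) (lookup-column b k))) ⟩
    ∑ (λ k → ∑ (λ j → lookup (lookup A i) j * δ (lookup ρ j) k) * lookup b k)
      ≡⟨ ∑-cong (λ k → trans (*-comm _ (lookup b k)) (sym (∑-*ˡ (lookup b k) (λ j → lookup (lookup A i) j * δ (lookup ρ j) k)))) ⟩
    ∑ (λ k → ∑ (λ j → lookup b k * (lookup (lookup A i) j * δ (lookup ρ j) k)))
      ≡⟨ ∑-swap (λ k j → lookup b k * (lookup (lookup A i) j * δ (lookup ρ j) k)) ⟩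
    ∑ (λ j → ∑ (λ k → lookup b k * (lookup (lookup A i) j * δ (lookup ρ j) k)))
      ≡⟨ ∑-cong (λ j → trans
           (∑-cong (λ k → solve 3 (λ b a d → b :* (a :* d) := a :* (d :* b)) refl (lookup b k) (lookup (lookup A i) j) (δ (lookup ρ j) k)))
           (∑-*ˡ (lookup (lookup A i) j) (λ k → δ (lookup ρ j) k * lookup b k))) ⟩
    ∑ (λ j → lookup (lookup A i) j * ∑ (λ k → δ (lookup ρ j) k * lookup b k))
      ≡⟨ ∑-cong (λ j → cong (lookup (lookup A i) j *_) (trans (∑-δ (lookup ρ j) (lookup b)) (sym (lookup-permute b ρ j)))) ⟩
    dot (lookup A i) (permute b ρ) ∎
    where
    lookup-⊗ : ∀ {a b c} (A : Mat a b) (B : Mat b c) i k → lookup (lookup (A ⊗ B) i) k ≡ ∑ λ j → lookup (lookup A i) j * lookup (lookup B j) k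
    lookup-⊗ A B i k = trans (cong (λ r → lookup r k) (lookup∘tabulate (λ i → tabulate λ k → ∑ λ j → lookup (lookup A i) j * lookup (lookup B j) k) i))
      (lookup∘tabulate (λ k → ∑ λ j → lookup (lookup A i) j * lookup (lookup B j) k) k)
    lookup-permMat : ∀ j k → lookup (lookup (permMat ρ) j) k ≡ δ (lookup ρ j) k
    lookup-permMat j k = trans (cong (λ r → lookup r k) (lookup∘tabulate (λ j → tabulate (δ (lookup ρ j))) j)) (lookup∘tabulate (δ (lookup ρ j)) k)

  ⊗≡𝟎⇒solves : ∀ {ℓ m} (A : Mat ℓ m) ρ b → (A ⊗ permMat ρ) ⊗ column b ≡ 𝟎 → Solves A (permute b ρ)
  ⊗≡𝟎⇒solves A ρ b eq i = trans (sym (⊗-column A ρ b i)) (trans (cong (λ M → lookup (lookup M i) zero) eq) (cong (λ r → lookup r zero) (lookup-replicate i (replicate 1 0#))))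

  solves⇒⊗≡𝟎 : ∀ {ℓ m} (A : Mat ℓ m) ρ b → Solves A (permute b ρ) → (A ⊗ permMat ρ) ⊗ column b ≡ 𝟎
  solves⇒⊗≡𝟎 A ρ b sol = lookup-ext λ i → lookup-ext λ
    { zero → trans (⊗-column A ρ b i) (trans (sol i) (sym (cong (λ r → lookup r zero) (lookup-replicate i (replicate 1 0#))))) }

  𝟙-solves : ∀ {ℓ m} (A : Mat ℓ m) ρ b → 𝟙 (((A ⊗ permMat ρ) ⊗ column b) ≟M 𝟎) ≡ 𝟙 (solves? A (permute b ρ))
  𝟙-solves A ρ b = 𝟙-cong (((A ⊗ permMat ρ) ⊗ column b) ≟M 𝟎) (solves? A (permute b ρ)) (⊗≡𝟎⇒solves A ρ b) (solves⇒⊗≡𝟎 A ρ b)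

-- The number of solutions

a∸b+b∸c : ∀ {a b c} → c ≤ b → b ≤ a → (a ∸ b) ℕ.+ (b ∸ c) ≡ a ∸ c
a∸b+b∸c {a} {b} {c} c≤b b≤a = trans (sym (ℕ.+-∸-assoc (a ∸ b) c≤b)) (cong (_∸ c) (ℕ.m∸n+n≡m b≤a))

permute-map : ∀ {A B : Set} {m n} (e : A → B) (w : Vec A m) (ρ : Vec (Fin m) n) → permute (Vec.map e w) ρ ≡ Vec.map e (permute w ρ)
permute-map e w ρ = trans (Vec.map-cong (λ i → lookup-map i e w) ρ) (Vec.map-∘ e (lookup w) ρ)

map-injective : ∀ {A B : Set} {n} {e : A → B} → (∀ {x y} → e x ≡ e y → x ≡ y) →
  {v w : Vec A n} → Vec.map e v ≡ Vec.map e w → v ≡ w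
map-injective {e = e} inj {v} {w} eq = lookup-ext λ i →
  inj (trans (sym (lookup-map i e v)) (trans (cong (λ u → lookup u i) eq) (lookup-map i e w)))

module Assembly (F : FiniteField) where
  open Units F
  open Linear F
  open Counting F
  open FiniteField F using (Carrier; 0#; elements; complete; unique; size)
    renaming (_≟_ to infix 4 _≟_)
  open LinAlg F
  open ≡-Reasoning

  unique⇒isPerm : ∀ {m} {ρ : Vec (Fin m) m} → Unique (toList ρ) → IsPerm ρ
  unique⇒isPerm {ρ = ρ} = unique⇒injective ρ

  Σ-Sym : ∀ m (f : Vec (Fin m) m → ℕ) → Σₗ (Sym m) f ≡ Σ[ ρ ∈ allVecs (allFin m) m ] (𝟙 (unique? ρ) ℕ.* f ρ)
  Σ-Sym m f = trans (Σ-filter isPerm? (allVecs (allFin m) m) f)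
    (Σ-cong (allVecs (allFin m) m) λ ρ → cong (ℕ._* f ρ) (𝟙-cong (isPerm? ρ) (unique? ρ) (injective⇒unique ρ) unique⇒isPerm))

  length-Sym : ∀ m → length (Sym m) ≡ m !
  length-Sym m = trans (sym (Σ-one (Sym m))) (trans (Σ-Sym m (λ _ → 1))
    (trans (Σ-cong (allVecs (allFin m) m) (λ ρ → ℕ.*-identityʳ (𝟙 (unique? ρ)))) (permutations-count m)))

  ∈-Sym⁻ : ∀ {m} {ρ : Vec (Fin m) m} → ρ ∈ Sym m → IsPerm ρ
  ∈-Sym⁻ {m} = proj₂ ∘ ∈-filter⁻ isPerm? {xs = allVecs (allFin m) m}

  permute-nonzero : ∀ {m} (b : Vec Carrier m) (ρ : Vec (Fin m) m) → IsPerm ρ → b ≢ 0⃗ → permute b ρ ≢ 0⃗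
  permute-nonzero b ρ perm b≢0 eq with i , bᵢ≢0 ← ≢0⃗⇒lookup≢0 b≢0
    with j , i≡ρj ← injective⇒surjective (lookup ρ) (λ {i} {j} → perm i j) i =
    bᵢ≢0 (trans (cong (lookup b) i≡ρj) (trans (sym (lookup-permute b ρ j)) (trans (cong (λ v → lookup v j) eq) (lookup-replicate j 0#))))

  Σ-admissible : ∀ ℓ {m} (π : Vec (Fin m) m) (b : Vec Carrier m) (f : Mat ℓ m → ℕ) →
    Σₗ (admissibleA ℓ π (column b)) f ≡
    Σ[ A ∈ allVecs (vectors m) ℓ ] (𝟙 (linIndep? A) ℕ.* (𝟙 (solves? A (permute b π)) ℕ.* f A))
  Σ-admissible ℓ {m} π b f = begin
    Σₗ (admissibleA ℓ π (column b)) f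
      ≡⟨ Σ-filter (λ A → ((A ⊗ permMat π) ⊗ column b) ≟M 𝟎) (matsOfRank ℓ m ℓ) f ⟩
    Σ[ A ∈ matsOfRank ℓ m ℓ ] (𝟙 (((A ⊗ permMat π) ⊗ column b) ≟M 𝟎) ℕ.* f A)
      ≡⟨ Σ-filter (λ A → hasRank? A ℓ) (allVecs (vectors m) ℓ) _ ⟩
    Σ[ A ∈ allVecs (vectors m) ℓ ] (𝟙 (hasRank? A ℓ) ℕ.* (𝟙 (((A ⊗ permMat π) ⊗ column b) ≟M 𝟎) ℕ.* f A))
      ≡⟨ Σ-cong (allVecs (vectors m) ℓ) (λ A → cong₂ ℕ._*_
           (𝟙-cong (hasRank? A ℓ) (linIndep? A) (hasFullRank⇒linIndep A) (linIndep⇒hasFullRank A))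
           (cong (ℕ._* f A) (𝟙-solves A π b))) ⟩
    Σ[ A ∈ allVecs (vectors m) ℓ ] (𝟙 (linIndep? A) ℕ.* (𝟙 (solves? A (permute b π)) ℕ.* f A)) ∎

  solutions-count : ∀ ℓ {m} (v : Vec Carrier m) →
    Σ[ A ∈ allVecs (vectors m) ℓ ] (𝟙 (linIndep? A) ℕ.* 𝟙 (solves? A v)) ≡ frames (length (orthogonal v)) ℓ
  solutions-count ℓ {m} v = begin
    Σ[ A ∈ allVecs (vectors m) ℓ ] (𝟙 (linIndep? A) ℕ.* 𝟙 (solves? A v))
      ≡⟨ Σ-cong (allVecs (vectors m) ℓ) (λ A → ℕ.*-comm (𝟙 (linIndep? A)) (𝟙 (solves? A v))) ⟩
    Σ[ A ∈ allVecs (vectors m) ℓ ] (𝟙 (solves? A v) ℕ.* 𝟙 (linIndep? A))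
      ≡⟨ Σ-allVecs-filter (λ u → dot u v ≟ 0#) (vectors m) ℓ (λ A → 𝟙 (linIndep? A)) ⟨
    Σ[ A ∈ allVecs (orthogonal v) ℓ ] 𝟙 (linIndep? A)
      ≡⟨ frames-count (λ u → dot u v ≟ 0#) (orthogonal-subspace v) ℓ ⟩
    frames (length (orthogonal v)) ℓ ∎

  common-solutions-count : ∀ ℓ {m} (v w : Vec Carrier m) →
    Σ[ A ∈ allVecs (vectors m) ℓ ] (𝟙 (linIndep? A) ℕ.* (𝟙 (solves? A v) ℕ.* 𝟙 (solves? A w))) ≡ frames (length (orthogonal₂ v w)) ℓ
  common-solutions-count ℓ {m} v w = begin
    Σ[ A ∈ allVecs (vectors m) ℓ ] (𝟙 (linIndep? A) ℕ.* (𝟙 (solves? A v) ℕ.* 𝟙 (solves? A w)))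
      ≡⟨ Σ-cong (allVecs (vectors m) ℓ) (λ A → trans (ℕ.*-comm (𝟙 (linIndep? A)) _) (cong (ℕ._* 𝟙 (linIndep? A)) (both A))) ⟩
    Σ[ A ∈ allVecs (vectors m) ℓ ] (𝟙 (both? A) ℕ.* 𝟙 (linIndep? A))
      ≡⟨ Σ-allVecs-filter (λ u → dot u v ≟ 0# ×-dec dot u w ≟ 0#) (vectors m) ℓ (λ A → 𝟙 (linIndep? A)) ⟨
    Σ[ A ∈ allVecs (orthogonal₂ v w) ℓ ] 𝟙 (linIndep? A)
      ≡⟨ frames-count (λ u → dot u v ≟ 0# ×-dec dot u w ≟ 0#) (orthogonal₂-subspace v w) ℓ ⟩
    frames (length (orthogonal₂ v w)) ℓ ∎
    where
    both? : (A : Mat ℓ m) → Dec (∀ i → dot (lookup A i) v ≡ 0# × dot (lookup A i) w ≡ 0#)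
    both? A = Fin.all? λ i → dot (lookup A i) v ≟ 0# ×-dec dot (lookup A i) w ≟ 0#
    both : ∀ A → 𝟙 (solves? A v) ℕ.* 𝟙 (solves? A w) ≡ 𝟙 (both? A)
    both A = trans (sym (𝟙-× (solves? A v) (solves? A w)))
      (𝟙-cong (solves? A v ×-dec solves? A w) (both? A) (λ (p , q) i → p i , q i) (λ h → proj₁ ∘ h , proj₂ ∘ h))

  -- For v ≠ 0 at most one scalar fits, so this is the indicator of w ∈ F* v. Written as a number of
  -- scalars, it lets the sum over c be exchanged with the sums over ρ and b; the price is the value
  -- `n` at v = w = 0.
  multiples : ∀ {m} → Vec Carrier m → Vec Carrier m → ℕ
  multiples v w = Σ[ c ∈ units ] 𝟙 (w ≟⃗ c ∙ v)

  ∙-injective : ∀ {m} {v : Vec Carrier m} → v ≢ 0⃗ → ∀ {c d} → c ∙ v ≡ d ∙ v → c ≡ d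
  ∙-injective {v = v} v≢0 {c} {d} eq with i , vᵢ≢0 ← ≢0⃗⇒lookup≢0 v≢0 = *-cancelˡ vᵢ≢0
    (trans (*-comm _ c) (trans (sym (lookup-∙ c v i)) (trans (cong (λ u → lookup u i) eq) (trans (lookup-∙ d v i) (*-comm d _)))))

  multiples≡1 : ∀ {m} {v w : Vec Carrier m} → v ≢ 0⃗ → ∀ {c} → c ∈ units → w ≡ c ∙ v → multiples v w ≡ 1
  multiples≡1 {v = v} v≢0 {c} c∈ refl = trans
    (Σ-cong units (λ d → trans (𝟙-cong (c ∙ v ≟⃗ d ∙ v) (c ≟ d) (∙-injective v≢0) (cong (_∙ v))) (sym (ℕ.*-identityʳ _))))
    (Σ-point _≟_ units-unique c∈ (λ _ → 1))

  -- Given A v = 0, a multiple w of v is always killed by A, and any other w with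
  -- probability (q^(m-ℓ) - q) / (q^m - q).
  common-solutions-weight : ∀ {ℓ m} → ℓ < m → {v w : Vec Carrier m} → v ≢ 0⃗ → w ≢ 0⃗ →
    Σ[ A ∈ allVecs (vectors m) ℓ ] (𝟙 (linIndep? A) ℕ.* (𝟙 (solves? A v) ℕ.* 𝟙 (solves? A w))) ℕ.* (size ℕ.^ m ∸ size) ≡
    frames (length (orthogonal v)) ℓ ℕ.* (multiples v w ℕ.* (size ℕ.^ m ∸ size ℕ.^ (m ∸ ℓ)) ℕ.+ (size ℕ.^ (m ∸ ℓ) ∸ size))
  common-solutions-weight {ℓ} {m} ℓ<m {v} {w} v≢0 w≢0 with any? (λ c → w ≟⃗ c ∙ v) units
  ... | yes found with c , c∈ , w≡cv ← find found = cong₂ ℕ._*_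
      (trans (Σ-cong (allVecs (vectors m) ℓ) (λ A → cong (𝟙 (linIndep? A) ℕ.*_) (absorb A))) (solutions-count ℓ v))
      -- For a multiple of v the weight is X + Y = q^m - q, that is, probability 1.
      (sym (trans (cong (λ x → x ℕ.* X ℕ.+ Y) (multiples≡1 v≢0 c∈ w≡cv))
        (trans (cong (ℕ._+ Y) (ℕ.*-identityˡ X)) (a∸b+b∸c {size ℕ.^ m} {size ℕ.^ (m ∸ ℓ)} {size} q≤q^[m∸ℓ] (ℕ.^-monoʳ-≤ size (ℕ.m∸n≤m m ℓ))))))
    where
    X = size ℕ.^ m ∸ size ℕ.^ (m ∸ ℓ)
    Y = size ℕ.^ (m ∸ ℓ) ∸ size
    q≤q^[m∸ℓ] : size ≤ size ℕ.^ (m ∸ ℓ)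
    q≤q^[m∸ℓ] = subst (_≤ size ℕ.^ (m ∸ ℓ)) (ℕ.^-identityʳ size) (ℕ.^-monoʳ-≤ size (ℕ.m<n⇒0<n∸m ℓ<m))
    absorb : ∀ A → 𝟙 (solves? A v) ℕ.* 𝟙 (solves? A w) ≡ 𝟙 (solves? A v)
    absorb A = trans (𝟙-*-cong (solves? A v) (λ sol → 𝟙-yes (solves? A w) (λ i →
      trans (cong (dot (lookup A i)) w≡cv) (trans (dot-∙ʳ c (lookup A i) v) (trans (cong (c *_) (sol i)) (zeroʳ c)))))) (ℕ.*-identityʳ _)
  ... | no none = trans (cong (ℕ._* (size ℕ.^ m ∸ size)) (common-solutions-count ℓ v w))
    (trans (frames-ratio {ℓ} {m} ℓ<m (length-orthogonal v≢0) (length-orthogonal₂ v≢0 independent))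
      (cong (λ x → frames (length (orthogonal v)) ℓ ℕ.* (x ℕ.* (size ℕ.^ m ∸ size ℕ.^ (m ∸ ℓ)) ℕ.+ (size ℕ.^ (m ∸ ℓ) ∸ size)))
        (sym (Σ-zero units (λ c c∈ → 𝟙-no (w ≟⃗ c ∙ v) (λ eq → none (lose c∈ eq)))))))
    where
    independent : ∀ c → w ≢ c ∙ v
    independent c eq with c ≟ 0#
    ... | yes refl = w≢0 (trans eq (0∙ v))
    ... | no c≢0 = none (lose (∈-units⁺ c≢0) eq)

  proportional : ∀ {m} → Vec (Fin m) m → Vec Carrier m → ℕ
  proportional {m} π b = Σ[ ρ ∈ Sym m ] multiples (permute b π) (permute b ρ)

  length-admissible : ∀ ℓ {m} (π : Vec (Fin m) m) (b : Vec Carrier m) →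
    length (admissibleA ℓ π (column b)) ≡ frames (length (orthogonal (permute b π))) ℓ
  length-admissible ℓ {m} π b = trans (sym (Σ-one (admissibleA ℓ π (column b)))) (trans (Σ-admissible ℓ π b (λ _ → 1))
    (trans (Σ-cong (allVecs (vectors m) ℓ) (λ A → cong (𝟙 (linIndep? A) ℕ.*_) (ℕ.*-identityʳ (𝟙 (solves? A (permute b π))))))
      (solutions-count ℓ (permute b π))))

  admissible>0 : ∀ {ℓ m} → ℓ < m → (π : Vec (Fin m) m) → IsPerm π → (b : Vec Carrier m) → b ≢ 0⃗ →
    0 < length (admissibleA ℓ π (column b))
  admissible>0 {ℓ} ℓ<m π perm b b≢0 = subst (0 <_) (sym (length-admissible ℓ π b))
    (frames>0 ℓ ℓ<m (length-orthogonal (permute-nonzero b π perm b≢0)))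

  -- The mean of `Nsol` over A, equal to m! p + (1 - p) N₁, cleared of denominators; here 1 - p is
  -- (q^m - q^(m-ℓ)) / (q^m - q).
  Σ-Nsol : ∀ {ℓ m} → ℓ < m → (π : Vec (Fin m) m) → IsPerm π → (b : Vec Carrier m) → b ≢ 0⃗ →
    Σ[ A ∈ admissibleA ℓ π (column b) ] Nsol A (column b) ℕ.* (size ℕ.^ m ∸ size) ≡
    length (admissibleA ℓ π (column b)) ℕ.*
      (proportional π b ℕ.* (size ℕ.^ m ∸ size ℕ.^ (m ∸ ℓ)) ℕ.+ m ! ℕ.* (size ℕ.^ (m ∸ ℓ) ∸ size))
  Σ-Nsol {ℓ} {m} ℓ<m π perm b b≢0 = begin
    Σ[ A ∈ admissibleA ℓ π (column b) ] Nsol A (column b) ℕ.* P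
      ≡⟨ cong (ℕ._* P) (Σ-admissible ℓ π b (λ A → Nsol A (column b))) ⟩
    Σ[ A ∈ mats ] (𝟙 (linIndep? A) ℕ.* (𝟙 (solves? A v) ℕ.* Nsol A (column b))) ℕ.* P
      ≡⟨ cong (ℕ._* P) (Σ-cong mats distribute) ⟩
    Σ[ A ∈ mats ] Σ[ ρ ∈ Sym m ] (𝟙 (linIndep? A) ℕ.* (𝟙 (solves? A v) ℕ.* 𝟙 (solves? A (permute b ρ)))) ℕ.* P
      ≡⟨ cong (ℕ._* P) (Σ-swap mats (Sym m) _) ⟩
    Σ[ ρ ∈ Sym m ] Σ[ A ∈ mats ] (𝟙 (linIndep? A) ℕ.* (𝟙 (solves? A v) ℕ.* 𝟙 (solves? A (permute b ρ)))) ℕ.* P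
      ≡⟨ Σ-*ʳ (Sym m) P _ ⟨
    Σ[ ρ ∈ Sym m ] (Σ[ A ∈ mats ] (𝟙 (linIndep? A) ℕ.* (𝟙 (solves? A v) ℕ.* 𝟙 (solves? A (permute b ρ)))) ℕ.* P)
      ≡⟨ Σ-cong-∈ (Sym m) (λ ρ ρ∈ → common-solutions-weight ℓ<m (permute-nonzero b π perm b≢0) (permute-nonzero b ρ (∈-Sym⁻ ρ∈) b≢0)) ⟩
    Σ[ ρ ∈ Sym m ] (N ℕ.* (multiples v (permute b ρ) ℕ.* X ℕ.+ Y))
      ≡⟨ Σ-*ˡ (Sym m) N _ ⟩
    N ℕ.* Σ[ ρ ∈ Sym m ] (multiples v (permute b ρ) ℕ.* X ℕ.+ Y)
      ≡⟨ cong₂ ℕ._*_ (sym (length-admissible ℓ π b)) (trans (Σ-+ (Sym m) _ _)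
           (cong₂ ℕ._+_ (Σ-*ʳ (Sym m) X _) (trans (Σ-const (Sym m) Y) (cong (ℕ._* Y) (length-Sym m))))) ⟩
    length (admissibleA ℓ π (column b)) ℕ.* (proportional π b ℕ.* X ℕ.+ m ! ℕ.* Y) ∎
    where
    v = permute b π
    mats = allVecs (vectors m) ℓ
    N = frames (length (orthogonal v)) ℓ
    P = size ℕ.^ m ∸ size
    X = size ℕ.^ m ∸ size ℕ.^ (m ∸ ℓ)
    Y = size ℕ.^ (m ∸ ℓ) ∸ size
    Nsol≡ : ∀ A → Nsol A (column b) ≡ Σ[ ρ ∈ Sym m ] 𝟙 (solves? A (permute b ρ))
    Nsol≡ A = trans (length-filter (λ ρ → ((A ⊗ permMat ρ) ⊗ column b) ≟M 𝟎) (Sym m)) (Σ-cong (Sym m) (λ ρ → 𝟙-solves A ρ b))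
    distribute : ∀ A → 𝟙 (linIndep? A) ℕ.* (𝟙 (solves? A v) ℕ.* Nsol A (column b)) ≡
      Σ[ ρ ∈ Sym m ] (𝟙 (linIndep? A) ℕ.* (𝟙 (solves? A v) ℕ.* 𝟙 (solves? A (permute b ρ))))
    distribute A = sym (trans (Σ-*ˡ (Sym m) (𝟙 (linIndep? A)) _) (cong (𝟙 (linIndep? A) ℕ.*_)
      (trans (Σ-*ˡ (Sym m) (𝟙 (solves? A v)) _) (cong (𝟙 (solves? A v) ℕ.*_) (sym (Nsol≡ A))))))

  -- The alphabet F listed as 0, g⁰, g¹, …, gⁿ⁻¹, on which multiplication by gᵃ acts as a shift.
  letter : Fin (suc n) → Carrier
  letter zero = 0#
  letter (suc i) = gen ^ toℕ i

  letter-injective : ∀ {x y} → letter x ≡ letter y → x ≡ y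
  letter-injective {zero} {zero} _ = refl
  letter-injective {zero} {suc y} eq = contradiction (sym eq) (^-nonzero gen≢0 (toℕ y))
  letter-injective {suc x} {zero} eq = contradiction eq (^-nonzero gen≢0 (toℕ x))
  letter-injective {suc x} {suc y} eq = cong suc (Fin.toℕ-injective (gen^-injective (Fin.toℕ<n x) (Fin.toℕ<n y) eq))

  elements-↭-letters : elements ↭ map letter (allFin (suc n))
  elements-↭-letters = sameMembers⇒↭ unique letters-unique
    (⊆∧length≤⇒⊇ _≟_ unique letters-unique (λ _ → complete _)
      (ℕ.≤-reflexive (trans size≡1+n (sym (trans (List.length-map letter (allFin (suc n))) (List.length-tabulate id))))))
    (λ _ → complete _)
    where
    letters-unique : Unique (map letter (allFin (suc n)))
    letters-unique = Unique.map⁺ letter-injective (Unique.allFin⁺ (suc n))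

  letter-shift : ∀ a x → gen ^ a * letter x ≡ letter (shift n a x)
  letter-shift a zero = zeroʳ (gen ^ a)
  letter-shift a (suc i) = begin
    gen ^ a * gen ^ toℕ i                       ≡⟨ ^-homo-* gen a (toℕ i) ⟨
    gen ^ (a ℕ.+ toℕ i)                         ≡⟨ gen^% (a ℕ.+ toℕ i) ⟨
    gen ^ ((a ℕ.+ toℕ i) % n)                   ≡⟨ cong (gen ^_) (toℕ-modFin (a ℕ.+ toℕ i) n) ⟨
    gen ^ toℕ (modFin (a ℕ.+ toℕ i) n)          ∎

  shift-injective : ∀ a {x y} → shift n a x ≡ shift n a y → x ≡ y
  shift-injective a {x} {y} eq = letter-injective (*-cancelˡ (^-nonzero gen≢0 a)
    (trans (letter-shift a x) (trans (cong letter eq) (sym (letter-shift a y)))))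

  ∙-letters : ∀ {m} a (u : Vec (Fin (suc n)) m) → gen ^ a ∙ Vec.map letter u ≡ Vec.map letter (Vec.map (shift n a) u)
  ∙-letters a [] = refl
  ∙-letters a (x ∷ u) = cong₂ _∷_ (letter-shift a x) (∙-letters a u)

  -- Extended by 0 at d = 0, where the quotients are undefined, to be a function of `cogcd`;
  -- `cogcd>0` ensures that this value is never taken.
  summand : ℕ → ℕ → ℕ
  summand m zero = 0
  summand m (suc k) = ((n ℕ.+ m) / suc k) C (m / suc k)

  Σ-summand : ∀ m → Σ[ a ∈ range₁ n ] summand m (cogcd n a) ≡ divisorSum size m
  Σ-summand m = trans (Σ-cogcd n (summand m)) (trans (Σ-divisors n (λ d → φ d ℕ.* summand m d))
    -- With q in the form `suc n`, the expressions q + m ∸ 1 and q ∸ 1 of `divisorSum` reduce to n +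
    -- m and n.
    (cong (λ q → divisorSum q m) (sym size≡1+n)))

  shift-invariant-count′ : ∀ a m → Σ[ μ ∈ compositions (suc n) m ] 𝟙 (invariant? (shift n a) μ) ≡ summand m (cogcd n a)
  shift-invariant-count′ a m with cogcd n a | cogcd>0 n a | cogcd*gcd n a
  ... | suc k | _ | eq = shift-invariant-count n a (suc k) (sym eq) m

  fixed-multiple-count : ∀ {m} (π : Vec (Fin m) m) → IsPerm π → ∀ a →
    Σ[ b ∈ vectors m ] Σ[ ρ ∈ Sym m ] 𝟙 (permute b ρ ≟⃗ gen ^ a ∙ permute b π) ≡ m ! ℕ.* summand m (cogcd n a)
  fixed-multiple-count {m} π perm a = begin
    Σ[ b ∈ vectors m ] Σ[ ρ ∈ Sym m ] 𝟙 (permute b ρ ≟⃗ gen ^ a ∙ permute b π)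
      ≡⟨ Σ-allVecs-↭ elements-↭-letters m _ ⟩
    Σ[ b ∈ allVecs (map letter (allFin (suc n))) m ] Σ[ ρ ∈ Sym m ] 𝟙 (permute b ρ ≟⃗ gen ^ a ∙ permute b π)
      ≡⟨ Σ-allVecs-map letter (allFin (suc n)) m _ ⟩
    Σ[ w ∈ allVecs (allFin (suc n)) m ] Σ[ ρ ∈ Sym m ] 𝟙 (permute (Vec.map letter w) ρ ≟⃗ gen ^ a ∙ permute (Vec.map letter w) π)
      ≡⟨ Σ-cong (allVecs (allFin (suc n)) m) (λ w → trans (Σ-cong (Sym m) (translate w)) (Σ-Sym m _)) ⟩
    Σ[ w ∈ allVecs (allFin (suc n)) m ] embeddings w (Vec.map (shift n a) (permute w π))
      ≡⟨ Σ-embeddings (shift n a) (shift-injective a) π (injective⇒unique π perm) ⟩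
    m ! ℕ.* Σ[ μ ∈ compositions (suc n) m ] 𝟙 (invariant? (shift n a) μ)
      ≡⟨ cong (m ! ℕ.*_) (shift-invariant-count′ a m) ⟩
    m ! ℕ.* summand m (cogcd n a) ∎
    where
    translate : ∀ w ρ → 𝟙 (permute (Vec.map letter w) ρ ≟⃗ gen ^ a ∙ permute (Vec.map letter w) π) ≡
                        𝟙 (permute w ρ ≟ᵥ Vec.map (shift n a) (permute w π))
    translate w ρ = 𝟙-cong (permute (Vec.map letter w) ρ ≟⃗ gen ^ a ∙ permute (Vec.map letter w) π)
        (permute w ρ ≟ᵥ Vec.map (shift n a) (permute w π))
        (λ eq → map-injective letter-injective (trans (sym (permute-map letter w ρ)) (trans eq rhs≡)))
        (λ eq → trans (permute-map letter w ρ) (trans (cong (Vec.map letter) eq) (sym rhs≡)))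
      where
      rhs≡ : gen ^ a ∙ permute (Vec.map letter w) π ≡ Vec.map letter (Vec.map (shift n a) (permute w π))
      rhs≡ = trans (cong (gen ^ a ∙_) (permute-map letter w π)) (∙-letters a (permute w π))

  Σ-proportional : ∀ {m} (π : Vec (Fin m) m) → IsPerm π → Σ[ b ∈ vectors m ] proportional π b ≡ m ! ℕ.* divisorSum size m
  Σ-proportional {m} π perm = begin
    Σ[ b ∈ vectors m ] Σ[ ρ ∈ Sym m ] Σ[ c ∈ units ] t b ρ c
      ≡⟨ Σ-cong (vectors m) (λ b → Σ-swap (Sym m) units (t b)) ⟩
    Σ[ b ∈ vectors m ] Σ[ c ∈ units ] Σ[ ρ ∈ Sym m ] t b ρ c
      ≡⟨ Σ-swap (vectors m) units _ ⟩
    Σ[ c ∈ units ] Σ[ b ∈ vectors m ] Σ[ ρ ∈ Sym m ] t b ρ c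
      ≡⟨ trans (Σ-↭ _ units-↭) (Σ-map (gen ^_) (range₁ n) _) ⟩
    Σ[ a ∈ range₁ n ] Σ[ b ∈ vectors m ] Σ[ ρ ∈ Sym m ] t b ρ (gen ^ a)
      ≡⟨ Σ-cong (range₁ n) (fixed-multiple-count π perm) ⟩
    Σ[ a ∈ range₁ n ] (m ! ℕ.* summand m (cogcd n a))
      ≡⟨ Σ-*ˡ (range₁ n) (m !) _ ⟩
    m ! ℕ.* Σ[ a ∈ range₁ n ] summand m (cogcd n a)
      ≡⟨ cong (m ! ℕ.*_) (Σ-summand m) ⟩
    m ! ℕ.* divisorSum size m ∎
    where
    t : Vec Carrier m → Vec (Fin m) m → Carrier → ℕ
    t b ρ c = 𝟙 (permute b ρ ≟⃗ c ∙ permute b π)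

  proportional-0⃗ : ∀ {m} (π : Vec (Fin m) m) → proportional π 0⃗ ≡ m ! ℕ.* n
  proportional-0⃗ {m} π = begin
    Σ[ ρ ∈ Sym m ] Σ[ c ∈ units ] 𝟙 (permute 0⃗ ρ ≟⃗ c ∙ permute 0⃗ π)
      ≡⟨ Σ-cong (Sym m) (λ ρ → trans (Σ-cong units (λ c → 𝟙-yes (permute 0⃗ ρ ≟⃗ c ∙ permute 0⃗ π)
           (trans (permute-0⃗ ρ) (sym (trans (cong (c ∙_) (permute-0⃗ π)) (∙0⃗ c)))))) (Σ-one units)) ⟩
    Σ[ _ ∈ Sym m ] n
      ≡⟨ trans (Σ-const (Sym m) n) (cong (ℕ._* n) (length-Sym m)) ⟩
    m ! ℕ.* n ∎
    where
    permute-0⃗ : (ρ : Vec (Fin m) m) → permute 0⃗ ρ ≡ 0⃗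
    permute-0⃗ ρ = lookup-ext λ i → trans (lookup-permute 0⃗ ρ i) (trans (lookup-replicate (lookup ρ i) 0#) (sym (lookup-replicate i 0#)))

  -- Nonzero vectors as the columns of rank one

  Σ-vectors : ∀ {m} (f : Vec Carrier m → ℕ) → Σₗ (vectors m) f ≡ f 0⃗ ℕ.+ Σ[ b ∈ vectors m ] (𝟙 (¬? (b ≟⃗ 0⃗)) ℕ.* f b)
  Σ-vectors {m} f = begin
    Σₗ (vectors m) f
      ≡⟨ Σ-cong (vectors m) split ⟩
    Σ[ b ∈ vectors m ] (𝟙 (0⃗ ≟⃗ b) ℕ.* f b ℕ.+ 𝟙 (¬? (b ≟⃗ 0⃗)) ℕ.* f b)
      ≡⟨ Σ-+ (vectors m) _ _ ⟩
    Σ[ b ∈ vectors m ] (𝟙 (0⃗ ≟⃗ b) ℕ.* f b) ℕ.+ Σ[ b ∈ vectors m ] (𝟙 (¬? (b ≟⃗ 0⃗)) ℕ.* f b)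
      ≡⟨ cong (ℕ._+ Σ[ b ∈ vectors m ] (𝟙 (¬? (b ≟⃗ 0⃗)) ℕ.* f b)) (Σ-point _≟⃗_ (vectors-unique m) (∈-vectors 0⃗) f) ⟩
    f 0⃗ ℕ.+ Σ[ b ∈ vectors m ] (𝟙 (¬? (b ≟⃗ 0⃗)) ℕ.* f b) ∎
    where
    split : ∀ b → f b ≡ 𝟙 (0⃗ ≟⃗ b) ℕ.* f b ℕ.+ 𝟙 (¬? (b ≟⃗ 0⃗)) ℕ.* f b
    split b with b ≟⃗ 0⃗
    ... | yes b≡0 = sym (trans (ℕ.+-identityʳ _) (trans (cong (ℕ._* f b) (𝟙-yes (0⃗ ≟⃗ b) (sym b≡0))) (ℕ.*-identityˡ (f b))))
    ... | no b≢0 = sym (trans (cong (λ x → x ℕ.* f b ℕ.+ 1 ℕ.* f b) (𝟙-no (0⃗ ≟⃗ b) (b≢0 ∘ sym))) (ℕ.*-identityˡ (f b)))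

  allVecs-1 : ∀ {A : Set} (xs : List A) → allVecs xs 1 ≡ map (_∷ []) xs
  allVecs-1 [] = refl
  allVecs-1 (x ∷ xs) = cong ((x ∷ []) ∷_) (allVecs-1 xs)

  uncolumn : ∀ {m} → Mat m 1 → Vec Carrier m
  uncolumn = Vec.map Vec.head

  column-uncolumn : ∀ {m} (B : Mat m 1) → column (uncolumn B) ≡ B
  column-uncolumn [] = refl
  column-uncolumn ((x ∷ []) ∷ B) = cong ((x ∷ []) ∷_) (column-uncolumn B)

  uncolumn-column : ∀ {m} (b : Vec Carrier m) → uncolumn (column b) ≡ b
  uncolumn-column [] = refl
  uncolumn-column (x ∷ b) = cong (x ∷_) (uncolumn-column b)

  ∈-matsOfRank1⁻ : ∀ {m} {B : Mat m 1} → B ∈ matsOfRank m 1 1 → uncolumn B ≢ 0⃗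
  ∈-matsOfRank1⁻ {m} {B} B∈ = hasRank1⇒≢0⃗ (uncolumn B) (subst (λ B → HasRank B 1) (sym (column-uncolumn B))
    (proj₂ (∈-filter⁻ (λ B → hasRank? B 1) {xs = allVecs (allVecs elements 1) m} B∈)))

  Σ-matsOfRank1 : ∀ m (f : Vec Carrier m → ℕ) →
    f 0⃗ ℕ.+ Σ[ B ∈ matsOfRank m 1 1 ] f (uncolumn B) ≡ Σₗ (vectors m) f
  Σ-matsOfRank1 m f = sym (trans (Σ-vectors f) (cong (f 0⃗ ℕ.+_) (sym (begin
    Σ[ B ∈ matsOfRank m 1 1 ] f (uncolumn B)
      ≡⟨ Σ-filter (λ B → hasRank? B 1) (allVecs (allVecs elements 1) m) _ ⟩
    Σ[ B ∈ allVecs (allVecs elements 1) m ] (𝟙 (hasRank? B 1) ℕ.* f (uncolumn B))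
      ≡⟨ trans (cong (λ xs → Σ[ B ∈ allVecs xs m ] (𝟙 (hasRank? B 1) ℕ.* f (uncolumn B))) (allVecs-1 elements)) (Σ-allVecs-map (_∷ []) elements m _) ⟩
    Σ[ b ∈ vectors m ] (𝟙 (hasRank? (column b) 1) ℕ.* f (uncolumn (column b)))
      ≡⟨ Σ-cong (vectors m) (λ b → cong₂ ℕ._*_
           (𝟙-cong (hasRank? (column b) 1) (¬? (b ≟⃗ 0⃗)) (hasRank1⇒≢0⃗ b) (≢0⃗⇒hasRank1 b)) (cong f (uncolumn-column b))) ⟩
    Σ[ b ∈ vectors m ] (𝟙 (¬? (b ≟⃗ 0⃗)) ℕ.* f b) ∎))))

  length-matsOfRank1 : ∀ m → 1 ℕ.+ length (matsOfRank m 1 1) ≡ size ℕ.^ m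
  length-matsOfRank1 m = trans (cong suc (sym (Σ-one (matsOfRank m 1 1)))) (trans (Σ-matsOfRank1 m (λ _ → 1))
    (trans (Σ-one (vectors m)) (length-allVecs elements m)))

  Σ-proportional-rank1 : ∀ {m} (π : Vec (Fin m) m) → IsPerm π →
    m ! ℕ.* n ℕ.+ Σ[ B ∈ matsOfRank m 1 1 ] proportional π (uncolumn B) ≡ m ! ℕ.* divisorSum size m
  Σ-proportional-rank1 {m} π perm = trans (cong (ℕ._+ Σ[ B ∈ matsOfRank m 1 1 ] proportional π (uncolumn B)) (sym (proportional-0⃗ π)))
    (trans (Σ-matsOfRank1 m (proportional π)) (Σ-proportional π perm))

-- Averages

ℕ→ℚ-+ : ∀ a b → ℕ→ℚ (a ℕ.+ b) ≡ ℕ→ℚ a ℚ.+ ℕ→ℚ b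
ℕ→ℚ-+ a b = ℚ.toℚᵘ-injective (begin
  ℚ.toℚᵘ (ℕ→ℚ (a ℕ.+ b))                   ≈⟨ ℚ.toℚᵘ-fromℚᵘ (mkℚᵘ (ℤ.+ (a ℕ.+ b)) 0) ⟩
  mkℚᵘ (ℤ.+ (a ℕ.+ b)) 0                     ≡⟨ cong₂ (λ x y → mkℚᵘ (x ℤ.+ y) 0) (ℤ.*-identityʳ (ℤ.+ a)) (ℤ.*-identityʳ (ℤ.+ b)) ⟨
  mkℚᵘ (ℤ.+ a) 0 ℚᵘ.+ mkℚᵘ (ℤ.+ b) 0           ≈⟨ ℚᵘ.+-cong (ℚ.toℚᵘ-fromℚᵘ (mkℚᵘ (ℤ.+ a) 0)) (ℚ.toℚᵘ-fromℚᵘ (mkℚᵘ (ℤ.+ b) 0)) ⟨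
  ℚ.toℚᵘ (ℕ→ℚ a) ℚᵘ.+ ℚ.toℚᵘ (ℕ→ℚ b)       ≈⟨ ℚ.toℚᵘ-homo-+ (ℕ→ℚ a) (ℕ→ℚ b) ⟨
  ℚ.toℚᵘ (ℕ→ℚ a ℚ.+ ℕ→ℚ b)                 ∎)
  where open ℚᵘ.≃-Reasoning

ℕ→ℚ-* : ∀ a b → ℕ→ℚ (a ℕ.* b) ≡ ℕ→ℚ a ℚ.* ℕ→ℚ b
ℕ→ℚ-* a b = ℚ.toℚᵘ-injective (begin
  ℚ.toℚᵘ (ℕ→ℚ (a ℕ.* b))                   ≈⟨ ℚ.toℚᵘ-fromℚᵘ (mkℚᵘ (ℤ.+ (a ℕ.* b)) 0) ⟩
  mkℚᵘ (ℤ.+ (a ℕ.* b)) 0                     ≡⟨ cong (λ x → mkℚᵘ x 0) (ℤ.pos-* a b) ⟩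
  mkℚᵘ (ℤ.+ a) 0 ℚᵘ.* mkℚᵘ (ℤ.+ b) 0           ≈⟨ ℚᵘ.*-cong (ℚ.toℚᵘ-fromℚᵘ (mkℚᵘ (ℤ.+ a) 0)) (ℚ.toℚᵘ-fromℚᵘ (mkℚᵘ (ℤ.+ b) 0)) ⟨
  ℚ.toℚᵘ (ℕ→ℚ a) ℚᵘ.* ℚ.toℚᵘ (ℕ→ℚ b)       ≈⟨ ℚ.toℚᵘ-homo-* (ℕ→ℚ a) (ℕ→ℚ b) ⟨
  ℚ.toℚᵘ (ℕ→ℚ a ℚ.* ℕ→ℚ b)                 ∎)
  where open ℚᵘ.≃-Reasoning

ℕ→ℚ-subtract : ∀ a b {c} → a ℕ.+ b ≡ c → ℕ→ℚ b ≡ ℕ→ℚ c ℚ.- ℕ→ℚ a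
ℕ→ℚ-subtract a b refl = trans (solve 2 (λ x y → y := (x :+ y) :- x) refl (ℕ→ℚ a) (ℕ→ℚ b)) (cong (ℚ._- ℕ→ℚ a) (sym (ℕ→ℚ-+ a b)))
  where open ℚSolver.+-*-Solver

ℕ→ℚ-∸ : ∀ a b → b ≤ a → ℕ→ℚ (a ∸ b) ≡ ℕ→ℚ a ℚ.- ℕ→ℚ b
ℕ→ℚ-∸ a b b≤a = ℕ→ℚ-subtract b (a ∸ b) (ℕ.m+[n∸m]≡n b≤a)

ℕ→ℚ≢0 : ∀ a → 0 < a → ℕ→ℚ a ≢ 0ℚ
ℕ→ℚ≢0 (suc a) _ eq with *≡* e ← ℚ.fromℚᵘ-injective {mkℚᵘ (ℤ.+ suc a) 0} {mkℚᵘ (ℤ.+ 0) 0} eq with () ← e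

[1/n]*n≡1 : ∀ n → (ℤ.+ 1 ℚ./ suc n) ℚ.* ℕ→ℚ (suc n) ≡ 1ℚ
[1/n]*n≡1 n = ℚ.toℚᵘ-injective (begin
  ℚ.toℚᵘ ((ℤ.+ 1 ℚ./ suc n) ℚ.* ℕ→ℚ (suc n))                 ≈⟨ ℚ.toℚᵘ-homo-* (ℤ.+ 1 ℚ./ suc n) (ℕ→ℚ (suc n)) ⟩
  ℚ.toℚᵘ (ℤ.+ 1 ℚ./ suc n) ℚᵘ.* ℚ.toℚᵘ (ℕ→ℚ (suc n))         ≈⟨ ℚᵘ.*-cong (ℚ.toℚᵘ-fromℚᵘ (mkℚᵘ (ℤ.+ 1) n)) (ℚ.toℚᵘ-fromℚᵘ (mkℚᵘ (ℤ.+ suc n) 0)) ⟩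
  mkℚᵘ (ℤ.+ 1) n ℚᵘ.* mkℚᵘ (ℤ.+ suc n) 0                       ≈⟨ ℚᵘ.*-inverseˡ (mkℚᵘ (ℤ.+ suc n) 0) ⟩
  ℚᵘ.1ℚᵘ                                                   ∎)
  where open ℚᵘ.≃-Reasoning

*-cancelʳ-≢0 : ∀ {p q r} → r ≢ 0ℚ → p ℚ.* r ≡ q ℚ.* r → p ≡ q
*-cancelʳ-≢0 {p} {q} {r} r≢0 eq = trans (expand p) (trans (cong (ℚ._* (ℚ.1/ r)) eq) (sym (expand q)))
  where
  instance _ = ℚ.≢-nonZero r≢0
  expand : ∀ p → p ≡ p ℚ.* r ℚ.* (ℚ.1/ r)
  expand p = sym (trans (ℚ.*-assoc p r (ℚ.1/ r)) (trans (cong (p ℚ.*_) (ℚ.*-inverseʳ r)) (ℚ.*-identityʳ p)))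

*-≢0 : ∀ {p q} → p ≢ 0ℚ → q ≢ 0ℚ → p ℚ.* q ≢ 0ℚ
*-≢0 {p} {q} p≢0 q≢0 eq = p≢0 (*-cancelʳ-≢0 q≢0 (trans eq (sym (ℚ.*-zeroˡ q))))

÷₀-* : ∀ p {r} → r ≢ 0ℚ → (p ÷₀ r) ℚ.* r ≡ p
÷₀-* p {r} r≢0 with r ℚ.≟ 0ℚ
... | yes r≡0 = contradiction r≡0 r≢0
... | no r≢0′ = trans (ℚ.*-assoc p (ℚ.1/ r) r) (trans (cong (p ℚ.*_) (ℚ.*-inverseˡ r)) (ℚ.*-identityʳ p))
  where instance _ = ℚ.≢-nonZero r≢0′

module _ {A : Set} where

  avg-*-length : (xs : List A) (f : A → ℚ) → avg xs f ℚ.* ℕ→ℚ (length xs) ≡ sumℚ (map f xs)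
  avg-*-length [] f = refl
  avg-*-length (x ∷ xs) f = trans (ℚ.*-assoc (sumℚ (map f (x ∷ xs))) (ℤ.+ 1 ℚ./ suc (length xs)) (ℕ→ℚ (suc (length xs))))
    (trans (cong (sumℚ (map f (x ∷ xs)) ℚ.*_) ([1/n]*n≡1 (length xs))) (ℚ.*-identityʳ _))

  sumℚ-scaled : (xs : List A) {f : A → ℚ} {c : ℚ} {g : A → ℕ} → (∀ x → x ∈ xs → f x ℚ.* c ≡ ℕ→ℚ (g x)) →
    sumℚ (map f xs) ℚ.* c ≡ ℕ→ℚ (Σₗ xs g)
  sumℚ-scaled [] {c = c} _ = ℚ.*-zeroˡ c
  sumℚ-scaled (x ∷ xs) {f} {c} {g} eq = trans (ℚ.*-distribʳ-+ c (f x) _)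
    (trans (cong₂ ℚ._+_ (eq x (here refl)) (sumℚ-scaled xs (λ y → eq y ∘ there))) (sym (ℕ→ℚ-+ (g x) _)))

  -- Here c is a common denominator of the values of f. With it the sum is a natural number, and the
  -- counts made in ℕ apply.
  avg-scaled : (xs : List A) {f : A → ℚ} {c : ℚ} {g : A → ℕ} → (∀ x → x ∈ xs → f x ℚ.* c ≡ ℕ→ℚ (g x)) →
    avg xs f ℚ.* c ℚ.* ℕ→ℚ (length xs) ≡ ℕ→ℚ (Σₗ xs g)
  avg-scaled xs {f} {c} eq = trans
    (solve 3 (λ a c l → a :* c :* l := a :* l :* c) refl (avg xs f) c (ℕ→ℚ (length xs)))
    (trans (cong (ℚ._* c) (avg-*-length xs f)) (sumℚ-scaled xs eq))
    where open ℚSolver.+-*-Solver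

  avg-constant : (xs : List A) → 0 < length xs → {f : A → ℚ} {c : ℚ} {k : ℕ} → (∀ x → x ∈ xs → f x ℚ.* c ≡ ℕ→ℚ k) →
    avg xs f ℚ.* c ≡ ℕ→ℚ k
  avg-constant xs nonempty {f} {c} {k} eq = *-cancelʳ-≢0 (ℕ→ℚ≢0 (length xs) nonempty) (trans (avg-scaled xs {g = λ _ → k} eq)
    (trans (cong ℕ→ℚ (trans (Σ-const xs k) (ℕ.*-comm (length xs) k))) (ℕ→ℚ-* k (length xs))))

-- The expectation as a rational number

module Expectation (F : FiniteField) (ℓ m : ℕ) (0<ℓ : 0 < ℓ) (ℓ<m : ℓ < m) where
  open Units F using (n; size≡1+n)
  open Counting F using (column; 1<size; size≢0)
  open Assembly F
  open FiniteField F using (size)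
  open LinAlg F
  open ≡-Reasoning

  -- In these terms p = Y / P and 1 - p = X / P, while S is the total of `proportional π` over the
  -- columns of rank one, the same for every permutation π.
  P X Y S : ℕ
  P = size ℕ.^ m ∸ size
  X = size ℕ.^ m ∸ size ℕ.^ (m ∸ ℓ)
  Y = size ℕ.^ (m ∸ ℓ) ∸ size
  S = m ! ℕ.* divisorSum size m ∸ m ! ℕ.* n

  weight : Vec (Fin m) m → Mat m 1 → ℕ
  weight π B = proportional π (uncolumn B) ℕ.* X ℕ.+ m ! ℕ.* Y

  meanA : Vec (Fin m) m → Mat m 1 → ℚ
  meanA π B = avg (admissibleA ℓ π B) (λ A → ℕ→ℚ (Nsol A B))

  expectation-A : ∀ π → IsPerm π → ∀ B → B ∈ matsOfRank m 1 1 →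
    meanA π B ℚ.* ℕ→ℚ P ≡ ℕ→ℚ (weight π B)
  expectation-A π perm B B∈ = subst (λ B′ → meanA π B′ ℚ.* ℕ→ℚ P ≡ ℕ→ℚ (weight π B)) (column-uncolumn B)
    (*-cancelʳ-≢0 (ℕ→ℚ≢0 (length adm) (admissible>0 ℓ<m π perm b b≢0)) (begin
      avg adm (λ A → ℕ→ℚ (Nsol A (column b))) ℚ.* ℕ→ℚ P ℚ.* ℕ→ℚ (length adm)
        ≡⟨ avg-scaled adm (λ A _ → sym (ℕ→ℚ-* (Nsol A (column b)) P)) ⟩
      ℕ→ℚ (Σ[ A ∈ adm ] (Nsol A (column b) ℕ.* P))
        ≡⟨ cong ℕ→ℚ (trans (Σ-*ʳ adm P _) (trans (Σ-Nsol ℓ<m π perm b b≢0) (ℕ.*-comm (length adm) _))) ⟩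
      ℕ→ℚ (weight π B ℕ.* length adm)
        ≡⟨ ℕ→ℚ-* (weight π B) (length adm) ⟩
      ℕ→ℚ (weight π B) ℚ.* ℕ→ℚ (length adm) ∎))
    where
    b = uncolumn B
    b≢0 = ∈-matsOfRank1⁻ {B = B} B∈
    adm = admissibleA ℓ π (column b)

  Σ-weight : ∀ π → IsPerm π → Σₗ (matsOfRank m 1 1) (weight π) ≡ S ℕ.* X ℕ.+ length (matsOfRank m 1 1) ℕ.* (m ! ℕ.* Y)
  Σ-weight π perm = begin
    Σₗ (matsOfRank m 1 1) (weight π)
      ≡⟨ Σ-+ (matsOfRank m 1 1) _ _ ⟩
    Σ[ B ∈ matsOfRank m 1 1 ] (proportional π (uncolumn B) ℕ.* X) ℕ.+ Σ[ _ ∈ matsOfRank m 1 1 ] (m ! ℕ.* Y)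
      ≡⟨ cong₂ ℕ._+_ (Σ-*ʳ (matsOfRank m 1 1) X _) (Σ-const (matsOfRank m 1 1) (m ! ℕ.* Y)) ⟩
    Σ[ B ∈ matsOfRank m 1 1 ] proportional π (uncolumn B) ℕ.* X ℕ.+ length (matsOfRank m 1 1) ℕ.* (m ! ℕ.* Y)
      ≡⟨ cong (λ s → s ℕ.* X ℕ.+ length (matsOfRank m 1 1) ℕ.* (m ! ℕ.* Y))
           (trans (sym (ℕ.m+n∸m≡n (m ! ℕ.* n) _)) (cong (_∸ m ! ℕ.* n) (Σ-proportional-rank1 π perm))) ⟩
    S ℕ.* X ℕ.+ length (matsOfRank m 1 1) ℕ.* (m ! ℕ.* Y) ∎

  L : ℕ
  L = length (matsOfRank m 1 1)

  expectation : expectedNsol ℓ m ℚ.* (ℕ→ℚ P ℚ.* ℕ→ℚ L) ≡ ℕ→ℚ (S ℕ.* X ℕ.+ L ℕ.* (m ! ℕ.* Y))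
  -- The value found in `Σ-weight` does not involve π, so the average over `Sym m` is that of a
  -- constant.
  expectation = avg-constant (Sym m) (subst (0 <_) (sym (length-Sym m)) (ℕ.1≤n! m)) {k = S ℕ.* X ℕ.+ L ℕ.* (m ! ℕ.* Y)} λ π π∈ →
    trans (sym (ℚ.*-assoc (avg (matsOfRank m 1 1) (meanA π)) (ℕ→ℚ P) (ℕ→ℚ L)))
      (trans (avg-scaled (matsOfRank m 1 1) {meanA π} {ℕ→ℚ P} {weight π} (expectation-A π (∈-Sym⁻ π∈))) (cong ℕ→ℚ (Σ-weight π (∈-Sym⁻ π∈))))

  -- The bounds on ℓ exclude m = 1, for which the denominator q^m - q would vanish.
  1<m : 1 < m
  1<m = ℕ.≤-<-trans 0<ℓ ℓ<m

  q<q^m : size < size ℕ.^ m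
  q<q^m = subst (_< size ℕ.^ m) (ℕ.^-identityʳ size) (ℕ.^-monoʳ-< size 1<size 1<m)

  q≤q^[m∸ℓ] : size ≤ size ℕ.^ (m ∸ ℓ)
  q≤q^[m∸ℓ] = subst (_≤ size ℕ.^ (m ∸ ℓ)) (ℕ.^-identityʳ size) (ℕ.^-monoʳ-≤ size (ℕ.m<n⇒0<n∸m ℓ<m))

  Q Qₗ q f D : ℚ
  Q = ℕ→ℚ (size ℕ.^ m)
  Qₗ = ℕ→ℚ (size ℕ.^ (m ∸ ℓ))
  q = ℕ→ℚ size
  f = ℕ→ℚ (m !)
  D = ℕ→ℚ (divisorSum size m)

  P≡ : ℕ→ℚ P ≡ Q ℚ.- q
  P≡ = ℕ→ℚ-∸ (size ℕ.^ m) size (ℕ.<⇒≤ q<q^m)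

  X≡ : ℕ→ℚ X ≡ Q ℚ.- Qₗ
  X≡ = ℕ→ℚ-∸ (size ℕ.^ m) (size ℕ.^ (m ∸ ℓ)) (ℕ.^-monoʳ-≤ size (ℕ.m∸n≤m m ℓ))

  Y≡ : ℕ→ℚ Y ≡ Qₗ ℚ.- q
  Y≡ = ℕ→ℚ-∸ (size ℕ.^ (m ∸ ℓ)) size q≤q^[m∸ℓ]

  L≡ : ℕ→ℚ L ≡ Q ℚ.- ℕ→ℚ 1
  L≡ = ℕ→ℚ-subtract 1 L (length-matsOfRank1 m)

  S≡ : ℕ→ℚ S ≡ f ℚ.* D ℚ.- f ℚ.* (q ℚ.- ℕ→ℚ 1)
  S≡ = trans (ℕ→ℚ-∸ (m ! ℕ.* divisorSum size m) (m ! ℕ.* n) m!*n≤) (cong₂ ℚ._-_ (ℕ→ℚ-* (m !) (divisorSum size m))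
    (trans (ℕ→ℚ-* (m !) n) (cong (f ℚ.*_) (ℕ→ℚ-subtract 1 n (sym size≡1+n)))))
    where
    m!*n≤ : m ! ℕ.* n ≤ m ! ℕ.* divisorSum size m
    -- The difference S is not truncated: by `Σ-proportional-rank1`, taken at the identity
    -- permutation, its first term is its second term plus a natural number.
    m!*n≤ = subst (m ! ℕ.* n ≤_) (Σ-proportional-rank1 (Vec.allFin m) (λ i j eq → trans (sym (lookup-allFin i)) (trans eq (lookup-allFin j)))) (ℕ.m≤m+n _ _)

  P≢0 : Q ℚ.- q ≢ 0ℚ
  P≢0 = subst (_≢ 0ℚ) P≡ (ℕ→ℚ≢0 P (ℕ.m<n⇒0<n∸m q<q^m))

  L≢0 : Q ℚ.- ℕ→ℚ 1 ≢ 0ℚ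
  L≢0 = subst (_≢ 0ℚ) L≡ (ℕ→ℚ≢0 L (ℕ.+-cancelˡ-< 1 0 L (subst (1 <_) (sym (length-matsOfRank1 m)) (ℕ.<-trans 1<size q<q^m))))

  rhs-scaled : rhs size ℓ m ℚ.* ((Q ℚ.- q) ℚ.* (Q ℚ.- ℕ→ℚ 1)) ≡
    f ℚ.* (Qₗ ℚ.- q) ℚ.* (Q ℚ.- ℕ→ℚ 1) ℚ.+ f ℚ.* (Q ℚ.- Qₗ) ℚ.* (D ℚ.- q ℚ.+ ℕ→ℚ 1)
  rhs-scaled = trans
    (solve 5 (λ a b c p l → (a :+ b :* c) :* (p :* l) := a :* p :* l :+ b :* (l :* p) :* c) refl
      ((f ℚ.* (Qₗ ℚ.- q)) ÷₀ (Q ℚ.- q)) ((f ℚ.* (Q ℚ.- Qₗ)) ÷₀ ((Q ℚ.- ℕ→ℚ 1) ℚ.* (Q ℚ.- q)))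
      (D ℚ.- q ℚ.+ ℕ→ℚ 1) (Q ℚ.- q) (Q ℚ.- ℕ→ℚ 1))
    (cong₂ (λ u v → u ℚ.* (Q ℚ.- ℕ→ℚ 1) ℚ.+ v ℚ.* (D ℚ.- q ℚ.+ ℕ→ℚ 1))
      (÷₀-* (f ℚ.* (Qₗ ℚ.- q)) P≢0) (÷₀-* (f ℚ.* (Q ℚ.- Qₗ)) (*-≢0 L≢0 P≢0)))
    where open ℚSolver.+-*-Solver

  expectedNsol≡rhs : expectedNsol ℓ m ≡ rhs size ℓ m
  expectedNsol≡rhs = *-cancelʳ-≢0 (*-≢0 P≢0 L≢0) (begin
    expectedNsol ℓ m ℚ.* ((Q ℚ.- q) ℚ.* (Q ℚ.- ℕ→ℚ 1))
      ≡⟨ cong₂ (λ p l → expectedNsol ℓ m ℚ.* (p ℚ.* l)) P≡ L≡ ⟨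
    expectedNsol ℓ m ℚ.* (ℕ→ℚ P ℚ.* ℕ→ℚ L)
      ≡⟨ expectation ⟩
    ℕ→ℚ (S ℕ.* X ℕ.+ L ℕ.* (m ! ℕ.* Y))
      ≡⟨ trans (ℕ→ℚ-+ (S ℕ.* X) _) (cong₂ ℚ._+_ (ℕ→ℚ-* S X) (trans (ℕ→ℚ-* L (m ! ℕ.* Y)) (cong (ℕ→ℚ L ℚ.*_) (ℕ→ℚ-* (m !) Y)))) ⟩
    ℕ→ℚ S ℚ.* ℕ→ℚ X ℚ.+ ℕ→ℚ L ℚ.* (f ℚ.* ℕ→ℚ Y)
      ≡⟨ cong₂ ℚ._+_ (cong₂ ℚ._*_ S≡ X≡) (cong₂ (λ l y → l ℚ.* (f ℚ.* y)) L≡ Y≡) ⟩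
    (f ℚ.* D ℚ.- f ℚ.* (q ℚ.- ℕ→ℚ 1)) ℚ.* (Q ℚ.- Qₗ) ℚ.+ (Q ℚ.- ℕ→ℚ 1) ℚ.* (f ℚ.* (Qₗ ℚ.- q))
      ≡⟨ solve 7 (λ f D q one x y l → (f :* D :- f :* (q :- one)) :* x :+ l :* (f :* y) := f :* y :* l :+ f :* x :* (D :- q :+ one)) refl f D q (ℕ→ℚ 1) (Q ℚ.- Qₗ) (Qₗ ℚ.- q) (Q ℚ.- ℕ→ℚ 1) ⟩
    f ℚ.* (Qₗ ℚ.- q) ℚ.* (Q ℚ.- ℕ→ℚ 1) ℚ.+ f ℚ.* (Q ℚ.- Qₗ) ℚ.* (D ℚ.- q ℚ.+ ℕ→ℚ 1)
      ≡⟨ rhs-scaled ⟨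
    rhs size ℓ m ℚ.* ((Q ℚ.- q) ℚ.* (Q ℚ.- ℕ→ℚ 1)) ∎)
    where open ℚSolver.+-*-Solver

theorem3 : (F : FiniteField) (ℓ m : ℕ) → 0 < ℓ → ℓ < m →
    LinAlg.expectedNsol F ℓ m ≡ rhs (FiniteField.size F) ℓ m
theorem3 = Expectation.expectedNsol≡rhs
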